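{- Let $K$ be a finite $k$-dimensional simplicial complex with $k\ge1$, let $D$ be the maximum upper degree of a ridge of $K$, and let $\rho$ be a ridge of degree $D$. Then $\rho$ is clean if and only if $Sx_\rho=(D-1)x_\rho$, where $S=S(K)$ is the signed facet-adjacency matrix and $x_\rho$ is the fan vector of $\rho$. Consequently, if $\lambda_1(L^{\mathrm{up}}_{k-1}(K))=D+k$, then every ridge of degree $D$ is clean.
   Context: A simplicial complex $K$ on a finite vertex set is a collection of subsets closed under taking subsets; a face with $m+1$ vertices has dimension $m$, and $K_j$ is the set of $j$-dimensional faces; $K$ is $k$-dimensional if $k$ is the largest dimension of a face. The $k$-faces are called facets and the $(k-1)$-faces ridges. The (upper) degree of a ridge $\rho$ is $d(\rho)=|\{F\in K_k:\rho\subset F\}|$. Choose an orientation (an ordering of the vertices, up to even permutations) of each face. The boundary matrix $B_k=([\sigma:F])_{\sigma\in K_{k-1},F\in K_k}$ has $[\sigma:F]=0$ if $\sigma\not\subset F$, and if $F=[v_0,\dots,v_k]$ and $\sigma=F\setminus\{v_i\}$ then $[\sigma:F]=(-1)^i\operatorname{sgn}(\pi)$, where $\pi$ is the permutation carrying $(v_0,\dots,\widehat{v_i},\dots,v_k)$ to the chosen ordering of $\sigma$. The up-Laplacian is $L^{\mathrm{up}}_{k-1}(K)=B_kB_k^{\mathsf T}$, and $\lambda_1$ denotes the largest eigenvalue. Two distinct facets $F,G$ are adjacent if they share a ridge $R=F\cap G$; then $\varepsilon(F,G)=[R:F][R:G]\in\{\pm1\}$. $S=S(K)$ is the symmetric matrix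 indexed by $K_k$ with zero diagonal, $S_{F,G}=\varepsilon(F,G)$ if $F,G$ are adjacent, and $S_{F,G}=0$ otherwise. For a ridge $\rho$ of degree $D$, its fan is $\mathcal F_\rho=\{F\in K_k:\rho\subset F\}$, and its fan vector $x_\rho\in\mathbb R^{K_k}$ has $(x_\rho)_F=[\rho:F]$ if $\rho\subset F$ and $(x_\rho)_F=0$ otherwise. The ridge $\rho$ is clean if every facet outside $\mathcal F_\rho$ is adjacent to either zero or two members of $\mathcal F_\rho$. -}

module Defs where

open import Level using (0ℓ)
open import Algebra.Bundles using (RawRing)
import Algebra.Definitions.RawMonoid as RawMonoidDefs
open import Data.Bool using (true; false; if_then_else_)
open import Data.Fin as Fin using (Fin; zero; suc; toℕ; punchIn; punchOut)
open import Data.Fin.Permutation using (Permutation′; permutation; _⟨$⟩ʳ_)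
open import Data.Fin.Properties
  using (any?; punchInᵢ≢i; punchIn-injective; punchIn-punchOut)
open import Data.Fin.Subset using (Subset; inside; outside; _∈_; _⊆_; _∩_; _-_; ∣_∣)
open import Data.Fin.Subset.Properties using (_⊆?_; x∈p∧x≢y⇒x∈p-y; p─q⊆p)
open import Data.Integer as ℤ using (ℤ; 0ℤ; -1ℤ)
open import Data.List using (List; []; _∷_; _++_; map; length; lookup; filter; allFin; cartesianProduct)
open import Data.Nat as ℕ using (ℕ; zero; suc; _≤_; _⊔_)
import Data.Nat.Properties as ℕ
open import Data.Product using (∃; _×_; _,_; proj₁; proj₂)
open import Data.Rational as ℚ using (ℚ; 0ℚ; 1ℚ; ½)
import Data.Rational.Properties as ℚ
open import Data.Sum using (_⊎_)
import Data.Bool.Properties as Bool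
import Data.Vec as Vec
import Data.Vec.Properties as Vec
open import Data.Vec.Functional using (Vector; transpose)
open import Function using (_∘_; Injective)
open import Relation.Binary.Definitions using (DecidableEquality)
open import Relation.Binary.PropositionalEquality
  using (_≡_; _≢_; refl; sym; trans; cong; cong₂; subst)
open import Relation.Nullary using (¬_; Dec; yes; no; does; ¬?; _×-dec_)
open import Relation.Unary using (Pred; Decidable)

-- ℝ consists of Cauchy sequences of rationals with an explicit modulus; its
-- equality is the setoid relation _≃ᵣ_, not _≡_.

IsCauchy : (ℕ → ℚ) → Set
IsCauchy s = ∀ ε → 0ℚ ℚ.< ε →
  ∃ λ N → ∀ m n → N ≤ m → N ≤ n → ℚ.∣ s m ℚ.- s n ∣ ℚ.< ε

record ℝ : Set where
  constructor mkℝ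
  field
    seq    : ℕ → ℚ
    cauchy : IsCauchy seq

open ℝ public

infix 4 _≃ᵣ_ _≤ᵣ_

_≃ᵣ_ : ℝ → ℝ → Set
x ≃ᵣ y = ∀ ε → 0ℚ ℚ.< ε → ∃ λ N → ∀ n → N ≤ n → ℚ.∣ seq x n ℚ.- seq y n ∣ ℚ.< ε

_≤ᵣ_ : ℝ → ℝ → Set
x ≤ᵣ y = ∀ ε → 0ℚ ℚ.< ε → ∃ λ N → ∀ n → N ≤ n → seq x n ℚ.< seq y n ℚ.+ ε

fromℚ : ℚ → ℝ
fromℚ q = mkℝ (λ _ → q) λ ε 0<ε →
  0 , λ _ _ _ _ → subst (λ z → ℚ.∣ z ∣ ℚ.< ε) (sym (ℚ.+-inverseʳ q)) 0<ε

fromℤ : ℤ → ℝ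
fromℤ z = fromℚ (z ℚ./ 1)

module _ where
  open import Data.Rational using (_+_; _*_; -_; _<_; positive) renaming (∣_∣ to abs; _-_ to _−_)
  open ℚ.≤-Reasoning

  private
    regroup : ∀ a b c d → (a + b) − (c + d) ≡ (a − c) + (b − d)
    regroup a b c d = begin-equality
      (a + b) + - (c + d)      ≡⟨ cong (λ z → (a + b) + z) (ℚ.neg-distrib-+ c d) ⟩
      (a + b) + (- c + - d)    ≡⟨ ℚ.+-assoc a b _ ⟩
      a + (b + (- c + - d))    ≡⟨ cong (a +_) (sym (ℚ.+-assoc b (- c) (- d))) ⟩
      a + ((b + - c) + - d)    ≡⟨ cong (λ z → a + (z + - d)) (ℚ.+-comm b (- c)) ⟩
      a + ((- c + b) + - d)    ≡⟨ cong (a +_) (ℚ.+-assoc (- c) b (- d)) ⟩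
      a + (- c + (b + - d))    ≡⟨ sym (ℚ.+-assoc a (- c) _) ⟩
      (a + - c) + (b + - d)    ∎

    telescope : ∀ a b c → (a − b) + (b − c) ≡ a − c
    telescope a b c = begin-equality
      (a + - b) + (b + - c)  ≡⟨ ℚ.+-assoc a (- b) _ ⟩
      a + (- b + (b + - c))  ≡⟨ cong (a +_) (sym (ℚ.+-assoc (- b) b (- c))) ⟩
      a + ((- b + b) + - c)  ≡⟨ cong (λ z → a + (z + - c)) (ℚ.+-inverseˡ b) ⟩
      a + (0ℚ + - c)         ≡⟨ cong (a +_) (ℚ.+-identityˡ (- c)) ⟩
      a + - c                ∎

    product-diff : ∀ a b c d → a * b − c * d ≡ a * (b − d) + (a − c) * d
    product-diff a b c d = begin-equality
      a * b − c * d                        ≡⟨ sym (telescope (a * b) (a * d) (c * d)) ⟩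
      (a * b − a * d) + (a * d − c * d)    ≡⟨ cong₂ _+_
           (cong (a * b +_) (ℚ.neg-distribʳ-* a d))
           (cong (a * d +_) (ℚ.neg-distribˡ-* c d)) ⟩
      (a * b + a * - d) + (a * d + - c * d) ≡⟨ cong₂ _+_ (sym (ℚ.*-distribˡ-+ a b (- d)))
                                                         (sym (ℚ.*-distribʳ-+ d a (- c))) ⟩
      a * (b − d) + (a − c) * d            ∎

    halve : ∀ ε → ε * ½ + ε * ½ ≡ ε
    halve ε = trans (sym (ℚ.*-distribˡ-+ ε ½ ½)) (ℚ.*-identityʳ ε)

    half-pos : ∀ ε → 0ℚ < ε → 0ℚ < ε * ½
    half-pos ε 0<ε = subst (_< ε * ½) (ℚ.*-zeroˡ ½) (ℚ.*-monoˡ-<-pos ½ 0<ε)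

  +-cauchy : ∀ s t → IsCauchy s → IsCauchy t → IsCauchy (λ n → s n + t n)
  +-cauchy s t cs ct ε 0<ε
    with cs (ε * ½) (half-pos ε 0<ε) | ct (ε * ½) (half-pos ε 0<ε)
  ... | M , hs | N , ht = M ⊔ N , λ m n p q → begin-strict
      abs ((s m + t m) − (s n + t n))        ≡⟨ cong abs (regroup (s m) (t m) (s n) (t n)) ⟩
      abs ((s m − s n) + (t m − t n))        ≤⟨ ℚ.∣p+q∣≤∣p∣+∣q∣ (s m − s n) (t m − t n) ⟩
      abs (s m − s n) + abs (t m − t n)      <⟨ ℚ.+-mono-<
          (hs m n (ℕ.m⊔n≤o⇒m≤o M N p) (ℕ.m⊔n≤o⇒m≤o M N q))
          (ht m n (ℕ.m⊔n≤o⇒n≤o M N p) (ℕ.m⊔n≤o⇒n≤o M N q)) ⟩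
      ε * ½ + ε * ½                          ≡⟨ halve ε ⟩
      ε                                      ∎

  neg-cauchy : ∀ s → IsCauchy s → IsCauchy (λ n → - s n)
  neg-cauchy s cs ε 0<ε with cs ε 0<ε
  ... | N , h = N , λ m n p q → begin-strict
      abs (- s m − - s n)    ≡⟨ cong abs (sym (ℚ.neg-distrib-+ (s m) (- s n))) ⟩
      abs (- (s m − s n))    ≡⟨ ℚ.∣-p∣≡∣p∣ (s m − s n) ⟩
      abs (s m − s n)        <⟨ h m n p q ⟩
      ε                      ∎

  eventually-bounded : ∀ s → IsCauchy s →
    ∃ λ A → 0ℚ < A × ∃ λ N → ∀ n → N ≤ n → abs (s n) < A
  eventually-bounded s cs with cs 1ℚ (ℚ.positive⁻¹ 1ℚ)
  ... | N , h = 1ℚ + abs (s N) , 0<A , N , bound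
    where
    0<A : 0ℚ < 1ℚ + abs (s N)
    0<A = ℚ.+-mono-<-≤ (ℚ.positive⁻¹ 1ℚ) (ℚ.0≤∣p∣ (s N))

    split : ∀ a b → a ≡ (a − b) + b
    split a b = sym (trans (ℚ.+-assoc a (- b) b)
      (trans (cong (a +_) (ℚ.+-inverseˡ b)) (ℚ.+-identityʳ a)))

    bound : ∀ n → N ≤ n → abs (s n) < 1ℚ + abs (s N)
    bound n N≤n = begin-strict
      abs (s n)                      ≡⟨ cong abs (split (s n) (s N)) ⟩
      abs ((s n − s N) + s N)        ≤⟨ ℚ.∣p+q∣≤∣p∣+∣q∣ (s n − s N) (s N) ⟩
      abs (s n − s N) + abs (s N)    <⟨ ℚ.+-monoˡ-< (abs (s N)) (h n N N≤n ℕ.≤-refl) ⟩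
      1ℚ + abs (s N)                 ∎

  *-cauchy : ∀ s t → IsCauchy s → IsCauchy t → IsCauchy (λ n → s n * t n)
  *-cauchy s t cs ct ε 0<ε
    with eventually-bounded s cs | eventually-bounded t ct
  ... | A , 0<A , M₁ , hA | B , 0<B , N₁ , hB = go
    where
    instance
      A-pos = positive 0<A
      B-pos = positive 0<B
      C-pos = ℚ.pos+pos⇒pos A B
      C-nonZero = ℚ.pos⇒nonZero (A + B)
      1/C-pos = ℚ.1/pos⇒pos (A + B)

    δ : ℚ
    δ = ε * ℚ.1/ (A + B)

    0<δ : 0ℚ < δ
    0<δ = subst (_< δ) (ℚ.*-zeroˡ (ℚ.1/ (A + B))) (ℚ.*-monoˡ-<-pos (ℚ.1/ (A + B)) 0<ε)

    total : A * δ + δ * B ≡ ε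
    total = begin-equality
      A * δ + δ * B                  ≡⟨ cong (_+ δ * B) (ℚ.*-comm A δ) ⟩
      δ * A + δ * B                  ≡⟨ sym (ℚ.*-distribˡ-+ δ A B) ⟩
      ε * ℚ.1/ (A + B) * (A + B)     ≡⟨ ℚ.*-assoc ε _ _ ⟩
      ε * (ℚ.1/ (A + B) * (A + B))   ≡⟨ cong (ε *_) (ℚ.*-inverseˡ (A + B)) ⟩
      ε * 1ℚ                         ≡⟨ ℚ.*-identityʳ ε ⟩
      ε                              ∎

    go : ∃ λ K → ∀ m n → K ≤ m → K ≤ n → abs (s m * t m − s n * t n) < ε
    go with cs δ 0<δ | ct δ 0<δ
    ... | M₂ , hs | N₂ , ht = (M₁ ⊔ N₁) ⊔ (M₂ ⊔ N₂) , λ m n p q →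
      let p₁ = ℕ.m⊔n≤o⇒m≤o (M₁ ⊔ N₁) (M₂ ⊔ N₂) p
          p₂ = ℕ.m⊔n≤o⇒n≤o (M₁ ⊔ N₁) (M₂ ⊔ N₂) p
          q₁ = ℕ.m⊔n≤o⇒m≤o (M₁ ⊔ N₁) (M₂ ⊔ N₂) q
          q₂ = ℕ.m⊔n≤o⇒n≤o (M₁ ⊔ N₁) (M₂ ⊔ N₂) q
          ds = hs m n (ℕ.m⊔n≤o⇒m≤o M₂ N₂ p₂) (ℕ.m⊔n≤o⇒m≤o M₂ N₂ q₂)
          dt = ht m n (ℕ.m⊔n≤o⇒n≤o M₂ N₂ p₂) (ℕ.m⊔n≤o⇒n≤o M₂ N₂ q₂)
          sm = hA m (ℕ.m⊔n≤o⇒m≤o M₁ N₁ p₁)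
          tn = hB n (ℕ.m⊔n≤o⇒n≤o M₁ N₁ q₁)
      in begin-strict
        abs (s m * t m − s n * t n)
          ≡⟨ cong abs (product-diff (s m) (t m) (s n) (t n)) ⟩
        abs (s m * (t m − t n) + (s m − s n) * t n)
          ≤⟨ ℚ.∣p+q∣≤∣p∣+∣q∣ (s m * (t m − t n)) ((s m − s n) * t n) ⟩
        abs (s m * (t m − t n)) + abs ((s m − s n) * t n)
          ≡⟨ cong₂ _+_ (ℚ.∣p*q∣≡∣p∣*∣q∣ (s m) (t m − t n)) (ℚ.∣p*q∣≡∣p∣*∣q∣ (s m − s n) (t n)) ⟩
        abs (s m) * abs (t m − t n) + abs (s m − s n) * abs (t n)
          ≤⟨ ℚ.+-mono-≤
               (ℚ.*-monoʳ-≤-nonNeg (abs (t m − t n)) {{ℚ.∣-∣-nonNeg (t m − t n)}} (ℚ.<⇒≤ sm))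
               (ℚ.*-monoˡ-≤-nonNeg (abs (s m − s n)) {{ℚ.∣-∣-nonNeg (s m − s n)}} (ℚ.<⇒≤ tn)) ⟩
        A * abs (t m − t n) + abs (s m − s n) * B
          <⟨ ℚ.+-mono-< (ℚ.*-monoʳ-<-pos A dt) (ℚ.*-monoˡ-<-pos B ds) ⟩
        A * δ + δ * B
          ≡⟨ total ⟩
        ε ∎

ℝ-rawRing : RawRing 0ℓ 0ℓ
ℝ-rawRing = record
  { Carrier = ℝ
  ; _≈_     = _≃ᵣ_
  ; _+_     = λ x y → mkℝ (λ n → seq x n ℚ.+ seq y n) (+-cauchy (seq x) (seq y) (cauchy x) (cauchy y))
  ; _*_     = λ x y → mkℝ (λ n → seq x n ℚ.* seq y n) (*-cauchy (seq x) (seq y) (cauchy x) (cauchy y))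
  ; -_      = λ x → mkℝ (λ n → ℚ.- seq x n) (neg-cauchy (seq x) (cauchy x))
  ; 0#      = fromℚ 0ℚ
  ; 1#      = fromℚ 1ℚ
  }

Matrix : Set → ℕ → ℕ → Set
Matrix A m n = Fin m → Fin n → A

module LinearAlgebra (R : RawRing 0ℓ 0ℓ) where
  open RawRing R
  open RawMonoidDefs +-rawMonoid public using (sum)

  infixl 7 _*ᴹ_ _*ᵛ_
  infixr 7 _•_
  infix  4 _≋_

  _*ᴹ_ : ∀ {m n p} → Matrix Carrier m n → Matrix Carrier n p → Matrix Carrier m p
  (A *ᴹ B) i j = sum (λ l → A i l * B l j)

  _*ᵛ_ : ∀ {m n} → Matrix Carrier m n → Vector Carrier n → Vector Carrier m
  (A *ᵛ x) i = sum (λ j → A i j * x j)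

  _•_ : ∀ {n} → Carrier → Vector Carrier n → Vector Carrier n
  (c • x) i = c * x i

  _≋_ : ∀ {n} → Vector Carrier n → Vector Carrier n → Set
  x ≋ y = ∀ i → x i ≈ y i

open LinearAlgebra ℤ.+-*-rawRing public using () renaming (_*ᴹ_ to _*ℤᴹ_)
open LinearAlgebra ℝ-rawRing public using (_*ᵛ_; _•_; _≋_)

realMatrix : ∀ {m n} → Matrix ℤ m n → Matrix ℝ m n
realMatrix A i j = fromℤ (A i j)

-- Nonzero means "not ≋ 0"; on ℝ this is implied by apartness from 0, so it
-- admits every eigenvector and makes the bound in IsLargestEigenvalue cover all
-- of them.
IsEigenvalue : ∀ {m} → Matrix ℝ m m → ℝ → Set
IsEigenvalue {m} A μ =
  ∃ λ (x : Vector ℝ m) → ¬ (x ≋ λ _ → fromℚ 0ℚ) × (A *ᵛ x) ≋ μ • x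

IsLargestEigenvalue : ∀ {m} → Matrix ℝ m m → ℝ → Set
IsLargestEigenvalue A μ = IsEigenvalue A μ × (∀ ν → IsEigenvalue A ν → ν ≤ᵣ μ)

count : ∀ {m} {P : Pred (Fin m) 0ℓ} → Decidable P → ℕ
count {m} P? = length (filter P? (allFin m))

x∉p-x : ∀ {n} (p : Subset n) x → ¬ (x ∈ p - x)
x∉p-x (false Vec.∷ p) zero    ()
x∉p-x (true  Vec.∷ p) zero    ()
x∉p-x (_     Vec.∷ p) (suc x) (Vec.there x∈) = x∉p-x p x x∈

infix 4 _≟ˢ_

_≟ˢ_ : ∀ {n} → DecidableEquality (Subset n)
_≟ˢ_ = Vec.≡-dec Bool._≟_

subsets : ∀ n → List (Subset n)
subsets zero    = Vec.[] ∷ []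
subsets (suc n) = map (inside Vec.∷_) (subsets n) ++ map (outside Vec.∷_) (subsets n)

record SimplicialComplex (n : ℕ) : Set₁ where
  field
    IsFace      : Pred (Subset n) 0ℓ
    isFace?     : Decidable IsFace
    down-closed : ∀ {s t} → s ⊆ t → IsFace t → IsFace s

open SimplicialComplex public

-- Faces are graded by their number m of vertices, so that K_j corresponds to
-- m = suc j.  The list has no repetitions, so its positions index K_j.
faceList : ∀ {n} → SimplicialComplex n → ℕ → List (Subset n)
faceList {n} K m = filter (λ s → isFace? K s ×-dec (∣ s ∣ ℕ.≟ m)) (subsets n)

#faces : ∀ {n} → SimplicialComplex n → ℕ → ℕ
#faces K m = length (faceList K m)

Face : ∀ {n} → SimplicialComplex n → ℕ → Set
Face K m = Fin (#faces K m)

vertices : ∀ {n} (K : SimplicialComplex n) m → Face K m → Subset n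
vertices K m = lookup (faceList K m)

HasDimension : ∀ {n} → SimplicialComplex n → ℕ → Set
HasDimension K k =
  (∃ λ s → IsFace K s × ∣ s ∣ ≡ suc k) × (∀ s → IsFace K s → ∣ s ∣ ≤ suc k)

record VertexOrdering {n} (s : Subset n) (m : ℕ) : Set where
  field
    vertex    : Fin m → Fin n
    vertex-∈  : ∀ i → vertex i ∈ s
    injective : Injective _≡_ _≡_ vertex
    onto      : ∀ {v} → v ∈ s → ∃ λ i → vertex i ≡ v

  position : ∀ {v} → v ∈ s → Fin m
  position = proj₁ ∘ onto

open VertexOrdering public

-- An orientation is given by a representative of its class modulo even
-- permutations.
Orientation : ∀ {n} → SimplicialComplex n → Set
Orientation K = ∀ m (σ : Face K m) → VertexOrdering (vertices K m σ) m

-- (v₀,…,vₘ) ↦ (v₀,…,v̂ᵢ,…,vₘ)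
omit : ∀ {n} {s : Subset n} {m} (a : VertexOrdering s (suc m)) (i : Fin (suc m)) →
       VertexOrdering (s - vertex a i) m
omit {s = s} {m} a i = record
  { vertex    = vertex a ∘ punchIn i
  ; vertex-∈  = λ j → x∈p∧x≢y⇒x∈p-y (vertex-∈ a (punchIn i j))
                        (punchInᵢ≢i i j ∘ injective a)
  ; injective = punchIn-injective i _ _ ∘ injective a
  ; onto      = onto′
  }
  where
  onto′ : ∀ {v} → v ∈ s - vertex a i → ∃ λ j → vertex a (punchIn i j) ≡ v
  onto′ {v} v∈ with onto a (p─q⊆p s _ v∈)
  ... | l , refl = punchOut i≢l , cong (vertex a) (punchIn-punchOut i≢l)
    where
    i≢l : i ≢ l
    i≢l refl = x∉p-x s _ v∈

-- The permutation π with bⱼ = a_{π j}.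
carrying : ∀ {n} {s t : Subset n} {m} → VertexOrdering s m → VertexOrdering t m → s ≡ t →
           Permutation′ m
carrying a b refl = permutation
  (λ j → position a (vertex-∈ b j))
  (λ j → position b (vertex-∈ a j))
  (λ j → injective a (trans (proj₂ (onto a _)) (proj₂ (onto b _))))
  (λ j → injective b (trans (proj₂ (onto b _)) (proj₂ (onto a _))))

inversions : ∀ {m} → Permutation′ m → ℕ
inversions {m} π = length (filter
  (λ (i , j) → (i Fin.<? j) ×-dec ((π ⟨$⟩ʳ j) Fin.<? (π ⟨$⟩ʳ i)))
  (cartesianProduct (allFin m) (allFin m)))

sgn : ∀ {m} → Permutation′ m → ℤ
sgn π = -1ℤ ℤ.^ inversions π

module _ {n} (K : SimplicialComplex n) (k : ℕ) where

  Facet : Set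
  Facet = Face K (suc k)

  Ridge : Set
  Ridge = Face K k

  facet : Facet → Subset n
  facet = vertices K (suc k)

  ridge : Ridge → Subset n
  ridge = vertices K k

  InFan : Ridge → Pred Facet 0ℓ
  InFan ρ F = ridge ρ ⊆ facet F

  inFan? : ∀ ρ → Decidable (InFan ρ)
  inFan? ρ F = ridge ρ ⊆? facet F

  degree : Ridge → ℕ
  degree ρ = count (inFan? ρ)

  IsMaximumDegree : ℕ → Set
  IsMaximumDegree D = (∃ λ ρ → degree ρ ≡ D) × (∀ ρ → degree ρ ≤ D)

  Adjacent : Facet → Facet → Set
  Adjacent F G = F ≢ G × ∃ λ (R : Ridge) → ridge R ≡ facet F ∩ facet G

  adjacent? : ∀ F G → Dec (Adjacent F G)
  adjacent? F G = ¬? (F Fin.≟ G) ×-dec any? (λ R → ridge R ≟ˢ (facet F ∩ facet G))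

  fanNeighbours : Ridge → Facet → ℕ
  fanNeighbours ρ F = count (λ G → inFan? ρ G ×-dec adjacent? F G)

  Clean : Ridge → Set
  Clean ρ = ∀ F → ¬ InFan ρ F → fanNeighbours ρ F ≡ 0 ⊎ fanNeighbours ρ F ≡ 2

  module _ (o : Orientation K) where

    -- [σ : F].  By cardinality, σ ⊂ F exactly when σ = F ∖ {vᵢ} for some i.
    incidence : Ridge → Facet → ℤ
    incidence σ F with any? (λ i → (facet F - vertex (o (suc k) F) i) ≟ˢ ridge σ)
    ... | yes (i , F-vᵢ≡σ) =
          (-1ℤ ℤ.^ toℕ i) ℤ.* sgn (carrying (omit (o (suc k) F) i) (o k σ) F-vᵢ≡σ)
    ... | no _ = 0ℤ

    boundary : Matrix ℤ (#faces K k) (#faces K (suc k))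
    boundary = incidence

    upLaplacian : Matrix ℤ (#faces K k) (#faces K k)
    upLaplacian = boundary *ℤᴹ transpose boundary

    -- R is the shared ridge F ∩ G.
    signedAdjacency : Matrix ℤ (#faces K (suc k)) (#faces K (suc k))
    signedAdjacency F G with adjacent? F G
    ... | yes (_ , R , _) = incidence R F ℤ.* incidence R G
    ... | no _            = 0ℤ

    fanVector : Ridge → Vector ℝ (#faces K (suc k))
    fanVector ρ F = if does (inFan? ρ F) then fromℤ (incidence ρ F) else fromℤ 0ℤ

-- If σ = F ∖ v, then [σ : F] is (−1)^r up to one sign depending on σ alone and
-- one depending on F alone, where r is the number of vertices of F below v.  It
-- follows that, for a facet F outside the fan, the non-zero terms of (S x_ρ)_F
-- are units any two of which are opposite.  So there are at most two of them, and
-- they cancel if and only if their number is 0 or 2.  In the rows of the fan,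
-- (S x_ρ)_F = (D − 1) (x_ρ)_F holds for every ridge.
--
-- For the second part, BᵀB = (k + 1) I + S, so y = B x_ρ and t = (S − (D − 1)) x_ρ
-- satisfy yᵀLy = (D + k) |y|² + |t|², and t = 0 once yᵀLy ≤ (D + k) |y|².  This
-- Rayleigh bound is proved by contradiction, being an inequality of rationals.
-- Semidefiniteness of rational matrices is decidable, so if the bound fails at
-- some vector, bisection produces a real λ > D + k such that λ − L is positive
-- semidefinite but not coercive.  Eliminating one variable at a time by Schur
-- complements shows that such a matrix has a kernel; this takes finitely many
-- case distinctions on reals, which are available under double negation.  Hence
-- λ is an eigenvalue exceeding D + k.

module Submission where

open import Defs
open import Algebra.Bundles using (CommutativeMonoid; CommutativeRing; RawRing)
open import Data.Bool using (if_then_else_; true; false)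
open import Data.Empty using (⊥-elim)
open import Data.Product using (∃; _×_; _,_; proj₁; proj₂)
open import Data.Sum using (_⊎_; inj₁; inj₂)
open import Function using (_∘_; id; Injective; _⇔_; mk⇔; Equivalence)
open import Level using (0ℓ)
open import Relation.Binary.PropositionalEquality
open import Relation.Nullary using (¬_; Dec; yes; no; does; contradiction; ¬?; _×-dec_; ¬¬-excluded-middle)
open import Relation.Unary using (Pred; Decidable)

-- Why the terms are opposite: a facet F outside the fan that has a neighbour in it contains all
-- vertices of ρ but one, and has exactly two further vertices a and b. Its possible fan neighbours
-- are therefore ρ ∪ {a} and ρ ∪ {b}. Passing from one to the other exchanges a and b, and the only
-- part of the sign not symmetric under this exchange records which of the two vertices is smaller.
--
-- Why the Rayleigh bound is laborious: the hypothesis speaks only of numbers that come with an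
-- eigenvector, so a violation of the bound has to be turned into an actual kernel vector.
-- Maximising over the unit sphere does not produce one constructively; elimination does, because a
-- kernel vector of a Schur complement lifts explicitly. The alternative to a kernel is coercivity,
-- uniform along the approximations, and the bisection witnesses refute it even though they need not
-- converge.
--
-- Algebra on reals is carried out at a fixed index of the approximating sequences, where it is
-- algebra over ℚ.

module SingleTerm {c ℓ} (M : CommutativeMonoid c ℓ) where
  open import Data.Fin using (punchIn)
  open import Data.Fin.Properties using (punchInᵢ≢i)
  open import Data.Nat using (suc)
  open import Data.Vec.Functional using (Vector)
  open CommutativeMonoid M using (Carrier; _≈_; ε; ∙-congˡ; identityʳ) renaming (trans to ≈-trans)
  open import Algebra.Properties.CommutativeMonoid.Sum M

  sum-zero : ∀ {n} {f : Vector Carrier n} → (∀ i → f i ≈ ε) → sum f ≈ ε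
  sum-zero {n} f≈0 = ≈-trans (sum-cong-≋ f≈0) (sum-replicate-zero n)

  sum-single : ∀ {n} (f : Vector Carrier n) j → (∀ i → i ≢ j → f i ≈ ε) → sum f ≈ f j
  sum-single {suc n} f j rest = ≈-trans (sum-remove f)
    (≈-trans (∙-congˡ (sum-zero λ i → rest (punchIn j i) (punchInᵢ≢i j i))) (identityʳ _))

-- Rational quadratic forms and Schur complements

module RayleighBound where
  open import Data.Fin as Fin using (Fin; zero; suc)
  open import Data.Fin.Properties using (all?; ¬∀⟶∃¬)
  open import Data.Integer as ℤ using (ℤ)
  import Data.Integer.Properties as ℤ
  open import Data.Maybe using (Maybe; just; nothing)
  open import Data.Nat as ℕ using (ℕ; zero; suc)
  import Data.Nat.Properties as ℕ
  open import Data.Rational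
  open import Data.Rational.Properties
  import Data.Rational.Unnormalised as ℚᵘ
  import Data.Rational.Unnormalised.Properties as ℚᵘ
  open import Data.Vec.Functional using (Vector; _∷_)
  open import Relation.Binary.Definitions using (tri<; tri≈; tri>)
  open import Tactic.RingSolver using (solve-∀)
  open import Tactic.RingSolver.Core.AlmostCommutativeRing using (AlmostCommutativeRing; fromCommutativeRing)
  open import Algebra.Properties.Semiring.Sum (CommutativeRing.semiring +-*-commutativeRing)
  open SingleTerm +-0-commutativeMonoid
  open LinearAlgebra +-*-rawRing public using () renaming (_*ᵛ_ to _*ℚᵛ_)

  ℚ-ring : AlmostCommutativeRing 0ℓ 0ℓ
  ℚ-ring = fromCommutativeRing +-*-commutativeRing isZero
    where
    isZero : ∀ x → Maybe (0ℚ ≡ x)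
    isZero x with 0ℚ ≟ x
    ... | yes 0≡x = just 0≡x
    ... | no _    = nothing

  p<q⇒0<q-p : ∀ {p q} → p < q → 0ℚ < q - p
  p<q⇒0<q-p {p} {q} p<q = subst (_< q - p) (+-inverseʳ p) (+-monoˡ-< (- p) p<q)

  p≤q⇒0≤q-p : ∀ {p q} → p ≤ q → 0ℚ ≤ q - p
  p≤q⇒0≤q-p {p} {q} p≤q = subst (_≤ q - p) (+-inverseʳ p) (+-monoˡ-≤ (- p) p≤q)

  0≤+ : ∀ {p q} → 0ℚ ≤ p → 0ℚ ≤ q → 0ℚ ≤ p + q
  0≤+ = +-mono-≤

  0≤* : ∀ {p q} → 0ℚ ≤ p → 0ℚ ≤ q → 0ℚ ≤ p * q
  0≤* {p} {q} 0≤p 0≤q = nonNegative⁻¹ (p * q)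
    {{nonNeg*nonNeg⇒nonNeg p {{nonNegative 0≤p}} q {{nonNegative 0≤q}}}}

  0<* : ∀ {p q} → 0ℚ < p → 0ℚ < q → 0ℚ < p * q
  0<* {p} {q} 0<p 0<q = positive⁻¹ (p * q) {{pos*pos⇒pos p {{positive 0<p}} q {{positive 0<q}}}}

  0≤p² : ∀ p → 0ℚ ≤ p * p
  0≤p² p with ≤-total 0ℚ p
  ... | inj₁ 0≤p = 0≤* 0≤p 0≤p
  ... | inj₂ p≤0 = subst (0ℚ ≤_) (square-neg p) (0≤* (neg-antimono-≤ p≤0) (neg-antimono-≤ p≤0))
    where
    square-neg : ∀ p → (- p) * (- p) ≡ p * p
    square-neg = solve-∀ ℚ-ring

  -- The working form of most estimates below: the difference is written as a visibly nonnegative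
  -- expression `r`, and the remaining equation is a polynomial identity for the ring solver.
  ≤-excess : ∀ {p q} r → 0ℚ ≤ r → q ≡ p + r → p ≤ q
  ≤-excess {p} r 0≤r refl = subst (_≤ p + r) (+-identityʳ p) (+-monoʳ-≤ p 0≤r)

  <-excess : ∀ {p q} r → 0ℚ < r → q ≡ p + r → p < q
  <-excess {p} r 0<r refl = subst (_< p + r) (+-identityʳ p) (+-monoʳ-< p 0<r)

  *-cancel-0≤ : ∀ {p q} → 0ℚ < p → 0ℚ ≤ p * q → 0ℚ ≤ q
  *-cancel-0≤ {p} {q} 0<p 0≤pq = *-cancelˡ-≤-pos p {{positive 0<p}} (subst (_≤ p * q) (sym (*-zeroʳ p)) 0≤pq)

  dot : ∀ {n} → Vector ℚ n → Vector ℚ n → ℚ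
  dot v w = sum (λ i → v i * w i)

  quadraticForm : ∀ {n} → Matrix ℚ n n → Vector ℚ n → ℚ
  quadraticForm A v = dot v (A *ℚᵛ v)

  Symmetric : ∀ {A : Set} {n} → Matrix A n n → Set
  Symmetric A = ∀ i j → A i j ≡ A j i

  sum-linear : ∀ {n} p q (f g : Vector ℚ n) →
               sum (λ i → p * f i + q * g i) ≡ p * sum f + q * sum g
  sum-linear p q f g = trans (∑-distrib-+ (λ i → p * f i) (λ i → q * g i))
    (sym (cong₂ _+_ (*-distribˡ-sum p f) (*-distribˡ-sum q g)))

  0≤dot : ∀ {n} (v : Vector ℚ n) → 0ℚ ≤ dot v v
  0≤dot {zero}  v = ≤-refl
  0≤dot {suc n} v = 0≤+ (0≤p² (v zero)) (0≤dot (v ∘ suc))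

  -- The Schur complement of the entry A₀₀, scaled by A₀₀ to avoid a division.
  schur : ∀ {n} → Matrix ℚ (suc n) (suc n) → Matrix ℚ n n
  schur A i j = A zero zero * A (suc i) (suc j) - A zero (suc i) * A zero (suc j)

  schur-symmetric : ∀ {n} (A : Matrix ℚ (suc n) (suc n)) → Symmetric A → Symmetric (schur A)
  schur-symmetric A symA i j = cong₂ (λ c d → A zero zero * c - d)
    (symA (suc i) (suc j)) (*-comm (A zero (suc i)) (A zero (suc j)))

  module SchurComplement {n} (A : Matrix ℚ (suc n) (suc n)) (symA : Symmetric A) where

    a = A zero zero

    b : Vector ℚ n
    b j = A zero (suc j)

    C : Matrix ℚ n n
    C i j = A (suc i) (suc j)

    schur-*ᵛ : ∀ w i → (schur A *ℚᵛ w) i ≡ a * (C *ℚᵛ w) i + - dot b w * b i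
    schur-*ᵛ w i = begin
      sum (λ j → (a * C i j - b i * b j) * w j)
        ≡⟨ sum-cong-≗ (λ j → expand a (C i j) (b i) (b j) (w j)) ⟩
      sum (λ j → a * (C i j * w j) + - b i * (b j * w j))
        ≡⟨ sum-linear a (- b i) (λ j → C i j * w j) (λ j → b j * w j) ⟩
      a * (C *ℚᵛ w) i + - b i * dot b w
        ≡⟨ swap (a * (C *ℚᵛ w) i) (b i) (dot b w) ⟩
      a * (C *ℚᵛ w) i + - dot b w * b i                       ∎
      where
      open ≡-Reasoning
      expand : ∀ a c x y z → (a * c - x * y) * z ≡ a * (c * z) + - x * (y * z)
      expand = solve-∀ ℚ-ring
      swap : ∀ x y z → x + - y * z ≡ x + - z * y
      swap = solve-∀ ℚ-ring

    schur-form : ∀ w → quadraticForm (schur A) w ≡ a * quadraticForm C w + - dot b w * dot b w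
    schur-form w = begin
      sum (λ i → w i * (schur A *ℚᵛ w) i)
        ≡⟨ sum-cong-≗ (λ i → trans (cong (w i *_) (schur-*ᵛ w i)) (expand a (w i) ((C *ℚᵛ w) i) (dot b w) (b i))) ⟩
      sum (λ i → a * (w i * (C *ℚᵛ w) i) + - dot b w * (b i * w i))
        ≡⟨ sum-linear a (- dot b w) (λ i → w i * (C *ℚᵛ w) i) (λ i → b i * w i) ⟩
      a * quadraticForm C w + - dot b w * dot b w                      ∎
      where
      open ≡-Reasoning
      expand : ∀ a x y z u → x * (a * y + - z * u) ≡ a * (x * y) + - z * (u * x)
      expand = solve-∀ ℚ-ring

    form-∷ : ∀ v → let w = v ∘ suc ; x = v zero in
             quadraticForm A v ≡ x * (a * x + dot b w) + (x * dot b w + quadraticForm C w)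
    form-∷ v = cong (x * (a * x + dot b w) +_) (begin
      sum (λ i → w i * (A (suc i) zero * x + (C *ℚᵛ w) i))
        ≡⟨ sum-cong-≗ (λ i → trans (cong (λ z → w i * (z * x + (C *ℚᵛ w) i)) (symA (suc i) zero)) (expand x (w i) (b i) ((C *ℚᵛ w) i))) ⟩
      sum (λ i → x * (b i * w i) + 1ℚ * (w i * (C *ℚᵛ w) i))
        ≡⟨ sum-linear x 1ℚ (λ i → b i * w i) (λ i → w i * (C *ℚᵛ w) i) ⟩
      x * dot b w + 1ℚ * quadraticForm C w
        ≡⟨ cong (x * dot b w +_) (*-identityˡ _) ⟩
      x * dot b w + quadraticForm C w                                ∎)
      where
      open ≡-Reasoning
      x = v zero
      w = v ∘ suc
      expand : ∀ x y z u → y * (z * x + u) ≡ x * (z * y) + 1ℚ * (y * u)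
      expand = solve-∀ ℚ-ring

    -- Completing the square, multiplied through by `a`: for `a` > 0 the form of `A` is nonnegative
    -- as soon as that of its Schur complement is.
    complete-square : ∀ v → let w = v ∘ suc ; u = a * v zero + dot b w in
                      a * quadraticForm A v ≡ u * u + quadraticForm (schur A) w
    complete-square v = trans (cong (a *_) (form-∷ v))
      (trans (expand a (v zero) (dot b w) (quadraticForm C w))
        (cong (u * u +_) (sym (schur-form w))))
      where
      w = v ∘ suc
      u = a * v zero + dot b w
      expand : ∀ a x β γ → a * (x * (a * x + β) + (x * β + γ)) ≡ (a * x + β) * (a * x + β) + (a * γ + - β * β)
      expand = solve-∀ ℚ-ring

    -- This is `a` times the vector with tail `w` whose first coordinate -(b · w)/a annihilates row
    -- 0, so the square in `complete-square` vanishes and only the Schur form remains.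
    lift : Vector ℚ n → Vector ℚ (suc n)
    lift w = - dot b w ∷ λ j → a * w j

    private
      pull : ∀ (f w : Vector ℚ n) → dot f (λ j → a * w j) ≡ a * dot f w
      pull f w = trans (sum-cong-≗ (λ j → expand (f j) a (w j))) (sym (*-distribˡ-sum a (λ j → f j * w j)))
        where
        expand : ∀ x y z → x * (y * z) ≡ y * (x * z)
        expand = solve-∀ ℚ-ring

    lift-zero : ∀ w → (A *ℚᵛ lift w) zero ≡ 0ℚ
    lift-zero w = trans (cong (a * - dot b w +_) (pull b w)) (cancel a (dot b w))
      where
      cancel : ∀ x y → x * - y + x * y ≡ 0ℚ
      cancel = solve-∀ ℚ-ring

    lift-suc : ∀ w i → (A *ℚᵛ lift w) (suc i) ≡ (schur A *ℚᵛ w) i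
    lift-suc w i = trans (cong₂ (λ z y → z * - dot b w + y) (symA (suc i) zero) (pull (C i) w))
      (trans (swap (b i) (dot b w) (a * (C *ℚᵛ w) i)) (sym (schur-*ᵛ w i)))
      where
      swap : ∀ x y z → x * - y + z ≡ z + - y * x
      swap = solve-∀ ℚ-ring

    form-lift : ∀ w → quadraticForm A (lift w) ≡ a * quadraticForm (schur A) w
    form-lift w = begin
      - dot b w * (A *ℚᵛ lift w) zero + sum (λ i → a * w i * (A *ℚᵛ lift w) (suc i))
        ≡⟨ cong₂ _+_ (trans (cong (- dot b w *_) (lift-zero w)) (*-zeroʳ (- dot b w)))
             (sum-cong-≗ λ i → trans (cong (a * w i *_) (lift-suc w i)) (*-assoc a _ _)) ⟩
      0ℚ + sum (λ i → a * (w i * (schur A *ℚᵛ w) i))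
        ≡⟨ trans (+-identityˡ _) (sym (*-distribˡ-sum a (λ i → w i * (schur A *ℚᵛ w) i))) ⟩
      a * quadraticForm (schur A) w ∎
      where open ≡-Reasoning

    at : Fin n → ℚ → Vector ℚ n
    at j t i = if does (i Fin.≟ j) then t else 0ℚ

    private
      at-here : ∀ j t → at j t j ≡ t
      at-here j t with j Fin.≟ j
      ... | yes _  = refl
      ... | no j≢j = contradiction refl j≢j

      at-there : ∀ {i j} t → i ≢ j → at j t i ≡ 0ℚ
      at-there {i} {j} t i≢j with i Fin.≟ j
      ... | yes i≡j = contradiction i≡j i≢j
      ... | no _    = refl

      dot-at : ∀ f j t → dot f (at j t) ≡ f j * t
      dot-at f j t = trans
        (sum-single (λ i → f i * at j t i) j (λ i i≢j → trans (cong (f i *_) (at-there t i≢j)) (*-zeroʳ (f i))))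
        (cong (f j *_) (at-here j t))

      at-dot : ∀ f j t → dot (at j t) f ≡ t * f j
      at-dot f j t = trans (sum-cong-≗ (λ i → *-comm (at j t i) (f i))) (trans (dot-at f j t) (*-comm (f j) t))

    form-plane : ∀ j s t → quadraticForm A (s ∷ at j t) ≡ a * s * s + (1ℚ + 1ℚ) * s * t * b j + C j j * t * t
    form-plane j s t = trans (form-∷ (s ∷ at j t))
      (trans (cong₂ (λ β γ → s * (a * s + β) + (s * β + γ)) (dot-at b j t)
          (trans (at-dot (C *ℚᵛ at j t) j t) (cong (t *_) (dot-at (C j) j t))))
        (expand a s (b j) t (C j j)))
      where
      expand : ∀ a s b t c → s * (a * s + b * t) + (s * (b * t) + t * (c * t))
                           ≡ a * s * s + (1ℚ + 1ℚ) * s * t * b + c * t * t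
      expand = solve-∀ ℚ-ring

    form-axis : ∀ s → quadraticForm A (s ∷ λ _ → 0ℚ) ≡ a * s * s
    form-axis s = trans (form-∷ (s ∷ λ _ → 0ℚ))
      (trans (cong₂ (λ β γ → s * (a * s + β) + (s * β + γ))
          (sum-zero λ j → *-zeroʳ (b j)) (sum-zero λ j → *-zeroˡ ((C *ℚᵛ λ _ → 0ℚ) j)))
        (expand a s))
      where
      expand : ∀ a s → s * (a * s + 0ℚ) + (s * 0ℚ + 0ℚ) ≡ a * s * s
      expand = solve-∀ ℚ-ring

  0<p² : ∀ p → p ≢ 0ℚ → 0ℚ < p * p
  0<p² p p≢0 with 0ℚ <? p * p
  ... | yes 0<p² = 0<p²
  ... | no ≮ with <-cmp 0ℚ p
  ...   | tri< 0<p _ _ = contradiction (0<* 0<p 0<p) ≮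
  ...   | tri≈ _ 0≡p _ = contradiction (sym 0≡p) p≢0
  ...   | tri> _ _ p<0 = contradiction
            (positive⁻¹ (p * p) {{neg*neg⇒pos p {{negative p<0}} p {{negative p<0}}}}) ≮

  psd? : ∀ {n} (A : Matrix ℚ n n) → Symmetric A →
         (∃ λ v → quadraticForm A v < 0ℚ) ⊎ (∀ v → 0ℚ ≤ quadraticForm A v)
  psd? {zero}  A symA = inj₂ λ _ → ≤-refl
  psd? {suc n} A symA with <-cmp (A zero zero) 0ℚ
  ... | tri< a<0 _ _ = inj₁ ((1ℚ ∷ λ _ → 0ℚ) , subst (_< 0ℚ) (sym form≡a) a<0)
    where
    open SchurComplement A symA
    form≡a : quadraticForm A (1ℚ ∷ λ _ → 0ℚ) ≡ a
    form≡a = trans (form-axis 1ℚ) (trans (*-identityʳ _) (*-identityʳ a))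
  ... | tri> _ _ 0<a = schur-case (psd? (schur A) (schur-symmetric A symA))
    where
    open SchurComplement A symA
    schur-case : _ → _
    schur-case (inj₁ (w , form<0)) = inj₁ (lift w , subst (_< 0ℚ) (sym (form-lift w))
      (negative⁻¹ _ {{pos*neg⇒neg a {{positive 0<a}} _ {{negative form<0}}}}))
    schur-case (inj₂ psd) = inj₂ λ v → *-cancel-0≤ 0<a
      (subst (0ℚ ≤_) (sym (complete-square v)) (0≤+ (0≤p² (a * v zero + dot b (v ∘ suc))) (psd (v ∘ suc))))
  ... | tri≈ _ a≡0 _ = null-case (all? λ j → b j ≟ 0ℚ)
    where
    open SchurComplement A symA

    null-case : _ → _
    null-case (yes b≡0) = block-case (psd? C λ i j → symA (suc i) (suc j))
      where
      form≡ : ∀ v → quadraticForm A v ≡ quadraticForm C (v ∘ suc)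
      form≡ v = trans (form-∷ v) (trans (cong₂ (λ z β → v zero * (z * v zero + β) + (v zero * β + quadraticForm C (v ∘ suc)))
          a≡0 (sum-zero λ j → trans (cong (_* v (suc j)) (b≡0 j)) (*-zeroˡ (v (suc j)))))
        (collapse (v zero) (quadraticForm C (v ∘ suc))))
        where
        collapse : ∀ x γ → x * (0ℚ * x + 0ℚ) + (x * 0ℚ + γ) ≡ γ
        collapse = solve-∀ ℚ-ring
      block-case : _ → _
      block-case (inj₁ (w , form<0)) = inj₁ ((0ℚ ∷ w) , subst (_< 0ℚ) (sym (form≡ (0ℚ ∷ w))) form<0)
      block-case (inj₂ psd) = inj₂ λ v → subst (0ℚ ≤_) (sym (form≡ v)) (psd (v ∘ suc))
    null-case (no ¬b≡0) with ¬∀⟶∃¬ n (λ j → b j ≡ 0ℚ) (λ j → b j ≟ 0ℚ) ¬b≡0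
    ... | j , bⱼ≢0 = inj₁ ((s ∷ at j (b j)) , <-excess _ 0<excess equation)
      where
      c = C j j
      -- With `a` = 0 the form at (s, bⱼ) is bⱼ² (2s + c), so `s` only has to make 2s + c negative;
      -- this value does so for every `c`.
      s = - (c * c + 1ℚ)
      -- −(2s + c) = 2c² − c + 2 = c² + (c − ½)² + 7/4 is positive.
      r = c * c + ((c - ½) * (c - ½) + (1ℚ + ½ + ½ * ½))
      0<excess : 0ℚ < b j * b j * r
      0<excess = 0<* (0<p² (b j) bⱼ≢0) (+-mono-≤-< (0≤p² c) (+-mono-≤-< (0≤p² (c - ½)) (positive⁻¹ _)))
      equation : 0ℚ ≡ quadraticForm A (s ∷ at j (b j)) + b j * b j * r
      equation = sym (trans (cong (_+ b j * b j * r) (trans (form-plane j s (b j)) (cong (λ z → z * s * s + (1ℚ + 1ℚ) * s * b j * b j + c * b j * b j) a≡0)))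
        (cancel (b j) c))
        where
        cancel : ∀ x c → 0ℚ * (- (c * c + 1ℚ)) * (- (c * c + 1ℚ)) + (1ℚ + 1ℚ) * (- (c * c + 1ℚ)) * x * x + c * x * x
          + x * x * (c * c + ((c - ½) * (c - ½) + (1ℚ + ½ + ½ * ½))) ≡ 0ℚ
        cancel = solve-∀ ℚ-ring

  -- Each step pays a factor 2 for (x + y)² ≤ 2x² + 2y².
  dotBound : ℕ → ℚ → ℚ
  dotBound zero    K = 0ℚ
  dotBound (suc n) K = (K + dotBound n K) + (K + dotBound n K)

  0≤dotBound : ∀ n {K} → 0ℚ ≤ K → 0ℚ ≤ dotBound n K
  0≤dotBound zero    0≤K = ≤-refl
  0≤dotBound (suc n) 0≤K = let h = 0≤+ 0≤K (0≤dotBound n 0≤K) in 0≤+ h h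

  -- A crude Cauchy-Schwarz inequality. Its constant depends only on the dimension and on `K`, so
  -- one constant serves all late approximations of a real vector.
  dot-bound : ∀ {n K} (b w : Vector ℚ n) → 0ℚ ≤ K → (∀ j → b j * b j ≤ K) →
              dot b w * dot b w ≤ dotBound n K * dot w w
  dot-bound {zero}      b w 0≤K b²≤K = ≤-refl
  dot-bound {suc n} {K} b w 0≤K b²≤K = ≤-excess excess 0≤excess (identity K κ x y P W)
    where
    κ = dotBound n K
    x = b zero
    y = w zero
    P = dot (b ∘ suc) (w ∘ suc)
    W = dot (w ∘ suc) (w ∘ suc)
    -- (xy + P)² + (xy - P)² = 2x²y² + 2P²; the next two summands compare these with `K` and κ, and
    -- the last holds the cross terms of (2K + 2κ)(y² + W).
    excess = (x * y - P) * (x * y - P) + ((K - x * x) * (y * y) + (K - x * x) * (y * y))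
           + ((κ * W - P * P) + (κ * W - P * P)) + ((κ * (y * y) + κ * (y * y)) + (K * W + K * W))
    0≤excess : 0ℚ ≤ excess
    0≤excess = 0≤+ (0≤+ (0≤+ (0≤p² (x * y - P)) (0≤+ h₁ h₁)) (0≤+ h₂ h₂)) (0≤+ (0≤+ h₃ h₃) (0≤+ h₄ h₄))
      where
      h₁ = 0≤* (p≤q⇒0≤q-p (b²≤K zero)) (0≤p² y)
      h₂ = p≤q⇒0≤q-p (dot-bound (b ∘ suc) (w ∘ suc) 0≤K (b²≤K ∘ suc))
      h₃ = 0≤* (0≤dotBound n 0≤K) (0≤p² y)
      h₄ = 0≤* 0≤K (0≤dot (w ∘ suc))
    identity : ∀ K κ x y P W → ((K + κ) + (K + κ)) * (y * y + W) ≡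
      (x * y + P) * (x * y + P) +
      ((x * y - P) * (x * y - P) + ((K - x * x) * (y * y) + (K - x * x) * (y * y))
           + ((κ * W - P * P) + (κ * W - P * P)) + ((κ * (y * y) + κ * (y * y)) + (K * W + K * W)))
    identity = solve-∀ ℚ-ring

  entry≤dot : ∀ {n} (b : Vector ℚ n) j → b j * b j ≤ dot b b
  entry≤dot b zero    = ≤-excess _ (0≤dot (b ∘ suc)) refl
  entry≤dot b (suc j) = ≤-trans (entry≤dot (b ∘ suc) j)
    (≤-excess _ (0≤p² (b zero)) (+-comm (b zero * b zero) _))

  *ᵛ-bound : ∀ {m n} (A : Matrix ℚ m n) → ∃ λ κ → ∀ v → dot (A *ℚᵛ v) (A *ℚᵛ v) ≤ κ * dot v v
  *ᵛ-bound {zero}      A = 0ℚ , λ v → ≤-reflexive (sym (*-zeroˡ (dot v v)))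
  *ᵛ-bound {suc m} {n} A with *ᵛ-bound (A ∘ suc)
  ... | κ , bound = dotBound n (dot (A zero) (A zero)) + κ , λ v →
    ≤-trans (+-mono-≤ (dot-bound (A zero) v (0≤dot (A zero)) (entry≤dot (A zero))) (bound v))
      (≤-reflexive (sym (*-distribʳ-+ (dot v v) (dotBound n (dot (A zero) (A zero))) κ)))

  sum-mono-≤ : ∀ {n} {f g : Vector ℚ n} → (∀ i → f i ≤ g i) → sum f ≤ sum g
  sum-mono-≤ {zero}  f≤g = ≤-refl
  sum-mono-≤ {suc n} f≤g = +-mono-≤ (f≤g zero) (sum-mono-≤ (f≤g ∘ suc))

  -- Provides the initial upper end of the bisection; xy ≤ x² + y² in each coordinate reduces it to
  -- the bound on |A v|².
  quadraticForm-bounded : ∀ {n} (A : Matrix ℚ n n) → ∃ λ κ → ∀ v → quadraticForm A v ≤ κ * dot v v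
  quadraticForm-bounded A with *ᵛ-bound A
  ... | κ , bound = 1ℚ + κ , λ v → begin
    dot v (A *ℚᵛ v)                          ≤⟨ sum-mono-≤ (λ i → young (v i) ((A *ℚᵛ v) i)) ⟩
    sum (λ i → v i * v i + (A *ℚᵛ v) i * (A *ℚᵛ v) i)
      ≡⟨ ∑-distrib-+ (λ i → v i * v i) (λ i → (A *ℚᵛ v) i * (A *ℚᵛ v) i) ⟩
    dot v v + dot (A *ℚᵛ v) (A *ℚᵛ v)        ≤⟨ +-monoʳ-≤ (dot v v) (bound v) ⟩
    dot v v + κ * dot v v                    ≡⟨ cong (_+ κ * dot v v) (sym (*-identityˡ (dot v v))) ⟩
    1ℚ * dot v v + κ * dot v v               ≡⟨ sym (*-distribʳ-+ (dot v v) 1ℚ κ) ⟩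
    (1ℚ + κ) * dot v v                       ∎
    where
    open ≤-Reasoning
    young : ∀ x y → x * y ≤ x * x + y * y
    young x y = ≤-excess ((x - ½ * y) * (x - ½ * y) + (½ + ½ * ½) * (y * y))
        (0≤+ (0≤p² (x - ½ * y)) (0≤* (nonNegative⁻¹ (½ + ½ * ½)) (0≤p² y))) (identity x y)
      where
      identity : ∀ x y → x * x + y * y ≡ x * y + ((x - ½ * y) * (x - ½ * y) + (½ + ½ * ½) * (y * y))
      identity = solve-∀ ℚ-ring

  -- The matrix c I - A, with the sign chosen so that semidefiniteness says that `c` bounds all
  -- Rayleigh quotients of `A`.
  shift : ∀ {n} → ℚ → Matrix ℚ n n → Matrix ℚ n n
  shift c A i j with i Fin.≟ j
  ... | yes _ = c - A i j
  ... | no _  = 0ℚ - A i j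

  shift-symmetric : ∀ {n} c (A : Matrix ℚ n n) → Symmetric A → Symmetric (shift c A)
  shift-symmetric c A symA i j with i Fin.≟ j | j Fin.≟ i
  ... | yes _ | yes _ = cong (λ z → c - z) (symA i j)
  ... | no _  | no _  = cong (λ z → 0ℚ - z) (symA i j)
  ... | yes i≡j | no j≢i = contradiction (sym i≡j) j≢i
  ... | no i≢j | yes j≡i = contradiction (sym j≡i) i≢j

  -- Adding A v back cancels every entry of the row except the diagonal one, which leaves a sum with
  -- a single term.
  shift-*ᵛ : ∀ {n} c (A : Matrix ℚ n n) v i → (shift c A *ℚᵛ v) i ≡ c * v i - (A *ℚᵛ v) i
  shift-*ᵛ c A v i = trans (add-back ((shift c A *ℚᵛ v) i) ((A *ℚᵛ v) i)) (cong (_- (A *ℚᵛ v) i) (begin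
    (shift c A *ℚᵛ v) i + (A *ℚᵛ v) i
      ≡⟨ sym (∑-distrib-+ (λ j → shift c A i j * v j) (λ j → A i j * v j)) ⟩
    sum (λ j → shift c A i j * v j + A i j * v j)
      ≡⟨ sum-single (λ j → shift c A i j * v j + A i j * v j) i off ⟩
    shift c A i i * v i + A i i * v i               ≡⟨ diagonal ⟩
    c * v i                                         ∎))
    where
    open ≡-Reasoning
    add-back : ∀ x y → x ≡ x + y - y
    add-back = solve-∀ ℚ-ring
    cancel : ∀ c x y → (c - x) * y + x * y ≡ c * y
    cancel = solve-∀ ℚ-ring
    off : ∀ j → j ≢ i → shift c A i j * v j + A i j * v j ≡ 0ℚ
    off j j≢i with i Fin.≟ j
    ... | yes i≡j = contradiction (sym i≡j) j≢i
    ... | no _    = trans (cancel 0ℚ (A i j) (v j)) (*-zeroˡ (v j))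
    diagonal : shift c A i i * v i + A i i * v i ≡ c * v i
    diagonal with i Fin.≟ i
    ... | yes _  = cancel c (A i i) (v i)
    ... | no i≢i = contradiction refl i≢i

  shift-form : ∀ {n} c (A : Matrix ℚ n n) v →
               quadraticForm (shift c A) v ≡ c * dot v v - quadraticForm A v
  shift-form c A v = begin
    dot v (shift c A *ℚᵛ v)
      ≡⟨ sum-cong-≗ (λ i → trans (cong (v i *_) (shift-*ᵛ c A v i)) (expand (v i) c ((A *ℚᵛ v) i))) ⟩
    sum (λ i → c * (v i * v i) + - 1ℚ * (v i * (A *ℚᵛ v) i))
      ≡⟨ sum-linear c (- 1ℚ) (λ i → v i * v i) (λ i → v i * (A *ℚᵛ v) i) ⟩
    c * dot v v + - 1ℚ * quadraticForm A v
      ≡⟨ collect (c * dot v v) (quadraticForm A v) ⟩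
    c * dot v v - quadraticForm A v                                ∎
    where
    open ≡-Reasoning
    expand : ∀ x c y → x * (c * x - y) ≡ c * (x * x) + - 1ℚ * (x * y)
    expand = solve-∀ ℚ-ring
    collect : ∀ x y → x + - 1ℚ * y ≡ x - y
    collect = solve-∀ ℚ-ring

  -- Integers inside the rationals, and powers of one half

  /1-homo-+ : ∀ x y → (x ℤ.+ y) / 1 ≡ x / 1 + y / 1
  /1-homo-+ x y = toℚᵘ-injective (begin
    toℚᵘ ((x ℤ.+ y) / 1)                  ≈⟨ toℚᵘ-fromℚᵘ (ℚᵘ.mkℚᵘ (x ℤ.+ y) 0) ⟩
    ℚᵘ.mkℚᵘ (x ℤ.+ y) 0
      ≈⟨ ℚᵘ.*≡* (cong (ℤ._* ℤ.+ 1) (sym (cong₂ ℤ._+_ (ℤ.*-identityʳ x) (ℤ.*-identityʳ y)))) ⟩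
    ℚᵘ.mkℚᵘ x 0 ℚᵘ.+ ℚᵘ.mkℚᵘ y 0
      ≈⟨ ℚᵘ.+-cong (ℚᵘ.≃-sym (toℚᵘ-fromℚᵘ (ℚᵘ.mkℚᵘ x 0))) (ℚᵘ.≃-sym (toℚᵘ-fromℚᵘ (ℚᵘ.mkℚᵘ y 0))) ⟩
    toℚᵘ (x / 1) ℚᵘ.+ toℚᵘ (y / 1)        ≈⟨ ℚᵘ.≃-sym (toℚᵘ-homo-+ (x / 1) (y / 1)) ⟩
    toℚᵘ (x / 1 + y / 1)                  ∎)
    where open ℚᵘ.≃-Reasoning

  /1-homo-* : ∀ x y → (x ℤ.* y) / 1 ≡ x / 1 * (y / 1)
  /1-homo-* x y = toℚᵘ-injective (begin
    toℚᵘ ((x ℤ.* y) / 1)                  ≈⟨ toℚᵘ-fromℚᵘ (ℚᵘ.mkℚᵘ (x ℤ.* y) 0) ⟩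
    ℚᵘ.mkℚᵘ x 0 ℚᵘ.* ℚᵘ.mkℚᵘ y 0
      ≈⟨ ℚᵘ.*-cong (ℚᵘ.≃-sym (toℚᵘ-fromℚᵘ (ℚᵘ.mkℚᵘ x 0))) (ℚᵘ.≃-sym (toℚᵘ-fromℚᵘ (ℚᵘ.mkℚᵘ y 0))) ⟩
    toℚᵘ (x / 1) ℚᵘ.* toℚᵘ (y / 1)        ≈⟨ ℚᵘ.≃-sym (toℚᵘ-homo-* (x / 1) (y / 1)) ⟩
    toℚᵘ (x / 1 * (y / 1))                ∎)
    where open ℚᵘ.≃-Reasoning

  /1-injective : ∀ {x y} → x / 1 ≡ y / 1 → x ≡ y
  /1-injective {x} {y} eq with fromℚᵘ-injective {ℚᵘ.mkℚᵘ x 0} {ℚᵘ.mkℚᵘ y 0} eq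
  ... | ℚᵘ.*≡* h = trans (sym (ℤ.*-identityʳ x)) (trans h (ℤ.*-identityʳ y))

  /1-cancel-≤ : ∀ {x y} → x / 1 ≤ y / 1 → x ℤ.≤ y
  /1-cancel-≤ {x} {y} x≤y with ℚᵘ.≤-respˡ-≃ (toℚᵘ-fromℚᵘ (ℚᵘ.mkℚᵘ x 0))
                              (ℚᵘ.≤-respʳ-≃ (toℚᵘ-fromℚᵘ (ℚᵘ.mkℚᵘ y 0)) (toℚᵘ-mono-≤ x≤y))
  ... | ℚᵘ.*≤* h = subst₂ ℤ._≤_ (ℤ.*-identityʳ x) (ℤ.*-identityʳ y) h

  abstract
    -- Abstract, so that later goals meet `ι` only through the lemmas of this block and never
    -- through the normalisation of fractions.
    ι : ℕ → ℚ
    ι n = ℤ.+ n / 1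

    ι-zero : ι 0 ≡ 0ℚ
    ι-zero = refl

    ι-suc : ∀ n → ι (suc n) ≡ 1ℚ + ι n
    ι-suc n = /1-homo-+ (ℤ.+ 1) (ℤ.+ n)

    archimedean : ∀ q → ∃ λ N → q ≤ ι N
    archimedean q@(mkℚ n d _) = ℤ.∣ n ∣ , toℚᵘ-cancel-≤
      (ℚᵘ.≤-respʳ-≃ (ℚᵘ.≃-sym (toℚᵘ-fromℚᵘ (ℚᵘ.mkℚᵘ (ℤ.+ ℤ.∣ n ∣) 0))) (ℚᵘ.*≤* (bound n)))
      where
      bound : ∀ n → n ℤ.* ℤ.+ 1 ℤ.≤ ℤ.+ ℤ.∣ n ∣ ℤ.* ℤ.+ suc d
      bound (ℤ.+ m)          = subst₂ ℤ._≤_ (sym (ℤ.*-identityʳ (ℤ.+ m))) (ℤ.pos-* m (suc d)) (ℤ.+≤+ (ℕ.m≤m*n m (suc d)))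
      bound ℤ.-[1+ m ]     = ℤ.≤-trans (ℤ.≤-reflexive (ℤ.*-identityʳ ℤ.-[1+ m ])) ℤ.-≤+

  0≤ι : ∀ n → 0ℚ ≤ ι n
  0≤ι zero    = ≤-reflexive (sym ι-zero)
  0≤ι (suc n) = subst (0ℚ ≤_) (sym (ι-suc n)) (0≤+ (nonNegative⁻¹ 1ℚ) (0≤ι n))

  ι-mono-≤ : ∀ {m n} → m ℕ.≤ n → ι m ≤ ι n
  ι-mono-≤ {zero}  {n}     ℕ.z≤n       = subst (_≤ ι n) (sym ι-zero) (0≤ι n)
  ι-mono-≤ {suc m} {suc n} (ℕ.s≤s m≤n) =
    subst₂ _≤_ (sym (ι-suc m)) (sym (ι-suc n)) (+-monoʳ-≤ 1ℚ (ι-mono-≤ m≤n))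

  halfPower : ℕ → ℚ
  halfPower zero    = 1ℚ
  halfPower (suc n) = halfPower n * ½

  0<halfPower : ∀ n → 0ℚ < halfPower n
  0<halfPower zero    = positive⁻¹ 1ℚ
  0<halfPower (suc n) = 0<* (0<halfPower n) (positive⁻¹ ½)

  -- Bernoulli's inequality n + 1 ≤ 2ⁿ in reciprocal form; it gives an explicit index past which
  -- `w * halfPower n` is below ε.
  halfPower-≤ : ∀ n → halfPower n * ι (suc n) ≤ 1ℚ
  halfPower-≤ zero    = ≤-reflexive (trans (*-identityˡ (ι 1)) (trans (ι-suc 0) (trans (cong (λ z → 1ℚ + z) ι-zero) (+-identityʳ 1ℚ))))
  halfPower-≤ (suc n) = ≤-trans
    (≤-excess (½ * (h * ι n)) (0≤* (nonNegative⁻¹ ½) (0≤* (<⇒≤ (0<halfPower n)) (0≤ι n)))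
      (trans (cong (h *_) (ι-suc n)) (trans (double h (ι n))
        (cong (λ z → h * ½ * z + ½ * (h * ι n)) (sym (trans (ι-suc (suc n)) (cong (λ z → 1ℚ + z) (ι-suc n))))))))
    (halfPower-≤ n)
    where
    h = halfPower n
    double : ∀ h x → h * (1ℚ + x) ≡ h * ½ * (1ℚ + (1ℚ + x)) + ½ * (h * x)
    double = solve-∀ ℚ-ring

  halfPower-vanishes : ∀ {w ε} → 0ℚ ≤ w → 0ℚ < ε → ∃ λ N → ∀ n → N ℕ.≤ n → w * halfPower n < ε
  halfPower-vanishes {w} {ε} 0≤w 0<ε with archimedean (w * (1/ ε) {{pos⇒nonZero ε {{positive 0<ε}}}})
  ... | N , q≤N = N , λ n N≤n →
    *-cancelʳ-<-nonNeg (ι (suc n)) {{nonNegative (0≤ι (suc n))}} (begin-strict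
      w * halfPower n * ι (suc n)      ≡⟨ *-assoc w (halfPower n) _ ⟩
      w * (halfPower n * ι (suc n))    ≤⟨ *-monoˡ-≤-nonNeg w {{nonNegative 0≤w}} (halfPower-≤ n) ⟩
      w * 1ℚ                           ≡⟨ cong (w *_) (sym (*-inverseˡ ε)) ⟩
      w * (1/ ε * ε)                   ≡⟨ sym (*-assoc w (1/ ε) ε) ⟩
      w * 1/ ε * ε                     ≤⟨ *-monoʳ-≤-nonNeg ε (≤-trans q≤N (ι-mono-≤ N≤n)) ⟩
      ι n * ε
        <⟨ <-excess ε 0<ε (trans (cong (_* ε) (ι-suc n)) (next (ι n) ε)) ⟩
      ι (suc n) * ε                    ≡⟨ *-comm (ι (suc n)) ε ⟩
      ε * ι (suc n)                    ∎)
    where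
    open ≤-Reasoning
    instance
      ε-pos = positive 0<ε
      ε-nonNeg = pos⇒nonNeg ε
      ε-nonZero = pos⇒nonZero ε
    next : ∀ x ε → (1ℚ + x) * ε ≡ x * ε + ε
    next = solve-∀ ℚ-ring

  -- Bisection for the largest Rayleigh quotient

  ∣∣<-from : ∀ {x ε} → x < ε → - x < ε → ∣ x ∣ < ε
  ∣∣<-from {x} x<ε -x<ε with ∣p∣≡p∨∣p∣≡-p x
  ... | inj₁ eq = subst (_< _) (sym eq) x<ε
  ... | inj₂ eq = subst (_< _) (sym eq) -x<ε

  -- Encloses the supremum of the Rayleigh quotients: one vector certifies the lower end, all
  -- vectors the upper end. Strictness of `below` keeps `witness` from being zero.
  record Bracket {n} (A : Matrix ℚ n n) : Set where
    field
      lo hi   : ℚ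
      witness : Vector ℚ n
      below   : lo * dot witness witness < quadraticForm A witness
      above   : ∀ v → quadraticForm A v ≤ hi * dot v v

  open Bracket

  -- Two different brackets are allowed, because both ends are compared with the form at the witness
  -- of `p`.
  lo<hi : ∀ {n} {A : Matrix ℚ n n} (p q : Bracket A) → lo p < hi q
  lo<hi p q = *-cancelʳ-<-nonNeg (dot v v) {{nonNegative (0≤dot v)}}
    (<-≤-trans (below p) (above q v))
    where v = witness p

  module Bisection {n} (A : Matrix ℚ n n) (symA : Symmetric A) (start : Bracket A) where

    width₀ = hi start - lo start

    -- Semidefiniteness of mid - A is decidable: a negative vector becomes the witness for the new
    -- lower end `mid`, and otherwise `mid` is an upper end.
    refine : (p : Bracket A) → ∃ λ q → hi q - lo q ≡ (hi p - lo p) * ½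
    refine p = choose (psd? (shift mid A) (shift-symmetric mid A symA))
      where
      mid = (lo p + hi p) * ½
      choose : _ → ∃ λ q → hi q - lo q ≡ (hi p - lo p) * ½
      choose (inj₁ (v , form<0)) = record p
        { lo = mid ; witness = v
        ; below = <-excess (- quadraticForm (shift mid A) v) (neg-antimono-< form<0)
            (trans (rearrange (mid * dot v v) (quadraticForm A v))
              (cong (λ z → mid * dot v v + - z) (sym (shift-form mid A v)))) }
        , upper (lo p) (hi p)
        where
        rearrange : ∀ x y → y ≡ x + - (x - y)
        rearrange = solve-∀ ℚ-ring
        upper : ∀ l h → h - (l + h) * ½ ≡ (h - l) * ½
        upper = solve-∀ ℚ-ring
      choose (inj₂ psd) = record p
        { hi = mid
        ; above = λ v → ≤-excess _ (psd v) (trans (rearrange (mid * dot v v) (quadraticForm A v))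
              (cong (quadraticForm A v +_) (sym (shift-form mid A v)))) }
        , lower (lo p) (hi p)
        where
        rearrange : ∀ x y → x ≡ y + (x - y)
        rearrange = solve-∀ ℚ-ring
        lower : ∀ l h → (l + h) * ½ - l ≡ (h - l) * ½
        lower = solve-∀ ℚ-ring

    bracket : ℕ → Bracket A
    bracket zero    = start
    bracket (suc n) = proj₁ (refine (bracket n))

    width : ∀ n → hi (bracket n) - lo (bracket n) ≡ width₀ * halfPower n
    width zero    = sym (*-identityʳ width₀)
    width (suc n) = trans (proj₂ (refine (bracket n))) (trans (cong (_* ½) (width n)) (*-assoc width₀ (halfPower n) ½))

    width-vanishes : ∀ {ε} → 0ℚ < ε → ∃ λ N → ∀ n → N ℕ.≤ n → hi (bracket n) - lo (bracket n) < ε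
    width-vanishes {ε} 0<ε =
      let N , small = halfPower-vanishes (<⇒≤ (p<q⇒0<q-p (lo<hi start start))) 0<ε
      in N , λ n N≤n → subst (_< ε) (sym (width n)) (small n N≤n)

    limit : ℝ
    limit = mkℝ (λ n → hi (bracket n)) λ ε 0<ε →
      let N , small = width-vanishes 0<ε
          -- Since `lo (bracket m)` lies below every upper end, the difference is less than the
          -- width of bracket m; monotonicity does not enter.
          close : ∀ m n → N ℕ.≤ m → hi (bracket m) - hi (bracket n) < ε
          close m n N≤m = <-trans
            (+-monoʳ-< (hi (bracket m)) (neg-antimono-< (lo<hi (bracket m) (bracket n)))) (small m N≤m)
      in N , λ m n N≤m N≤n → ∣∣<-from (close m n N≤m)
           (subst (_< ε) (flip (hi (bracket m)) (hi (bracket n))) (close n m N≤n))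
      where
      flip : ∀ x y → y - x ≡ - (x - y)
      flip = solve-∀ ℚ-ring

  -- Real matrices as sequences of rational matrices

  module Rᵣ = RawRing ℝ-rawRing

  Eventually : (ℕ → Set) → Set
  Eventually P = ∃ λ T → ∀ t → T ℕ.≤ t → P t

  eventually₂ : ∀ {P Q R : ℕ → Set} → (∀ t → P t → Q t → R t) → Eventually P → Eventually Q → Eventually R
  eventually₂ f (S , p) (T , q) = S ℕ.⊔ T , λ t h →
    f t (p t (ℕ.m⊔n≤o⇒m≤o S T h)) (q t (ℕ.m⊔n≤o⇒n≤o S T h))

  eventually₁ : ∀ {P Q : ℕ → Set} → (∀ t → P t → Q t) → Eventually P → Eventually Q
  eventually₁ f (S , p) = S , λ t h → f t (p t h)

  ≃ᵣ-pointwise : ∀ {x y} → (∀ t → seq x t ≡ seq y t) → x ≃ᵣ y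
  ≃ᵣ-pointwise {x} {y} eq ε 0<ε = 0 , λ t _ →
    subst (λ z → ∣ z ∣ < ε) (sym (trans (cong (_- seq y t) (eq t)) (+-inverseʳ (seq y t)))) 0<ε

  ≃ᵣ-trans-pointwise : ∀ {x y z} → (∀ t → seq x t ≡ seq y t) → y ≃ᵣ z → x ≃ᵣ z
  ≃ᵣ-trans-pointwise {z = z} eq y≃z ε 0<ε = eventually₁ (λ t → subst (λ p → ∣ p - seq z t ∣ < ε) (sym (eq t))) (y≃z ε 0<ε)

  p-0≡p : ∀ p → p - 0ℚ ≡ p
  p-0≡p p = +-identityʳ p

  ≃ᵣ0⇒small : ∀ {x ε} → x ≃ᵣ fromℚ 0ℚ → 0ℚ < ε → Eventually λ t → ∣ seq x t ∣ < ε
  ≃ᵣ0⇒small {x} x≃0 0<ε = eventually₁ (λ t → subst (λ z → ∣ z ∣ < _) (p-0≡p (seq x t))) (x≃0 _ 0<ε)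

  small⇒≃ᵣ0 : ∀ {x} → (∀ ε → 0ℚ < ε → Eventually λ t → ∣ seq x t ∣ < ε) → x ≃ᵣ fromℚ 0ℚ
  small⇒≃ᵣ0 {x} small ε 0<ε = eventually₁ (λ t → subst (λ z → ∣ z ∣ < ε) (sym (p-0≡p (seq x t)))) (small ε 0<ε)

  module Lᵣ = LinearAlgebra ℝ-rawRing

  seq-sum : ∀ {n} (f : Vector ℝ n) t → seq (Lᵣ.sum f) t ≡ sum (λ i → seq (f i) t)
  seq-sum {zero}  f t = refl
  seq-sum {suc n} f t = cong (seq (f zero) t +_) (seq-sum (f ∘ suc) t)

  infix 9 _⟨_⟩ _⟨_⟩ᵛ

  -- The operations of ℝ act termwise, so a real matrix product is, at each index `t`, the rational
  -- product of the approximations, and the rational lemmas apply index by index.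
  _⟨_⟩ : ∀ {m n} → Matrix ℝ m n → ℕ → Matrix ℚ m n
  (N ⟨ t ⟩) i j = seq (N i j) t

  _⟨_⟩ᵛ : ∀ {n} → Vector ℝ n → ℕ → Vector ℚ n
  (x ⟨ t ⟩ᵛ) i = seq (x i) t

  seq-*ᵛ : ∀ {m n} (N : Matrix ℝ m n) x i t → seq ((N *ᵛ x) i) t ≡ (N ⟨ t ⟩ *ℚᵛ x ⟨ t ⟩ᵛ) i
  seq-*ᵛ N x i t = seq-sum (λ j → N i j Rᵣ.* x j) t

  HasKernel : ∀ {n} → Matrix ℝ n n → Set
  HasKernel {n} N = ∃ λ (x : Vector ℝ n) → ¬ (x ≋ λ _ → fromℚ 0ℚ) × (N *ᵛ x) ≋ λ _ → fromℚ 0ℚ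

  -- Demands semidefiniteness of the approximations themselves, which is more than that of their
  -- limit. The bisection supplies it because it uses the upper ends, and rational elimination
  -- preserves it.
  EventuallyPSD : ∀ {n} → Matrix ℝ n n → Set
  EventuallyPSD N = Eventually λ t → ∀ v → 0ℚ ≤ quadraticForm (N ⟨ t ⟩) v

  -- The constants do not depend on `t`. The pair `p`, `r` stands for the ratio p / r and spares a
  -- division at each elimination step.
  EventuallyCoercive : ∀ {n} → Matrix ℝ n n → Set
  EventuallyCoercive N = ∃ λ p → ∃ λ r → 0ℚ < p × 0ℚ < r ×
    Eventually λ t → ∀ v → p * dot v v ≤ r * quadraticForm (N ⟨ t ⟩) v

  0≤∣x∣-x : ∀ x → 0ℚ ≤ ∣ x ∣ - x
  0≤∣x∣-x x with ∣p∣≡p∨∣p∣≡-p x | 0≤∣p∣ x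
  ... | inj₁ eq | _ = ≤-reflexive (sym (trans (cong (_- x) eq) (+-inverseʳ x)))
  ... | inj₂ eq | h = 0≤+ h (subst (0ℚ ≤_) eq h)

  x≤∣x∣ : ∀ x → x ≤ ∣ x ∣
  x≤∣x∣ x = ≤-excess (∣ x ∣ - x) (0≤∣x∣-x x) (rearrange x ∣ x ∣)
    where
    rearrange : ∀ x y → y ≡ x + (y - x)
    rearrange = solve-∀ ℚ-ring

  ∣x∣²≡x² : ∀ x → ∣ x ∣ * ∣ x ∣ ≡ x * x
  ∣x∣²≡x² x = trans (sym (∣p*q∣≡∣p∣*∣q∣ x x)) (0≤p⇒∣p∣≡p (0≤p² x))

  square-cancel-< : ∀ {x y} → 0ℚ < y → x * x < y * y → x < y
  square-cancel-< {x} {y} 0<y x²<y² with x <? y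
  ... | yes x<y = x<y
  ... | no x≮y  = contradiction x²<y² (≤⇒≯ (≤-excess _
        (0≤+ (0≤* 0≤x-y 0≤x-y) (0≤* (0≤+ (<⇒≤ 0<y) (<⇒≤ 0<y)) 0≤x-y)) (identity x y)))
    where
    ≤⇒≯ : ∀ {p q} → p ≤ q → ¬ (q < p)
    ≤⇒≯ p≤q q<p = <-irrefl refl (<-≤-trans q<p p≤q)
    0≤x-y = p≤q⇒0≤q-p (≮⇒≥ x≮y)
    identity : ∀ x y → x * x ≡ y * y + ((x - y) * (x - y) + (y + y) * (x - y))
    identity = solve-∀ ℚ-ring

  eventually-≤ : ∀ x → ∃ λ K → 0ℚ < K × Eventually λ t → seq x t ≤ K
  eventually-≤ x =
    let K , 0<K , ∣x∣<K = eventually-bounded (seq x) (cauchy x)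
    in K , 0<K , eventually₁ (λ t ∣xₜ∣<K → ≤-trans (x≤∣x∣ (seq x t)) (<⇒≤ ∣xₜ∣<K)) ∣x∣<K

  eventually-squares-≤ : ∀ {n} (b : Vector ℝ n) →
                         ∃ λ K → 0ℚ ≤ K × Eventually λ t → ∀ j → seq (b j) t * seq (b j) t ≤ K
  eventually-squares-≤ {zero}  b = 0ℚ , ≤-refl , 0 , λ _ _ ()
  eventually-squares-≤ {suc n} b = combine (eventually-≤ (b zero Rᵣ.* b zero)) (eventually-squares-≤ (b ∘ suc))
    where
    combine : (∃ λ K → 0ℚ < K × Eventually λ t → seq (b zero) t * seq (b zero) t ≤ K) →
              (∃ λ K → 0ℚ ≤ K × Eventually λ t → ∀ j → seq (b (suc j)) t * seq (b (suc j)) t ≤ K) →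
              ∃ λ K → 0ℚ ≤ K × Eventually λ t → ∀ j → seq (b j) t * seq (b j) t ≤ K
    combine (K , 0<K , head≤K) (K′ , 0≤K′ , tail≤K′) =
      K + K′ , 0≤+ (<⇒≤ 0<K) 0≤K′ , eventually₂ merge head≤K tail≤K′
      where
      merge : ∀ t → seq (b zero) t * seq (b zero) t ≤ K →
              (∀ j → seq (b (suc j)) t * seq (b (suc j)) t ≤ K′) → ∀ j → seq (b j) t * seq (b j) t ≤ K + K′
      merge t h ts zero    = ≤-trans h (≤-excess K′ 0≤K′ refl)
      merge t h ts (suc j) = ≤-trans (ts j) (≤-excess K (<⇒≤ 0<K) (+-comm K K′))

  -- If some late term were at least ε, the Cauchy condition with ε/2 would keep all terms past its
  -- modulus at or above ε/2, contrary to assumption.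
  ¬bounded-below⇒≃ᵣ0 : ∀ {x} → Eventually (λ t → 0ℚ ≤ seq x t) →
    ¬ (∃ λ δ → 0ℚ < δ × Eventually λ t → δ ≤ seq x t) → x ≃ᵣ fromℚ 0ℚ
  ¬bounded-below⇒≃ᵣ0 {x} 0≤x ¬below = small⇒≃ᵣ0 {x} small
    where
    open ≤-Reasoning
    small : ∀ ε → 0ℚ < ε → Eventually λ t → ∣ seq x t ∣ < ε
    small ε 0<ε with cauchy x (ε * ½) (0<* 0<ε (positive⁻¹ ½))
    ... | N , close = eventually₂ {P = λ t → 0ℚ ≤ seq x t} {Q = λ t → seq x t < ε}
            (λ t 0≤xt xt<ε → subst (_< ε) (sym (0≤p⇒∣p∣≡p 0≤xt)) xt<ε) 0≤x (N , xt<ε)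
      where
      xt<ε : ∀ t → N ℕ.≤ t → seq x t < ε
      xt<ε t N≤t with seq x t <? ε
      ... | yes h = h
      ... | no xt≮ε = contradiction (ε * ½ , 0<* 0<ε (positive⁻¹ ½) , N , λ s N≤s →
              ≤-excess _ (0≤+ (p≤q⇒0≤q-p (≮⇒≥ xt≮ε))
                 (p≤q⇒0≤q-p (≤-trans (x≤∣x∣ (seq x t - seq x s)) (<⇒≤ (close t s N≤t N≤s)))))
               (identity (seq x s) (seq x t) ε)) ¬below
        where
        identity : ∀ xs xt ε → xs ≡ ε * ½ + ((xt - ε) + (ε * ½ - (xt - xs)))
        identity = solve-∀ ℚ-ring

  -- Kernel or coercivity, by elimination over the reals

  schurᵣ : ∀ {n} → Matrix ℝ (suc n) (suc n) → Matrix ℝ n n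
  schurᵣ N i j = N zero zero Rᵣ.* N (suc i) (suc j) Rᵣ.+ Rᵣ.- (N zero (suc i) Rᵣ.* N zero (suc j))

  module _ {n} (N : Matrix ℝ (suc n) (suc n)) (symN : ∀ t → Symmetric (N ⟨ t ⟩)) (psd : EventuallyPSD N) where

    private
      module S t = SchurComplement (N ⟨ t ⟩) (symN t)

    corner≥0 : Eventually λ t → 0ℚ ≤ seq (N zero zero) t
    corner≥0 = eventually₁ (λ t psd-t → subst (0ℚ ≤_) (trans (S.form-axis t 1ℚ)
              (trans (*-identityʳ (S.a t * 1ℚ)) (*-identityʳ (S.a t)))) (psd-t (1ℚ ∷ λ _ → 0ℚ))) psd

    -- On the plane of the axes 0 and j, nonnegativity at (−K, bⱼ) with K ≥ Cⱼⱼ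
    -- gives bⱼ² ≤ a K.
    null-corner⇒null-row : N zero zero ≃ᵣ fromℚ 0ℚ → ∀ j → N zero (suc j) ≃ᵣ fromℚ 0ℚ
    null-corner⇒null-row a≃0 j = small⇒≃ᵣ0 {N zero (suc j)} small
      where
      small : ∀ ε → 0ℚ < ε → Eventually λ t → ∣ S.b t j ∣ < ε
      small ε 0<ε = from-bound (eventually-≤ (N (suc j) (suc j)))
        where
        from-bound : (∃ λ K → 0ℚ < K × Eventually λ t → S.C t j j ≤ K) → Eventually λ t → ∣ S.b t j ∣ < ε
        from-bound (K , 0<K , C≤K) = eventually₂ (λ t a<η f → f a<η)
            (≃ᵣ0⇒small {N zero zero} a≃0 0<η) (eventually₂ bound psd C≤K)
          where
          instance
            K-pos = positive 0<K
            K-nonZero = pos⇒nonZero K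
          η = ε * ε * 1/ K
          0<η = 0<* (0<* 0<ε 0<ε) (positive⁻¹ (1/ K) {{1/pos⇒pos K}})
          η*K≡ε² : η * K ≡ ε * ε
          η*K≡ε² = trans (*-assoc (ε * ε) (1/ K) K) (trans (cong (ε * ε *_) (*-inverseˡ K)) (*-identityʳ (ε * ε)))
          bound : ∀ t → (∀ v → 0ℚ ≤ quadraticForm (N ⟨ t ⟩) v) → S.C t j j ≤ K →
                  ∣ S.a t ∣ < η → ∣ S.b t j ∣ < ε
          bound t psd-t C≤K ∣a∣<η = square-cancel-< 0<ε (begin-strict
            ∣ b ∣ * ∣ b ∣  ≡⟨ ∣x∣²≡x² b ⟩
            b * b          ≤⟨ *-cancelʳ-≤-pos K b²K≤aKK ⟩
            a * K          <⟨ *-monoˡ-<-pos K (≤-<-trans (x≤∣x∣ a) ∣a∣<η) ⟩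
            η * K          ≡⟨ η*K≡ε² ⟩
            ε * ε          ∎)
            where
            open ≤-Reasoning
            a = S.a t
            b = S.b t j
            c = S.C t j j
            identity : ∀ a b c K → a * K * K ≡ b * b * K + ((a * (- K) * (- K) + (1ℚ + 1ℚ) * (- K) * b * b + c * b * b) + (K - c) * (b * b))
            identity = solve-∀ ℚ-ring
            b²K≤aKK : b * b * K ≤ a * K * K
            b²K≤aKK = ≤-excess _ (0≤+ (subst (0ℚ ≤_) (S.form-plane t j (- K) b) (psd-t (- K ∷ S.at t j b)))
              (0≤* (p≤q⇒0≤q-p C≤K) (0≤p² b))) (identity a b c K)

    -- A zero corner forces row 0 and, by symmetry, column 0 to vanish, so the first axis vector is
    -- annihilated.
    null-corner⇒kernel : N zero zero ≃ᵣ fromℚ 0ℚ → HasKernel N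
    null-corner⇒kernel a≃0 = e₀ , e₀≄0 , λ i → ≃ᵣ-trans-pointwise {(N *ᵛ e₀) i} {N i zero} {fromℚ 0ℚ} (column i) (null i)
      where
      e₀ : Vector ℝ (suc n)
      e₀ = fromℚ 1ℚ ∷ λ _ → fromℚ 0ℚ
      e₀≄0 : ¬ (e₀ ≋ λ _ → fromℚ 0ℚ)
      e₀≄0 e₀≋0 with e₀≋0 zero 1ℚ (positive⁻¹ 1ℚ)
      ... | T , 1<1 = <-irrefl refl (1<1 T ℕ.≤-refl)
      column : ∀ i t → seq ((N *ᵛ e₀) i) t ≡ seq (N i zero) t
      column i t = trans (seq-*ᵛ N e₀ i t) (trans
        (cong₂ _+_ (*-identityʳ (seq (N i zero) t)) (sum-zero λ j → *-zeroʳ (seq (N i (suc j)) t)))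
        (+-identityʳ (seq (N i zero) t)))
      null : ∀ i → N i zero ≃ᵣ fromℚ 0ℚ
      null zero    = a≃0
      null (suc i) = ≃ᵣ-trans-pointwise {N (suc i) zero} {N zero (suc i)} {fromℚ 0ℚ}
        (λ t → symN t (suc i) zero) (null-corner⇒null-row a≃0 i)

    module _ {δ} (0<δ : 0ℚ < δ) (δ≤a : Eventually λ t → δ ≤ seq (N zero zero) t) where

      -- `schurᵣ N` unfolds at index `t` to `schur (N ⟨ t ⟩)`, whose form times the positive corner
      -- is the form of `N ⟨ t ⟩` at a lifted vector.
      schurᵣ-psd : EventuallyPSD (schurᵣ N)
      schurᵣ-psd = eventually₂ psd-at δ≤a psd
        where
        psd-at : ∀ t → δ ≤ S.a t → (∀ v → 0ℚ ≤ quadraticForm (N ⟨ t ⟩) v) →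
                 ∀ w → 0ℚ ≤ quadraticForm (schur (N ⟨ t ⟩)) w
        psd-at t δ≤at psd-t w = *-cancel-0≤ (<-≤-trans 0<δ δ≤at)
          (subst (0ℚ ≤_) (S.form-lift t w) (psd-t (S.lift t w)))

      -- Lifting multiplies the tail by the corner, so a vanishing lift would give a wⱼ = 0; the
      -- lower bound δ on the corner turns this into wⱼ = 0.
      schurᵣ-kernel : HasKernel (schurᵣ N) → HasKernel N
      schurᵣ-kernel (w , w≄0 , Sw≋0) = x , (λ x≋0 → w≄0 λ j → unscale j (x≋0 (suc j))) , Nx≋0
        where
        b : Vector ℝ n
        b j = N zero (suc j)
        x : Vector ℝ (suc n)
        x = Rᵣ.- Lᵣ.sum (λ j → b j Rᵣ.* w j) ∷ λ j → N zero zero Rᵣ.* w j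

        x-lift : ∀ t i → (x ⟨ t ⟩ᵛ) i ≡ S.lift t (w ⟨ t ⟩ᵛ) i
        x-lift t zero    = cong -_ (seq-sum (λ j → b j Rᵣ.* w j) t)
        x-lift t (suc j) = refl

        product : ∀ i t → seq ((N *ᵛ x) i) t ≡ (N ⟨ t ⟩ *ℚᵛ S.lift t (w ⟨ t ⟩ᵛ)) i
        product i t = trans (seq-*ᵛ N x i t) (sum-cong-≗ λ j → cong (seq (N i j) t *_) (x-lift t j))

        Nx≋0 : (N *ᵛ x) ≋ λ _ → fromℚ 0ℚ
        Nx≋0 zero    = ≃ᵣ-pointwise {(N *ᵛ x) zero} {fromℚ 0ℚ} λ t → trans (product zero t) (S.lift-zero t (w ⟨ t ⟩ᵛ))
        Nx≋0 (suc i) = ≃ᵣ-trans-pointwise {(N *ᵛ x) (suc i)} {(schurᵣ N *ᵛ w) i} {fromℚ 0ℚ}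
          (λ t → trans (product (suc i) t) (trans (S.lift-suc t (w ⟨ t ⟩ᵛ) i) (sym (seq-*ᵛ (schurᵣ N) w i t)))) (Sw≋0 i)

        unscale : ∀ j → (N zero zero Rᵣ.* w j) ≃ᵣ fromℚ 0ℚ → w j ≃ᵣ fromℚ 0ℚ
        unscale j aw≃0 = small⇒≃ᵣ0 {w j} λ ε 0<ε → eventually₂ (λ t δ≤at ∣aw∣<δε →
            *-cancelˡ-<-nonNeg δ {{nonNegative (<⇒≤ 0<δ)}} (≤-<-trans (scaled t δ≤at) ∣aw∣<δε))
          δ≤a (≃ᵣ0⇒small {N zero zero Rᵣ.* w j} aw≃0 (0<* 0<δ 0<ε))
          where
          scaled : ∀ t → δ ≤ S.a t → δ * ∣ seq (w j) t ∣ ≤ ∣ S.a t * seq (w j) t ∣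
          scaled t δ≤at = ≤-trans
            (*-monoʳ-≤-nonNeg (∣ seq (w j) t ∣) {{nonNegative (0≤∣p∣ (seq (w j) t))}} (≤-trans δ≤at (x≤∣x∣ (S.a t))))
            (≤-reflexive (sym (∣p*q∣≡∣p∣*∣q∣ (S.a t) (seq (w j) t))))

      -- The tail is controlled by the Schur form, and the first coordinate through a x = u - β,
      -- where u² occurs in the completed square and β = b · w is bounded by the tail.
      schurᵣ-coercive : EventuallyCoercive (schurᵣ N) → EventuallyCoercive N
      schurᵣ-coercive (p , r , 0<p , 0<r , coercive) =
        from-bounds (eventually-squares-≤ (λ j → N zero (suc j))) (eventually-≤ (N zero zero))
        where
        from-bounds : (∃ λ K → 0ℚ ≤ K × Eventually λ t → ∀ j → S.b t j * S.b t j ≤ K) →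
                      (∃ λ α → 0ℚ < α × Eventually λ t → S.a t ≤ α) → EventuallyCoercive N
        from-bounds (K , 0≤K , b²≤K) (α , 0<α , a≤α) =
          p * (δ * δ) , M * α , 0<* 0<p (0<* 0<δ 0<δ) , 0<* 0<M 0<α ,
          eventually₂ (λ t f g → f (proj₁ g) (proj₂ g)) (eventually₂ estimate coercive b²≤K)
            (eventually₂ (λ t → _,_) a≤α (eventually₂ (λ t → _,_) δ≤a psd))
          where
          κ = dotBound n K
          0≤κ = 0≤dotBound n 0≤K
          0≤p = <⇒≤ 0<p
          0≤r = <⇒≤ 0<r
          0≤δ = <⇒≤ 0<δ
          -- From δ²x² ≤ (u - β)² ≤ 2u² + 2β² and β² ≤ κW follows pδ²(x² + W) ≤ 2pu² + (2κ + δ²)pW ≤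
          -- 2pu² + (2κ + δ²)rs. This is dominated by M(u² + s) = MaQ ≤ MαQ.
          κδ = (κ + κ) + δ * δ
          0<κδ : 0ℚ < κδ
          0<κδ = +-mono-≤-< (0≤+ 0≤κ 0≤κ) (0<* 0<δ 0<δ)
          M = (p + p) + κδ * r
          0<M : 0ℚ < M
          0<M = +-mono-≤-< (0≤+ 0≤p 0≤p) (0<* 0<κδ 0<r)
          estimate : ∀ t → (∀ w → p * dot w w ≤ r * quadraticForm (schur (N ⟨ t ⟩)) w) →
            (∀ j → S.b t j * S.b t j ≤ K) →
            S.a t ≤ α → (δ ≤ S.a t) × (∀ v → 0ℚ ≤ quadraticForm (N ⟨ t ⟩) v) →
            ∀ v → p * (δ * δ) * dot v v ≤ M * α * quadraticForm (N ⟨ t ⟩) v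
          estimate t coercive-t b²≤Kt at≤α (δ≤at , psd-t) v = ≤-excess _ 0≤excess
            (trans (split M α a Q) step)
            where
            w = v ∘ suc
            x = v zero
            a = S.a t
            β = dot (S.b t) w
            W = dot w w
            Q = quadraticForm (N ⟨ t ⟩) v
            s = quadraticForm (schur (N ⟨ t ⟩)) w
            u = a * x + β
            excess = M * ((α - a) * Q) + (p * ((a - δ) * (a + δ) * (x * x)) + p * ((u + β) * (u + β))
              + ((p + p) * (κ * W - β * β) + κδ * (r * s - p * W) + ((p + p) * s + κδ * r * (u * u))))
            0≤s : 0ℚ ≤ s
            0≤s = *-cancel-0≤ 0<r (≤-trans (0≤* 0≤p (0≤dot w)) (coercive-t w))
            0≤excess : 0ℚ ≤ excess
            0≤excess = 0≤+ (0≤* (<⇒≤ 0<M) (0≤* (p≤q⇒0≤q-p at≤α) (psd-t v)))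
              (0≤+ (0≤+ (0≤* 0≤p (0≤* (0≤* (p≤q⇒0≤q-p δ≤at) (0≤+ (≤-trans 0≤δ δ≤at) 0≤δ)) (0≤p² x)))
                        (0≤* 0≤p (0≤p² (u + β))))
                   (0≤+ (0≤+ (0≤* (0≤+ 0≤p 0≤p) (p≤q⇒0≤q-p (dot-bound (S.b t) w 0≤K b²≤Kt)))
                             (0≤* (<⇒≤ 0<κδ) (p≤q⇒0≤q-p (coercive-t w))))
                        (0≤+ (0≤* (0≤+ 0≤p 0≤p) 0≤s) (0≤* (0≤* (<⇒≤ 0<κδ) 0≤r) (0≤p² u)))))
            split : ∀ M α a Q → M * α * Q ≡ M * ((α - a) * Q) + M * (a * Q)
            split = solve-∀ ℚ-ring
            identity : ∀ p κ δ r a x β W s B →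
              B + ((p + p) + ((κ + κ) + δ * δ) * r) * ((a * x + β) * (a * x + β) + s)
              ≡ p * (δ * δ) * (x * x + W) +
                (B + (p * ((a - δ) * (a + δ) * (x * x)) + p * ((a * x + β + β) * (a * x + β + β))
                  + ((p + p) * (κ * W - β * β) + ((κ + κ) + δ * δ) * (r * s - p * W)
                     + ((p + p) * s + ((κ + κ) + δ * δ) * r * ((a * x + β) * (a * x + β))))))
            identity = solve-∀ ℚ-ring
            step : M * ((α - a) * Q) + M * (a * Q) ≡ p * (δ * δ) * dot v v + excess
            step = trans (cong (λ z → M * ((α - a) * Q) + M * z) (S.complete-square t v))
              (identity p κ δ r a x β W s (M * ((α - a) * Q)))

  -- While corners are bounded away from 0, elimination goes on; if it reaches the empty matrix,
  -- coercivity is carried back from there. The first corner not so bounded equals 0 and gives a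
  -- kernel vector to carry back instead. Which case holds is not decidable in general, hence the
  -- double negation.
  kernel-or-coercive : ∀ {n} (N : Matrix ℝ n n) → (∀ t → Symmetric (N ⟨ t ⟩)) → EventuallyPSD N →
                       ¬ ¬ (HasKernel N ⊎ EventuallyCoercive N)
  kernel-or-coercive {zero}  N symN psd k =
    k (inj₂ (1ℚ , 1ℚ , positive⁻¹ 1ℚ , positive⁻¹ 1ℚ , 0 , λ _ _ _ → ≤-refl))
  kernel-or-coercive {suc n} N symN psd k = ¬¬-excluded-middle λ where
      (no ¬below) → k (inj₁ (null-corner⇒kernel N symN psd (¬bounded-below⇒≃ᵣ0 {N zero zero} (corner≥0 N symN psd) ¬below)))
      (yes (δ , 0<δ , δ≤a)) →
        kernel-or-coercive (schurᵣ N) (λ t → schur-symmetric (N ⟨ t ⟩) (symN t)) (schurᵣ-psd N symN psd 0<δ δ≤a) λ where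
          (inj₁ kernel)   → k (inj₁ (schurᵣ-kernel N symN psd 0<δ δ≤a kernel))
          (inj₂ coercive) → k (inj₂ (schurᵣ-coercive N symN psd 0<δ δ≤a coercive))

  -- From the limit of the bisection to an eigenvalue

  shift-cauchy : ∀ {n} (A : Matrix ℚ n n) s → IsCauchy s → ∀ i j → IsCauchy (λ t → shift (s t) A i j)
  shift-cauchy A s cs i j with i Fin.≟ j
  ... | yes _ = +-cauchy s (λ _ → - A i j) cs (cauchy (fromℚ (- A i j)))
  ... | no _  = cauchy (fromℚ (0ℚ - A i j))

  shiftᵣ : ∀ {n} → ℝ → Matrix ℚ n n → Matrix ℝ n n
  shiftᵣ x A i j = mkℝ (λ t → shift (seq x t) A i j) (shift-cauchy A (seq x) (cauchy x) i j)

  kernel⇒eigenvalue : ∀ {n} (A : Matrix ℚ n n) μ → HasKernel (shiftᵣ μ A) → IsEigenvalue (λ i j → fromℚ (A i j)) μ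
  kernel⇒eigenvalue A μ (x , x≄0 , Nx≋0) = x , x≄0 , eigen
    where
    Aᵣ : Matrix ℝ _ _
    Aᵣ i j = fromℚ (A i j)
    difference : ∀ i t → seq ((shiftᵣ μ A *ᵛ x) i) t ≡ seq μ t * seq (x i) t - seq ((Aᵣ *ᵛ x) i) t
    difference i t = trans (seq-*ᵛ (shiftᵣ μ A) x i t) (trans (shift-*ᵛ (seq μ t) A (x ⟨ t ⟩ᵛ) i)
      (cong (λ z → seq μ t * seq (x i) t - z) (sym (seq-*ᵛ Aᵣ x i t))))
    eigen : (Aᵣ *ᵛ x) ≋ μ • x
    eigen i ε 0<ε = eventually₁ transfer (Nx≋0 i ε 0<ε)
      where
      reorder : ∀ a b → a - b - 0ℚ ≡ - (b - a)
      reorder = solve-∀ ℚ-ring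
      flip : ∀ t → ∣ seq ((shiftᵣ μ A *ᵛ x) i) t - 0ℚ ∣ ≡ ∣ seq ((Aᵣ *ᵛ x) i) t - seq μ t * seq (x i) t ∣
      flip t = trans (cong (λ z → ∣ z - 0ℚ ∣) (difference i t))
        (trans (cong ∣_∣ (reorder (seq μ t * seq (x i) t) (seq ((Aᵣ *ᵛ x) i) t)))
          (∣-p∣≡∣p∣ (seq ((Aᵣ *ᵛ x) i) t - seq μ t * seq (x i) t)))
      transfer : ∀ t → ∣ seq ((shiftᵣ μ A *ᵛ x) i) t - 0ℚ ∣ < ε → ∣ seq ((Aᵣ *ᵛ x) i) t - seq μ t * seq (x i) t ∣ < ε
      transfer t = subst (_< ε) (flip t)

  module _ {n} (A : Matrix ℚ n n) (symA : Symmetric A) (start : Bracket A) where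
    open Bisection A symA start

    limit-psd : EventuallyPSD (shiftᵣ limit A)
    limit-psd = 0 , λ t _ v → subst (0ℚ ≤_) (sym (shift-form (hi (bracket t)) A v)) (p≤q⇒0≤q-p (above (bracket t) v))

    -- At the witness v of a bracket the form of hi - A is smaller than (hi - lo) |v|², so a
    -- coercivity ratio p / r is contradicted once the bracket is narrower than it.
    ¬limit-coercive : ¬ EventuallyCoercive (shiftᵣ limit A)
    ¬limit-coercive (p , r , 0<p , 0<r , T , coercive) = refute (width-vanishes (0<* 0<p (positive⁻¹ (1/ r) {{1/pos⇒pos r}})))
      where
      instance
        r-pos = positive 0<r
        r-nonZero = pos⇒nonZero r
      open ≤-Reasoning
      refute : ¬ (∃ λ N → ∀ t → N ℕ.≤ t → hi (bracket t) - lo (bracket t) < p * 1/ r)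
      refute (N , narrow) = <-irrefl refl (begin-strict
        p * dot v v                                                ≤⟨ coercive t (ℕ.m≤m⊔n T N) v ⟩
        r * quadraticForm (shift (hi P) A) v
          ≡⟨ cong (r *_) (shift-form (hi P) A v) ⟩
        r * (hi P * dot v v - quadraticForm A v)
          <⟨ *-monoʳ-<-pos r (+-monoʳ-< (hi P * dot v v) (neg-antimono-< (below P))) ⟩
        r * (hi P * dot v v - lo P * dot v v)                      ≡⟨ factor r (hi P) (lo P) (dot v v) ⟩
        r * (hi P - lo P) * dot v v
          ≤⟨ *-monoʳ-≤-nonNeg (dot v v) {{nonNegative (0≤dot v)}} (*-monoˡ-≤-nonNeg r {{pos⇒nonNeg r}} (<⇒≤ (narrow t (ℕ.m≤n⊔m T N)))) ⟩
        r * (p * 1/ r) * dot v v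
          ≡⟨ cong (_* dot v v) (trans (swap r p (1/ r)) (trans (cong (p *_) (*-inverseʳ r)) (*-identityʳ p))) ⟩
        p * dot v v                                                ∎)
        where
        t = T ℕ.⊔ N
        P = bracket t
        v = witness P
        factor : ∀ r h l d → r * (h * d - l * d) ≡ r * (h - l) * d
        factor = solve-∀ ℚ-ring
        swap : ∀ x y z → x * (y * z) ≡ y * (x * z)
        swap = solve-∀ ℚ-ring

    ¬¬limit-eigenvalue : ¬ ¬ IsEigenvalue (λ i j → fromℚ (A i j)) limit
    ¬¬limit-eigenvalue k = kernel-or-coercive (shiftᵣ limit A)
      (λ t → shift-symmetric (hi (bracket t)) A symA) limit-psd λ where
        (inj₁ kernel)   → k (kernel⇒eigenvalue A limit kernel)
        (inj₂ coercive) → ¬limit-coercive coercive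

    -- Every upper end lies above `lo start`, so the limit cannot come within the gap `lo start - c`
    -- of the bound. The negated goal absorbs the double negation on the eigenvector.
    eigenvalues-exceed-start : ∀ {c} → c < lo start →
      ¬ (∀ ν → IsEigenvalue (λ i j → fromℚ (A i j)) ν → ν ≤ᵣ fromℚ c)
    eigenvalues-exceed-start {c} c<lo bounded = ¬¬limit-eigenvalue λ eigenvalue →
      refute (bounded limit eigenvalue (lo start - c) (p<q⇒0<q-p c<lo))
      where
      restore : ∀ c l → c + (l - c) ≡ l
      restore = solve-∀ ℚ-ring
      refute : ¬ Eventually λ t → hi (bracket t) < c + (lo start - c)
      refute (T , hi<lo) = <-irrefl refl (<-trans (lo<hi start (bracket T))
        (subst (hi (bracket T) <_) (restore c (lo start)) (hi<lo T ℕ.≤-refl)))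

  rayleigh-bound : ∀ {n} (A : Matrix ℚ n n) → Symmetric A → ∀ c →
    (∀ ν → IsEigenvalue (λ i j → fromℚ (A i j)) ν → ν ≤ᵣ fromℚ c) →
    ∀ v → quadraticForm A v ≤ c * dot v v
  rayleigh-bound A symA c bounded v = ≮⇒≥ λ c∣v∣²<form →
    refute (halfPower-vanishes (0≤dot v) (p<q⇒0<q-p c∣v∣²<form)) (quadraticForm-bounded A)
    where
    rearrange : ∀ c h d q → q ≡ (c + h) * d + (q - c * d - d * h)
    rearrange = solve-∀ ℚ-ring
    refute : (∃ λ N → ∀ n → N ℕ.≤ n → dot v v * halfPower n < quadraticForm A v - c * dot v v) →
             ¬ ∃ λ κ → ∀ w → quadraticForm A w ≤ κ * dot w w
    refute (n , small) (κ , above-κ) = eigenvalues-exceed-start A symA start (<-excess {c} (halfPower n) (0<halfPower n) refl) bounded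
      where
      -- The lower end must exceed `c` strictly and stay below the Rayleigh quotient at `v`; a small
      -- power of one half fits into the gap without a division by |v|².
      start : Bracket A
      start = record
        { lo = c + halfPower n ; hi = κ ; witness = v
        ; below = <-excess _ (p<q⇒0<q-p (small n ℕ.≤-refl)) (rearrange c (halfPower n) (dot v v) (quadraticForm A v))
        ; above = above-κ }

-- Inversion parities and signs of vertex orderings

module OrderingSigns where
  open import Data.Fin as Fin using (Fin; zero; suc; toℕ; punchIn)
  import Data.Fin.Properties as Fin
  open import Data.Fin.Permutation using (Permutation′; _⟨$⟩ʳ_; _⟨$⟩ˡ_; inverseˡ)
  open import Data.Fin.Subset using (Subset; _∈_; _-_)
  open import Data.Fin.Subset.Properties using (_∈?_; x∈p∧x≢y⇒x∈p-y; p─q⊆p)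
  open import Data.Integer as ℤ using (ℤ; 1ℤ; -1ℤ)
  import Data.Integer.Properties as ℤ
  import Data.Integer.Tactic.RingSolver as ℤ-Solver
  open import Data.List using (_++_; map; length; filter; tabulate; cartesianProduct)
  import Data.List.Properties as List
  open import Data.Nat as ℕ using (ℕ; zero; suc; _+_; _*_)
  import Data.Nat.Properties as ℕ
  open import Data.Nat.Tactic.RingSolver using (solve-∀)
  open import Relation.Binary.Definitions using (tri<; tri≈; tri>)
  open import Algebra.Properties.Semiring.Sum ℕ.+-*-semiring
  open SingleTerm ℕ.+-0-commutativeMonoid

  𝟙 : ∀ {p} {P : Set p} → Dec P → ℕ
  𝟙 P? = if does P? then 1 else 0

  𝟙-yes : ∀ {p} {P : Set p} (P? : Dec P) → P → 𝟙 P? ≡ 1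
  𝟙-yes (yes _) _ = refl
  𝟙-yes (no ¬p) p = contradiction p ¬p

  𝟙-no : ∀ {p} {P : Set p} (P? : Dec P) → ¬ P → 𝟙 P? ≡ 0
  𝟙-no (yes p) ¬p = contradiction p ¬p
  𝟙-no (no _)  _  = refl

  𝟙-cong : ∀ {p q} {P : Set p} {Q : Set q} (P? : Dec P) (Q? : Dec Q) → (P → Q) → (Q → P) → 𝟙 P? ≡ 𝟙 Q?
  𝟙-cong (yes p) Q? f g = sym (𝟙-yes Q? (f p))
  𝟙-cong (no ¬p) Q? f g = sym (𝟙-no Q? (¬p ∘ g))

  𝟙-× : ∀ {p q} {P : Set p} {Q : Set q} (P? : Dec P) (Q? : Dec Q) → 𝟙 (P? ×-dec Q?) ≡ 𝟙 P? * 𝟙 Q?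
  𝟙-× (no _)  Q? = refl
  𝟙-× (yes _) Q? with does Q?
  ... | true  = refl
  ... | false = refl

  length-filter-tabulate : ∀ {A : Set} {P : Pred A 0ℓ} (P? : Decidable P) {n} (f : Fin n → A) →
                           length (filter P? (tabulate f)) ≡ sum (λ i → 𝟙 (P? (f i)))
  length-filter-tabulate P? {zero}  f = refl
  length-filter-tabulate P? {suc n} f with does (P? (f zero))
  ... | true  = cong suc (length-filter-tabulate P? (f ∘ suc))
  ... | false = length-filter-tabulate P? (f ∘ suc)

  count-sum : ∀ {n} {P : Pred (Fin n) 0ℓ} (P? : Decidable P) → count P? ≡ sum (λ i → 𝟙 (P? i))
  count-sum P? = length-filter-tabulate P? id

  length-filter-cartesianProduct : ∀ {A B : Set} {P : Pred (A × B) 0ℓ} (P? : Decidable P)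
    {m n} (f : Fin m → A) (g : Fin n → B) →
    length (filter P? (cartesianProduct (tabulate f) (tabulate g))) ≡ sum (λ i → sum (λ j → 𝟙 (P? (f i , g j))))
  length-filter-cartesianProduct P? {zero}  f g = refl
  length-filter-cartesianProduct P? {suc m} f g = begin
    length (filter P? (row ++ rest))                    ≡⟨ cong length (List.filter-++ P? row rest) ⟩
    length (filter P? row ++ filter P? rest)            ≡⟨ List.length-++ (filter P? row) ⟩
    length (filter P? row) + length (filter P? rest)    ≡⟨ cong₂ _+_
      (trans (cong (length ∘ filter P?) (List.map-tabulate g (f zero ,_))) (length-filter-tabulate P? (λ j → f zero , g j)))
      (length-filter-cartesianProduct P? (f ∘ suc) g) ⟩
    _                                                   ∎
    where
    open ≡-Reasoning
    row  = map (f zero ,_) (tabulate g)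
    rest = cartesianProduct (tabulate (f ∘ suc)) (tabulate g)

  lt : ∀ {n} → Fin n → Fin n → ℕ
  lt i j = 𝟙 (i Fin.<? j)

  lt-irrefl : ∀ {n} (i : Fin n) → lt i i ≡ 0
  lt-irrefl i = 𝟙-no (i Fin.<? i) (ℕ.<-irrefl refl)

  lt-total : ∀ {n} {i j : Fin n} → i ≢ j → lt i j + lt j i ≡ 1
  lt-total {i = i} {j} i≢j with Fin.<-cmp i j
  ... | tri< i<j _ j≮i = cong₂ _+_ (𝟙-yes (i Fin.<? j) i<j) (𝟙-no (j Fin.<? i) j≮i)
  ... | tri≈ _ i≡j _   = contradiction i≡j i≢j
  ... | tri> i≮j _ j<i = cong₂ _+_ (𝟙-no (i Fin.<? j) i≮j) (𝟙-yes (j Fin.<? i) j<i)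

  -- Taken for maps into any `Fin n`, so that a vertex ordering has a sign of its own against the
  -- order of the ambient vertex set.
  inversionCount : ∀ {m n} → (Fin m → Fin n) → ℕ
  inversionCount f = sum (λ i → sum (λ j → lt i j * lt (f j) (f i)))

  inversions≡inversionCount : ∀ {m} (π : Permutation′ m) → inversions π ≡ inversionCount (π ⟨$⟩ʳ_)
  inversions≡inversionCount π = trans
    (length-filter-cartesianProduct (λ (i , j) → (i Fin.<? j) ×-dec ((π ⟨$⟩ʳ j) Fin.<? (π ⟨$⟩ʳ i))) id id)
    (sum-cong-≗ λ i → sum-cong-≗ λ j → 𝟙-× (i Fin.<? j) ((π ⟨$⟩ʳ j) Fin.<? (π ⟨$⟩ʳ i)))

  sum₂-+ : ∀ {m n} (f g : Fin m → Fin n → ℕ) →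
           sum (λ i → sum (λ j → f i j + g i j)) ≡ sum (λ i → sum (f i)) + sum (λ i → sum (g i))
  sum₂-+ f g = trans (sum-cong-≗ λ i → ∑-distrib-+ (f i) (g i)) (∑-distrib-+ (λ i → sum (f i)) (λ i → sum (g i)))

  -- z counts the pairs that are inverted by π and whose images are inverted by a.
  inversionCount-∘ : ∀ {m n} (π : Permutation′ m) (a : Fin m → Fin n) → Injective _≡_ _≡_ a →
    ∃ λ z → inversionCount (π ⟨$⟩ʳ_) + inversionCount a ≡ inversionCount (a ∘ (π ⟨$⟩ʳ_)) + (z + z)
  inversionCount-∘ {m} π a inj = ΣZ , (begin
    inversionCount p + inversionCount a  ≡⟨ cong₂ _+_ count-π (trans reindex count-a) ⟩
    (ΣY + ΣW) + (ΣX + ΣZ)                ≡⟨ cong (λ w → (ΣY + w) + (ΣX + ΣZ)) W≡Z ⟩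
    (ΣY + ΣZ) + (ΣX + ΣZ)                ≡⟨ regroup ΣX ΣY ΣZ ⟩
    (ΣX + ΣY) + (ΣZ + ΣZ)                ≡⟨ cong (_+ (ΣZ + ΣZ)) (sym count-b) ⟩
    inversionCount b + (ΣZ + ΣZ)         ∎)
    where
    open ≡-Reasoning
    p = π ⟨$⟩ʳ_
    b = a ∘ p
    -- A pair is classified by three comparisons: of the indices, of their images under `π`, and of
    -- their images under `b`. Each of the three counts below fixes two of them and splits along the
    -- third.
    X Y Z W : Fin m → Fin m → ℕ
    X i j = lt i j * lt (p i) (p j) * lt (b j) (b i)
    Y i j = lt i j * lt (p j) (p i) * lt (b j) (b i)
    Z i j = lt j i * lt (p i) (p j) * lt (b j) (b i)
    W i j = lt i j * lt (p j) (p i) * lt (b i) (b j)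
    Σ₂ : (Fin m → Fin m → ℕ) → ℕ
    Σ₂ f = sum (λ i → sum (f i))
    ΣX = Σ₂ X
    ΣY = Σ₂ Y
    ΣZ = Σ₂ Z
    ΣW = Σ₂ W

    p-injective : Injective _≡_ _≡_ p
    p-injective eq = trans (sym (inverseˡ π)) (trans (cong (π ⟨$⟩ˡ_) eq) (inverseˡ π))

    regroup : ∀ x y z → (y + z) + (x + z) ≡ (x + y) + (z + z)
    regroup = solve-∀

    expand₁ : ∀ u v s t → s + t ≡ 1 → u * v ≡ u * s * v + u * t * v
    expand₁ u v s t eq = trans (sym (ℕ.*-identityʳ (u * v))) (trans (cong (u * v *_) (sym eq)) (distribute u v s t))
      where
      distribute : ∀ u v s t → u * v * (s + t) ≡ u * s * v + u * t * v
      distribute = solve-∀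

    expand₂ : ∀ u v s t → s + t ≡ 1 → u * v ≡ s * u * v + t * u * v
    expand₂ u v s t eq = trans (expand₁ u v s t eq) (cong₂ (λ x y → x * v + y * v) (ℕ.*-comm u s) (ℕ.*-comm u t))

    expand₃ : ∀ u v s t → s + t ≡ 1 → u * v ≡ u * v * s + u * v * t
    expand₃ u v s t eq = trans (sym (ℕ.*-identityʳ (u * v))) (trans (cong (u * v *_) (sym eq)) (ℕ.*-distribˡ-+ (u * v) s t))

    count-b : inversionCount b ≡ ΣX + ΣY
    count-b = trans (sum-cong-≗ λ i → sum-cong-≗ (pointwise i)) (sum₂-+ X Y)
      where
      pointwise : ∀ i j → lt i j * lt (b j) (b i) ≡ X i j + Y i j
      pointwise i j with i Fin.≟ j
      ... | no i≢j   = expand₁ (lt i j) (lt (b j) (b i)) (lt (p i) (p j)) (lt (p j) (p i)) (lt-total (i≢j ∘ p-injective))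
      ... | yes refl rewrite lt-irrefl i = refl

    count-a : sum (λ i → sum (λ j → lt (p i) (p j) * lt (b j) (b i))) ≡ ΣX + ΣZ
    count-a = trans (sum-cong-≗ λ i → sum-cong-≗ (pointwise i)) (sum₂-+ X Z)
      where
      pointwise : ∀ i j → lt (p i) (p j) * lt (b j) (b i) ≡ X i j + Z i j
      pointwise i j with i Fin.≟ j
      ... | no i≢j   = expand₂ (lt (p i) (p j)) (lt (b j) (b i)) (lt i j) (lt j i) (lt-total i≢j)
      ... | yes refl rewrite lt-irrefl i | lt-irrefl (p i) = refl

    count-π : inversionCount p ≡ ΣY + ΣW
    count-π = trans (sum-cong-≗ λ i → sum-cong-≗ (pointwise i)) (sum₂-+ Y W)
      where
      pointwise : ∀ i j → lt i j * lt (p j) (p i) ≡ Y i j + W i j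
      pointwise i j with i Fin.≟ j
      ... | no i≢j   = expand₃ (lt i j) (lt (p j) (p i)) (lt (b j) (b i)) (lt (b i) (b j)) (lt-total (λ eq → i≢j (sym (p-injective (inj eq)))))
      ... | yes refl rewrite lt-irrefl i = refl

    reindex : inversionCount a ≡ sum (λ i → sum (λ j → lt (p i) (p j) * lt (b j) (b i)))
    reindex = trans (sum-permute (λ i → sum (λ j → lt i j * lt (a j) (a i))) π)
      (sum-cong-≗ λ i → sum-permute (λ j → lt (p i) j * lt (a j) (b i)) π)

    -- `W` is `Z` with the two indices exchanged.
    W≡Z : ΣW ≡ ΣZ
    W≡Z = ∑-comm W

  sg : ℕ → ℤ
  sg n = -1ℤ ℤ.^ n

  sg-+ : ∀ m n → sg (m + n) ≡ sg m ℤ.* sg n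
  sg-+ = ℤ.^-distribˡ-+-* -1ℤ

  sg² : ∀ n → sg n ℤ.* sg n ≡ 1ℤ
  sg² zero    = refl
  sg² (suc n) = trans (square (sg n)) (sg² n)
    where
    square : ∀ x → (-1ℤ ℤ.* x) ℤ.* (-1ℤ ℤ.* x) ≡ x ℤ.* x
    square = ℤ-Solver.solve-∀

  sg-double : ∀ z → sg (z + z) ≡ 1ℤ
  sg-double z = trans (sg-+ z z) (sg² z)

  sg-cancelʳ : ∀ x n → x ℤ.* sg n ℤ.* sg n ≡ x
  sg-cancelʳ x n = trans (ℤ.*-assoc x (sg n) (sg n)) (trans (cong (x ℤ.*_) (sg² n)) (ℤ.*-identityʳ x))

  orderingSign : ∀ {n} {s : Subset n} {m} → VertexOrdering s m → ℤ
  orderingSign a = sg (inversionCount (vertex a))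

  -- One ordering is the other composed with the permutation, and inversion numbers add modulo 2
  -- under composition. The resulting factorisation is what separates σ from F in an incidence
  -- number.
  sgn-carrying : ∀ {n} {s t : Subset n} {m} (a : VertexOrdering s m) (b : VertexOrdering t m) (s≡t : s ≡ t) →
                 sgn (carrying a b s≡t) ≡ orderingSign a ℤ.* orderingSign b
  sgn-carrying a b refl = begin
    sgn π
      ≡⟨ cong sg (inversions≡inversionCount π) ⟩
    sg (inversionCount p)
      ≡⟨ sym (sg-cancelʳ (sg (inversionCount p)) (inversionCount (vertex a))) ⟩
    sg (inversionCount p) ℤ.* orderingSign a ℤ.* orderingSign a
      ≡⟨ cong (ℤ._* orderingSign a) (sym (sg-+ (inversionCount p) (inversionCount (vertex a)))) ⟩
    sg (inversionCount p + inversionCount (vertex a)) ℤ.* orderingSign a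
      ≡⟨ cong (λ x → sg x ℤ.* orderingSign a) composite ⟩
    sg (inversionCount (vertex b) + (z + z)) ℤ.* orderingSign a
      ≡⟨ cong (ℤ._* orderingSign a) (trans (sg-+ (inversionCount (vertex b)) (z + z)) (trans (cong (orderingSign b ℤ.*_) (sg-double z)) (ℤ.*-identityʳ (orderingSign b)))) ⟩
    orderingSign b ℤ.* orderingSign a
      ≡⟨ ℤ.*-comm (orderingSign b) (orderingSign a) ⟩
    orderingSign a ℤ.* orderingSign b                              ∎
    where
    open ≡-Reasoning
    π = carrying a b refl
    p = π ⟨$⟩ʳ_
    z = proj₁ (inversionCount-∘ π (vertex a) (injective a))
    composite : inversionCount p + inversionCount (vertex a) ≡ inversionCount (vertex b) + (z + z)
    composite = trans (proj₂ (inversionCount-∘ π (vertex a) (injective a)))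
      (cong (_+ (z + z)) (sum-cong-≗ λ i → sum-cong-≗ λ j →
        cong₂ (λ u v → lt i j * lt u v) (proj₂ (onto a (vertex-∈ b j))) (proj₂ (onto a (vertex-∈ b i)))))

  lt-punchIn : ∀ {n} (i : Fin (suc n)) (p q : Fin n) → lt (punchIn i p) (punchIn i q) ≡ lt p q
  lt-punchIn i p q = 𝟙-cong (punchIn i p Fin.<? punchIn i q) (p Fin.<? q)
    (λ h → ℕ.≰⇒> λ q≤p → ℕ.<⇒≱ h (Fin.punchIn-mono-≤ i q p q≤p))
    (λ h → ℕ.≰⇒> λ q≤p → ℕ.<⇒≱ h (Fin.punchIn-cancel-≤ i q p q≤p))

  sum-lt : ∀ {n} (i : Fin n) → sum (λ p → lt p i) ≡ toℕ i
  sum-lt {suc n} zero = sum-zero {f = λ (p : Fin (suc n)) → lt p zero} λ p → 𝟙-no (p Fin.<? zero {n}) λ ()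
  sum-lt {suc n} (suc i) = cong suc (sum-lt i)

  -- Turns a sum along an ordering into one over the set; this is how `rank` comes to be independent
  -- of the orientation.
  sum-vertices : ∀ {n m} {s : Subset n} (a : VertexOrdering s m) (f : Fin n → ℕ) →
                 sum (λ p → f (vertex a p)) ≡ sum (λ u → 𝟙 (u ∈? s) * f u)
  sum-vertices {s = s} a f = begin
    sum (λ p → f (vertex a p))                                    ≡⟨ sum-cong-≗ (λ p → sym (trans
        (sum-single (λ u → 𝟙 (vertex a p Fin.≟ u) * f u) (vertex a p) (λ u u≢ → cong (_* f u) (𝟙-no (vertex a p Fin.≟ u) (u≢ ∘ sym))))
        (trans (cong (_* f (vertex a p)) (𝟙-yes (vertex a p Fin.≟ vertex a p) refl)) (ℕ.*-identityˡ _)))) ⟩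
    sum (λ p → sum (λ u → 𝟙 (vertex a p Fin.≟ u) * f u))
      ≡⟨ ∑-comm (λ p u → 𝟙 (vertex a p Fin.≟ u) * f u) ⟩
    sum (λ u → sum (λ p → 𝟙 (vertex a p Fin.≟ u) * f u))
      ≡⟨ sum-cong-≗ (λ u → trans (sym (*-distribʳ-sum (f u) (λ p → 𝟙 (vertex a p Fin.≟ u)))) (cong (_* f u) (hits u))) ⟩
    sum (λ u → 𝟙 (u ∈? s) * f u)                                  ∎
    where
    open ≡-Reasoning
    hits : ∀ u → sum (λ p → 𝟙 (vertex a p Fin.≟ u)) ≡ 𝟙 (u ∈? s)
    hits u with u ∈? s
    ... | no u∉s  = sum-zero λ p → 𝟙-no (vertex a p Fin.≟ u) λ { refl → u∉s (vertex-∈ a p) }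
    ... | yes u∈s with onto a u∈s
    ...   | q , refl = trans
              (sum-single (λ p → 𝟙 (vertex a p Fin.≟ vertex a q)) q (λ p p≢q → 𝟙-no (vertex a p Fin.≟ vertex a q) (p≢q ∘ injective a)))
              (𝟙-yes (vertex a q Fin.≟ vertex a q) refl)

  rank : ∀ {n} → Subset n → Fin n → ℕ
  rank s v = sum (λ u → 𝟙 (u ∈? s) * lt u v)

  rank-remove : ∀ {n} (s : Subset n) {v} → v ∈ s → ∀ x → rank s x ≡ rank (s - v) x + lt v x
  rank-remove s {v} v∈s x = begin
    sum (λ u → 𝟙 (u ∈? s) * lt u x)                                            ≡⟨ sum-cong-≗ pointwise ⟩
    sum (λ u → 𝟙 (u ∈? (s - v)) * lt u x + 𝟙 (u Fin.≟ v) * lt u x)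
      ≡⟨ ∑-distrib-+ (λ u → 𝟙 (u ∈? (s - v)) * lt u x) (λ u → 𝟙 (u Fin.≟ v) * lt u x) ⟩
    rank (s - v) x + sum (λ u → 𝟙 (u Fin.≟ v) * lt u x)
      ≡⟨ cong (rank (s - v) x +_) (trans
        (sum-single (λ u → 𝟙 (u Fin.≟ v) * lt u x) v (λ u u≢v → cong (_* lt u x) (𝟙-no (u Fin.≟ v) u≢v)))
        (trans (cong (_* lt v x) (𝟙-yes (v Fin.≟ v) refl)) (ℕ.*-identityˡ (lt v x)))) ⟩
    rank (s - v) x + lt v x                                                    ∎
    where
    open ≡-Reasoning
    split : ∀ u → 𝟙 (u ∈? s) ≡ 𝟙 (u ∈? (s - v)) + 𝟙 (u Fin.≟ v)
    split u with u Fin.≟ v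
    ... | yes refl = trans (𝟙-yes (v ∈? s) v∈s) (cong (_+ 1) (sym (𝟙-no (v ∈? (s - v)) (x∉p-x s v))))
    ... | no u≢v   = trans (𝟙-cong (u ∈? s) (u ∈? (s - v)) (λ u∈s → x∈p∧x≢y⇒x∈p-y u∈s u≢v) (p─q⊆p s _)) (sym (ℕ.+-identityʳ _))
    pointwise : ∀ u → 𝟙 (u ∈? s) * lt u x ≡ 𝟙 (u ∈? (s - v)) * lt u x + 𝟙 (u Fin.≟ v) * lt u x
    pointwise u = trans (cong (_* lt u x) (split u)) (ℕ.*-distribʳ-+ (lt u x) (𝟙 (u ∈? (s - v))) (𝟙 (u Fin.≟ v)))

  module _ {n m} (a : Fin (suc m) → Fin n) (inj : Injective _≡_ _≡_ a) (i : Fin (suc m)) where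

    private
      t : Fin (suc m) → Fin (suc m) → ℕ
      t p q = lt p q * lt (a q) (a p)

      crossing : ℕ
      crossing = sum (t i) + sum (λ p → t p i)

      tᵢᵢ≡0 : t i i ≡ 0
      tᵢᵢ≡0 = cong (_* lt (a i) (a i)) (lt-irrefl i)

    inversionCount-punchIn : inversionCount a ≡ crossing + inversionCount (a ∘ punchIn i)
    inversionCount-punchIn = begin
      sum (λ p → sum (t p))                                   ≡⟨ sum-remove {i = i} (λ p → sum (t p)) ⟩
      sum (t i) + sum (λ p → sum (t (punchIn i p)))
        ≡⟨ cong (sum (t i) +_) (sum-cong-≗ λ p → sum-remove {i = i} (t (punchIn i p))) ⟩
      sum (t i) + sum (λ p → t (punchIn i p) i + inner p)
        ≡⟨ cong (sum (t i) +_) (∑-distrib-+ (λ p → t (punchIn i p) i) inner) ⟩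
      sum (t i) + (sum (λ p → t (punchIn i p) i) + sum inner)
        ≡⟨ cong₂ (λ x y → sum (t i) + (x + y)) column (sum-cong-≗ λ p → sum-cong-≗ λ q → cong (_* lt (a (punchIn i q)) (a (punchIn i p))) (lt-punchIn i p q)) ⟩
      sum (t i) + (sum (λ p → t p i) + inversionCount (a ∘ punchIn i))
        ≡⟨ sym (ℕ.+-assoc (sum (t i)) _ _) ⟩
      crossing + inversionCount (a ∘ punchIn i)               ∎
      where
      open ≡-Reasoning
      inner : Fin m → ℕ
      inner p = sum (λ q → t (punchIn i p) (punchIn i q))
      column : sum (λ p → t (punchIn i p) i) ≡ sum (λ p → t p i)
      column = sym (trans (sum-remove {i = i} (λ p → t p i)) (cong (_+ sum (λ p → t (punchIn i p) i)) tᵢᵢ≡0))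

    -- The indices p and i form an inversion exactly when one of p < i and a p < a i holds without
    -- the other. Counting both conditions thus counts the inversions through i, plus twice the p at
    -- which both hold.
    crossing-parity : ∃ λ z → toℕ i + sum (λ p → lt (a p) (a i)) ≡ crossing + (z + z)
    crossing-parity = sum z , (begin
      toℕ i + sum (λ p → lt (a p) (a i))
        ≡⟨ cong (_+ sum (λ p → lt (a p) (a i))) (sym (sum-lt i)) ⟩
      sum (λ p → lt p i) + sum (λ p → lt (a p) (a i))
        ≡⟨ sym (∑-distrib-+ (λ p → lt p i) (λ p → lt (a p) (a i))) ⟩
      sum (λ p → lt p i + lt (a p) (a i))                     ≡⟨ sum-cong-≗ pointwise ⟩
      sum (λ p → (t i p + t p i) + (z p + z p))
        ≡⟨ ∑-distrib-+ (λ p → t i p + t p i) (λ p → z p + z p) ⟩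
      sum (λ p → t i p + t p i) + sum (λ p → z p + z p)
        ≡⟨ cong₂ _+_ (∑-distrib-+ (t i) (λ p → t p i)) (∑-distrib-+ z z) ⟩
      crossing + (sum z + sum z)                              ∎)
      where
      open ≡-Reasoning
      z : Fin (suc m) → ℕ
      z p = lt p i * lt (a p) (a i)
      mix : ∀ x x′ y y′ → x + x′ ≡ 1 → y + y′ ≡ 1 → x + y ≡ (x′ * y + x * y′) + (x * y + x * y)
      mix x x′ y y′ ex ey = begin
        x + y
          ≡⟨ sym (cong₂ _+_ (ℕ.*-identityʳ x) (ℕ.*-identityʳ y)) ⟩
        x * 1 + y * 1                                ≡⟨ sym (cong₂ (λ u v → x * u + y * v) ey ex) ⟩
        x * (y + y′) + y * (x + x′)                  ≡⟨ regroup x x′ y y′ ⟩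
        (x′ * y + x * y′) + (x * y + x * y)          ∎
        where
        regroup : ∀ x x′ y y′ → x * (y + y′) + y * (x + x′) ≡ (x′ * y + x * y′) + (x * y + x * y)
        regroup = solve-∀
      pointwise : ∀ p → lt p i + lt (a p) (a i) ≡ (t i p + t p i) + (z p + z p)
      pointwise p with p Fin.≟ i
      ... | yes refl rewrite lt-irrefl p | lt-irrefl (a p) = refl
      ... | no p≢i   = mix (lt p i) (lt i p) (lt (a p) (a i)) (lt (a i) (a p)) (lt-total p≢i) (lt-total (p≢i ∘ inj))

    sg-punchIn : sg (toℕ i) ℤ.* sg (inversionCount (a ∘ punchIn i)) ≡
                 sg (sum (λ p → lt (a p) (a i))) ℤ.* sg (inversionCount a)
    sg-punchIn with crossing-parity
    ... | z , parity = begin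
      sg (toℕ i) ℤ.* S
        ≡⟨ cong (ℤ._* S) (sym (sg-cancelʳ (sg (toℕ i)) r)) ⟩
      sg (toℕ i) ℤ.* sg r ℤ.* sg r ℤ.* S
        ≡⟨ cong (λ x → x ℤ.* sg r ℤ.* S) (trans (sym (sg-+ (toℕ i) r)) (trans (cong sg parity) (trans (sg-+ crossing (z + z)) (trans (cong (sg crossing ℤ.*_) (sg-double z)) (ℤ.*-identityʳ (sg crossing)))))) ⟩
      sg crossing ℤ.* sg r ℤ.* S                      ≡⟨ rotate (sg crossing) (sg r) S ⟩
      sg r ℤ.* (sg crossing ℤ.* S)
        ≡⟨ cong (sg r ℤ.*_) (trans (sym (sg-+ crossing (inversionCount (a ∘ punchIn i)))) (cong sg (sym inversionCount-punchIn))) ⟩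
      sg r ℤ.* sg (inversionCount a)                  ∎
      where
      open ≡-Reasoning
      r = sum (λ p → lt (a p) (a i))
      S = sg (inversionCount (a ∘ punchIn i))
      rotate : ∀ x y z → x ℤ.* y ℤ.* z ≡ y ℤ.* (x ℤ.* z)
      rotate = ℤ-Solver.solve-∀

  -- Trades the position of the omitted vertex, which depends on the ordering, for its rank, which
  -- does not; the ordering survives only in a factor independent of `i`.
  sg-omit : ∀ {n m} {s : Subset n} (a : VertexOrdering s (suc m)) i →
            sg (toℕ i) ℤ.* orderingSign (omit a i) ≡ sg (rank s (vertex a i)) ℤ.* orderingSign a
  sg-omit a i = trans (sg-punchIn (vertex a) (injective a) i)
    (cong (λ r → sg r ℤ.* orderingSign a) (sum-vertices a (λ u → lt u (vertex a i))))

-- Faces as subsets, and the sign rule for incidence numbers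

module FanVectors where
  open import Data.Fin as Fin using (Fin; zero; suc; toℕ)
  open import Data.Fin.Properties using (any?; suc-injective)
  open import Data.Fin.Subset using (Subset; inside; outside; _∈_; _∉_; _⊆_; _∩_; _-_; ∣_∣)
  open import Data.Fin.Subset.Properties
  open import Data.Integer as ℤ using (ℤ; 0ℤ; 1ℤ; -1ℤ; _*_; _+_)
  import Data.Integer.Properties as ℤ
  open import Data.Integer.Tactic.RingSolver using (solve-∀)
  open import Data.List using (List; _∷_; map; lookup)
  open import Data.List.Membership.Propositional using () renaming (_∈_ to _∈ˡ_)
  open import Data.List.Membership.Propositional.Properties using (∈-lookup; ∈-filter⁺; ∈-filter⁻; ∈-++⁺ˡ; ∈-++⁺ʳ; ∈-map⁺; ∈-map⁻)
  open import Data.List.Relation.Unary.All as All using ()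
  open import Data.List.Relation.Unary.AllPairs using ([]; _∷_)
  open import Data.List.Relation.Unary.Any using (here; index)
  open import Data.List.Relation.Unary.Any.Properties using (lookup-index)
  open import Data.List.Relation.Unary.Unique.Propositional using (Unique)
  open import Data.List.Relation.Unary.Unique.Propositional.Properties using (map⁺; ++⁺; filter⁺)
  open import Data.Nat as ℕ using (ℕ; zero; suc)
  import Data.Nat.Properties as ℕ
  import Data.Nat.Tactic.RingSolver as ℕ-Solver
  import Data.Vec as Vec
  open import Data.Vec.Functional using (Vector)
  open OrderingSigns
  import Algebra.Properties.Semiring.Sum ℕ.+-*-semiring as ∑ℕ
  open import Algebra.Properties.Semiring.Sum ℤ.+-*-semiring
  open SingleTerm ℤ.+-0-commutativeMonoid
  open SingleTerm ℕ.+-0-commutativeMonoid using () renaming (sum-zero to sum-zeroℕ; sum-single to sum-singleℕ)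

  ⊆∧∣∣≡⇒≡ : ∀ {n} {p q : Subset n} → p ⊆ q → ∣ p ∣ ≡ ∣ q ∣ → p ≡ q
  ⊆∧∣∣≡⇒≡ {p = p} {q} p⊆q ∣p∣≡∣q∣ = ⊆-antisym p⊆q q⊆p
    where
    q⊆p : q ⊆ p
    q⊆p {x} x∈q with x ∈? p
    ... | yes x∈p = x∈p
    ... | no x∉p  = contradiction ∣p∣≡∣q∣ (ℕ.<⇒≢ (p⊂q⇒∣p∣<∣q∣ (p⊆q , x , x∈q , x∉p)))

  ∣p∣≡1+∣p-x∣ : ∀ {n} {p : Subset n} {x} → x ∈ p → ∣ p ∣ ≡ suc ∣ p - x ∣
  ∣p∣≡1+∣p-x∣ {p = inside Vec.∷ p}  {zero}  Vec.here        = cong (suc ∘ ∣_∣) (sym (p─⊥≡p p))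
  ∣p∣≡1+∣p-x∣ {p = inside Vec.∷ p}  {suc x} (Vec.there x∈p) = cong suc (∣p∣≡1+∣p-x∣ x∈p)
  ∣p∣≡1+∣p-x∣ {p = outside Vec.∷ p} {suc x} (Vec.there x∈p) = ∣p∣≡1+∣p-x∣ x∈p

  ⊆-removal : ∀ {n} {p q : Subset n} → p ⊆ q → ∣ q ∣ ≡ suc ∣ p ∣ → ∃ λ v → v ∈ q × q - v ≡ p
  ⊆-removal {p = p} {q} p⊆q ∣q∣≡ with any? (λ v → (v ∈? q) ×-dec (¬? (v ∈? p)))
  ... | yes (v , v∈q , v∉p) = v , v∈q , sym (⊆∧∣∣≡⇒≡ p⊆q-v (ℕ.suc-injective (trans (sym ∣q∣≡) (∣p∣≡1+∣p-x∣ v∈q))))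
    where
    p⊆q-v : p ⊆ q - v
    p⊆q-v x∈p = x∈p∧x≢y⇒x∈p-y (p⊆q x∈p) λ { refl → v∉p x∈p }
  ... | no none = contradiction (trans (sym ∣q∣≡) (cong ∣_∣ (⊆-antisym q⊆p p⊆q))) (ℕ.1+n≢n)
    where
    q⊆p : q ⊆ p
    q⊆p {x} x∈q with x ∈? p
    ... | yes x∈p = x∈p
    ... | no x∉p  = contradiction (x , x∈q , x∉p) none

  p-x-injective : ∀ {n} {p : Subset n} {x y} → x ∈ p → p - x ≡ p - y → x ≡ y
  p-x-injective {p = p} {x} {y} x∈p eq with x Fin.≟ y
  ... | yes x≡y = x≡y
  ... | no x≢y  = contradiction (subst (x ∈_) (sym eq) (x∈p∧x≢y⇒x∈p-y x∈p x≢y)) (x∉p-x p x)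

  ∈-subsets : ∀ {n} (s : Subset n) → s ∈ˡ subsets n
  ∈-subsets Vec.[]               = here refl
  ∈-subsets (inside  Vec.∷ s)    = ∈-++⁺ˡ (∈-map⁺ (inside Vec.∷_) (∈-subsets s))
  ∈-subsets (outside Vec.∷ s)    = ∈-++⁺ʳ _ (∈-map⁺ (outside Vec.∷_) (∈-subsets s))

  subsets-unique : ∀ n → Unique (subsets n)
  subsets-unique zero    = All.[] ∷ []
  subsets-unique (suc n) = ++⁺ (map⁺ (λ { refl → refl }) (subsets-unique n)) (map⁺ (λ { refl → refl }) (subsets-unique n)) disjoint
    where
    disjoint : ∀ {s} → ¬ (s ∈ˡ map (inside Vec.∷_) (subsets n) × s ∈ˡ map (outside Vec.∷_) (subsets n))
    disjoint (s∈₁ , s∈₂) with ∈-map⁻ (inside Vec.∷_) s∈₁ | ∈-map⁻ (outside Vec.∷_) s∈₂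
    ... | _ , _ , refl | _ , _ , ()

  Unique⇒lookup-injective : ∀ {A : Set} {xs : List A} → Unique xs → Injective _≡_ _≡_ (lookup xs)
  Unique⇒lookup-injective (x∉ ∷ u) {zero}  {zero}  eq = refl
  Unique⇒lookup-injective (x∉ ∷ u) {zero}  {suc j} eq = contradiction eq (All.lookup x∉ (∈-lookup j))
  Unique⇒lookup-injective (x∉ ∷ u) {suc i} {zero}  eq = contradiction (sym eq) (All.lookup x∉ (∈-lookup i))
  Unique⇒lookup-injective (x∉ ∷ u) {suc i} {suc j} eq = cong suc (Unique⇒lookup-injective u eq)

  module _ {n} (K : SimplicialComplex n) (m : ℕ) where

    private
      face? = λ (s : Subset n) → isFace? K s ×-dec (∣ s ∣ ℕ.≟ m)

    vertices-isFace : ∀ σ → IsFace K (vertices K m σ)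
    vertices-isFace σ = proj₁ (proj₂ (∈-filter⁻ face? {xs = subsets n} (∈-lookup {xs = faceList K m} σ)))

    ∣vertices∣ : ∀ σ → ∣ vertices K m σ ∣ ≡ m
    ∣vertices∣ σ = proj₂ (proj₂ (∈-filter⁻ face? {xs = subsets n} (∈-lookup {xs = faceList K m} σ)))

    vertices-injective : Injective _≡_ _≡_ (vertices K m)
    vertices-injective = Unique⇒lookup-injective (filter⁺ face? (subsets-unique n))

    face-index : ∀ {s} → IsFace K s → ∣ s ∣ ≡ m → ∃ λ σ → vertices K m σ ≡ s
    face-index {s} face size = index s∈ , sym (lookup-index s∈)
      where
      s∈ : s ∈ˡ faceList K m
      s∈ = ∈-filter⁺ face? (∈-subsets s) (face , size)

  module Incidence {n} (K : SimplicialComplex n) (k : ℕ) (o : Orientation K) where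

    [_∶_] : Ridge K k → Facet K k → ℤ
    [_∶_] = incidence K k o

    ridgeSign : Ridge K k → ℤ
    ridgeSign σ = orderingSign (o k σ)

    facetSign : Facet K k → ℤ
    facetSign F = orderingSign (o (suc k) F)

    -- The definition picks some index whose removal gives σ; as a removal determines the removed
    -- vertex, that vertex is `v`. The sign of the carrying permutation then splits, and the
    -- position becomes a rank.
    incidence-removal : ∀ {σ F v} → v ∈ facet K k F → facet K k F - v ≡ ridge K k σ →
                        [ σ ∶ F ] ≡ sg (rank (facet K k F) v) * facetSign F * ridgeSign σ
    incidence-removal {σ} {F} {v} v∈F F-v≡σ with any? (λ i → (facet K k F - vertex (o (suc k) F) i) ≟ˢ ridge K k σ)
    ... | no none = contradiction (position (o (suc k) F) v∈F ,
            trans (cong (facet K k F -_) (proj₂ (onto (o (suc k) F) v∈F))) F-v≡σ) none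
    ... | yes (i , F-vᵢ≡σ) = begin
      sg (toℕ i) * sgn (carrying (omit a i) (o k σ) F-vᵢ≡σ)
        ≡⟨ cong (sg (toℕ i) *_) (sgn-carrying (omit a i) (o k σ) F-vᵢ≡σ) ⟩
      sg (toℕ i) * (orderingSign (omit a i) * ridgeSign σ)         ≡⟨ sym (ℤ.*-assoc (sg (toℕ i)) _ _) ⟩
      sg (toℕ i) * orderingSign (omit a i) * ridgeSign σ
        ≡⟨ cong (_* ridgeSign σ) (sg-omit a i) ⟩
      sg (rank (facet K k F) (vertex a i)) * facetSign F * ridgeSign σ
        ≡⟨ cong (λ u → sg (rank (facet K k F) u) * facetSign F * ridgeSign σ) (p-x-injective (vertex-∈ a i) (trans F-vᵢ≡σ (sym F-v≡σ))) ⟩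
      sg (rank (facet K k F) v) * facetSign F * ridgeSign σ        ∎
      where
      open ≡-Reasoning
      a = o (suc k) F

    incidence-outside : ∀ {σ F} → ¬ (ridge K k σ ⊆ facet K k F) → [ σ ∶ F ] ≡ 0ℤ
    incidence-outside {σ} {F} σ⊈F with any? (λ i → (facet K k F - vertex (o (suc k) F) i) ≟ˢ ridge K k σ)
    ... | no _ = refl
    ... | yes (i , F-vᵢ≡σ) = contradiction (λ {x} x∈σ → p─q⊆p (facet K k F) _ (subst (x ∈_) (sym F-vᵢ≡σ) x∈σ)) σ⊈F

  -- Removing a vertex, and sums of pairwise opposite units

  -[x]-injective : ∀ {n} {p q : Subset n} {x} → x ∈ p → x ∈ q → p - x ≡ q - x → p ≡ q
  -[x]-injective {p = p} {q} {x} x∈p x∈q eq = ⊆-antisym (transfer x∈q eq) (transfer x∈p (sym eq))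
    where
    transfer : ∀ {p q} → x ∈ q → p - x ≡ q - x → p ⊆ q
    transfer {p} {q} x∈q eq {y} y∈p with y Fin.≟ x
    ... | yes refl = x∈q
    ... | no y≢x   = p─q⊆p q _ (subst (y ∈_) eq (x∈p∧x≢y⇒x∈p-y y∈p y≢x))

  ∈-removed : ∀ {n} {p q : Subset n} {x y} → p - x ≡ q → y ∈ p → y ∉ q → y ≡ x
  ∈-removed {x = x} {y} refl y∈p y∉q with y Fin.≟ x
  ... | yes y≡x = y≡x
  ... | no y≢x  = contradiction (x∈p∧x≢y⇒x∈p-y y∈p y≢x) y∉q

  ∈-remains : ∀ {n} {p q : Subset n} {x y} → p - x ≡ q → y ∈ p → y ≢ x → y ∈ q
  ∈-remains refl y∈p y≢x = x∈p∧x≢y⇒x∈p-y y∈p y≢x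

  ∉-removal : ∀ {n} {p q : Subset n} {x} → p - x ≡ q → x ∉ q
  ∉-removal {p = p} {x = x} refl = x∉p-x p x

  -- Ties the value of the sum to the count: zero for counts 0 and 2, a single term for count 1. The
  -- indices are kept so that a further term can be tested against them.
  data SignedSum {n} (w : Vector ℤ n) (P : Pred (Fin n) 0ℓ) (c : ℕ) : Set where
    none : c ≡ 0 → sum w ≡ 0ℤ → SignedSum w P c
    one  : c ≡ 1 → ∀ i → P i → sum w ≡ w i → SignedSum w P c
    two  : c ≡ 2 → ∀ i j → i ≢ j → P i → P j → sum w ≡ 0ℤ → SignedSum w P c

  unit≢0 : ∀ {x} → x * x ≡ 1ℤ → x ≢ 0ℤ
  unit≢0 eq refl = contradiction eq λ ()

  -- Three units cannot be pairwise opposite.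
  signedSum : ∀ {n} (w : Vector ℤ n) {P : Pred (Fin n) 0ℓ} (P? : Decidable P) →
    (∀ i → P i → w i * w i ≡ 1ℤ) → (∀ i → ¬ P i → w i ≡ 0ℤ) →
    (∀ i j → i ≢ j → P i → P j → w i + w j ≡ 0ℤ) → SignedSum w P (∑ℕ.sum (λ i → 𝟙 (P? i)))
  signedSum {zero}  w P? unit null opposite = none refl refl
  signedSum {suc n} w {P} P? unit null opposite
    with P? zero | signedSum (w ∘ suc) (P? ∘ suc) (λ i → unit (suc i)) (λ i → null (suc i))
                     (λ i j i≢j → opposite (suc i) (suc j) (i≢j ∘ suc-injective))
  ... | no ¬p | none c≡0 s≡0           = none c≡0 (trans (cong₂ _+_ (null zero ¬p) s≡0) refl)
  ... | no ¬p | one c≡1 i pᵢ s≡        = one c≡1 (suc i) pᵢ (trans (cong₂ _+_ (null zero ¬p) s≡) (ℤ.+-identityˡ _))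
  ... | no ¬p | two c≡2 i j i≢j pᵢ pⱼ s≡0 = two c≡2 (suc i) (suc j) (i≢j ∘ suc-injective) pᵢ pⱼ (trans (cong₂ _+_ (null zero ¬p) s≡0) refl)
  ... | yes p | none c≡0 s≡0           = one (cong suc c≡0) zero p (trans (cong (w zero +_) s≡0) (ℤ.+-identityʳ _))
  ... | yes p | one c≡1 i pᵢ s≡        = two (cong suc c≡1) zero (suc i) (λ ()) p pᵢ (trans (cong (w zero +_) s≡) (opposite zero (suc i) (λ ()) p pᵢ))
  ... | yes p | two c≡2 i j i≢j pᵢ pⱼ s≡0 = contradiction 2≡0 λ ()
    where
    x = w zero
    y = w (suc i)
    z = w (suc j)
    -- The bracket equals 2x, so if all three pairwise sums vanished, 2x² = 2 would be zero.
    expand : ∀ x y z → x * x + x * x ≡ x * ((x + y) + (x + z) + ℤ.- (y + z))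
    expand = solve-∀
    2≡0 : 1ℤ + 1ℤ ≡ 0ℤ
    2≡0 = begin
      1ℤ + 1ℤ                                    ≡⟨ sym (cong₂ _+_ (unit zero p) (unit zero p)) ⟩
      x * x + x * x                              ≡⟨ expand x y z ⟩
      x * ((x + y) + (x + z) + ℤ.- (y + z))      ≡⟨ cong (x *_) (cong₂ (λ u v → u + ℤ.- v)
          (cong₂ _+_ (opposite zero (suc i) (λ ()) p pᵢ) (opposite zero (suc j) (λ ()) p pⱼ))
          (opposite (suc i) (suc j) (i≢j ∘ suc-injective) pᵢ pⱼ)) ⟩
      x * 0ℤ                                     ≡⟨ ℤ.*-zeroʳ x ⟩
      0ℤ                                         ∎
      where open ≡-Reasoning

  pos-sum : ∀ {n} (f : Fin n → ℕ) → ℤ.+ ∑ℕ.sum f ≡ sum (λ i → ℤ.+ f i)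
  pos-sum {zero}  f = refl
  pos-sum {suc n} f = trans (ℤ.pos-+ (f zero) _) (cong (ℤ.+ f zero +_) (pos-sum (f ∘ suc)))

  -- All that is used about orientations is the sign rule incidence-removal.
  record SignedIncidence (n : ℕ) : Set where
    infix 4 _◁_ _∼_ _◁?_ _∼?_
    field
      #ridges #facets size : ℕ
      rset : Fin #ridges → Subset n
      fset : Fin #facets → Subset n
      rset-injective : Injective _≡_ _≡_ rset
      fset-injective : Injective _≡_ _≡_ fset
      ∣rset∣ : ∀ σ → ∣ rset σ ∣ ≡ size
      ∣fset∣ : ∀ F → ∣ fset F ∣ ≡ suc size
      removal-index : ∀ F {v} → v ∈ fset F → ∃ λ σ → rset σ ≡ fset F - v
      [_∶_] : Fin #ridges → Fin #facets → ℤ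
      ridgeSign : Fin #ridges → ℤ
      facetSign : Fin #facets → ℤ
      ridgeSign² : ∀ σ → ridgeSign σ * ridgeSign σ ≡ 1ℤ
      facetSign² : ∀ F → facetSign F * facetSign F ≡ 1ℤ
      incidence-removal : ∀ {σ F v} → v ∈ fset F → fset F - v ≡ rset σ →
                          [ σ ∶ F ] ≡ sg (rank (fset F) v) * facetSign F * ridgeSign σ
      incidence-outside : ∀ {σ F} → ¬ (rset σ ⊆ fset F) → [ σ ∶ F ] ≡ 0ℤ

    _◁_ : Fin #ridges → Fin #facets → Set
    σ ◁ F = rset σ ⊆ fset F

    _◁?_ : ∀ σ F → Dec (σ ◁ F)
    σ ◁? F = rset σ ⊆? fset F

    _∼_ : Fin #facets → Fin #facets → Set
    F ∼ G = F ≢ G × ∃ λ R → rset R ≡ fset F ∩ fset G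

    _∼?_ : ∀ F G → Dec (F ∼ G)
    F ∼? G = ¬? (F Fin.≟ G) ×-dec any? (λ R → rset R ≟ˢ (fset F ∩ fset G))

    field
      S : Fin #facets → Fin #facets → ℤ
      S-adjacent : ∀ {F G R} → F ≢ G → rset R ≡ fset F ∩ fset G → S F G ≡ [ R ∶ F ] * [ R ∶ G ]
      S-nonadjacent : ∀ {F G} → ¬ (F ∼ G) → S F G ≡ 0ℤ

    ridge-removal : ∀ {σ F} → σ ◁ F → ∃ λ v → v ∈ fset F × fset F - v ≡ rset σ
    ridge-removal {σ} {F} σ◁F = ⊆-removal σ◁F (trans (∣fset∣ F) (cong suc (sym (∣rset∣ σ))))

    incidence² : ∀ {σ F} → σ ◁ F → [ σ ∶ F ] * [ σ ∶ F ] ≡ 1ℤ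
    incidence² {σ} {F} σ◁F with ridge-removal {σ} {F} σ◁F
    ... | v , v∈F , F-v≡σ = begin
      [ σ ∶ F ] * [ σ ∶ F ]                      ≡⟨ cong₂ _*_ eq eq ⟩
      x * y * z * (x * y * z)                    ≡⟨ regroup x y z ⟩
      (x * x) * (y * y) * (z * z)
        ≡⟨ cong₂ _*_ (cong₂ _*_ (sg² (rank (fset F) v)) (facetSign² F)) (ridgeSign² σ) ⟩
      1ℤ                                         ∎
      where
      open ≡-Reasoning
      x = sg (rank (fset F) v)
      y = facetSign F
      z = ridgeSign σ
      eq = incidence-removal {σ} {F} v∈F F-v≡σ
      regroup : ∀ x y z → x * y * z * (x * y * z) ≡ (x * x) * (y * y) * (z * z)
      regroup = solve-∀

  -- The rows of S x_ρ, inside and outside the fan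

  module FanVector {n} (I : SignedIncidence n) where
    open SignedIncidence I

    fanDegree : Fin #ridges → ℕ
    fanDegree ρ = count (ρ ◁?_)

    -- Each facet is σ with one more vertex, and these two vertices differ, so nothing outside σ is
    -- shared.
    common-ridge : ∀ {σ F G} → F ≢ G → σ ◁ F → σ ◁ G → rset σ ≡ fset F ∩ fset G
    common-ridge {σ} {F} {G} F≢G σ⊆F σ⊆G with ridge-removal {σ} {F} σ⊆F | ridge-removal {σ} {G} σ⊆G
    ... | v , v∈F , F-v≡σ | w , w∈G , G-w≡σ = ⊆-antisym (λ x∈σ → x∈p∩q⁺ (σ⊆F x∈σ , σ⊆G x∈σ)) F∩G⊆σ
      where
      v≢w : v ≢ w
      v≢w refl = F≢G (fset-injective (-[x]-injective v∈F w∈G (trans F-v≡σ (sym G-w≡σ))))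
      F∩G⊆σ : fset F ∩ fset G ⊆ rset σ
      F∩G⊆σ {x} x∈F∩G with x Fin.≟ v | x∈p∩q⁻ (fset F) (fset G) x∈F∩G
      ... | yes refl | _ , x∈G = ∈-remains G-w≡σ x∈G v≢w
      ... | no x≢v   | x∈F , _ = ∈-remains F-v≡σ x∈F x≢v

    -- Any other member G of the fan meets F exactly in ρ, so its term is [ρ:F] [ρ:G]² = [ρ:F].
    fan-row : ∀ ρ F → ρ ◁ F → sum (λ G → S F G * [ ρ ∶ G ]) ≡ (ℤ.+ fanDegree ρ ℤ.- ℤ.+ 1) * [ ρ ∶ F ]
    fan-row ρ F ρ⊆F = begin
      T                                               ≡⟨ isolate T x ⟩
      (T + x) ℤ.- x                                   ≡⟨ cong (ℤ._- x) total ⟩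
      ℤ.+ fanDegree ρ * x ℤ.- x                      ≡⟨ factor (ℤ.+ fanDegree ρ) x ⟩
      (ℤ.+ fanDegree ρ ℤ.- ℤ.+ 1) * x                ∎
      where
      open ≡-Reasoning
      x = [ ρ ∶ F ]
      T = sum (λ G → S F G * [ ρ ∶ G ])
      isolate : ∀ t x → t ≡ (t + x) ℤ.- x
      isolate = solve-∀
      factor : ∀ d x → d * x ℤ.- x ≡ (d ℤ.- ℤ.+ 1) * x
      factor = solve-∀
      indicator : Fin #facets → ℤ
      indicator G = ℤ.+ 𝟙 (ρ ◁? G)
      -- The extra summand at G = F makes up for the zero diagonal of `S`: every facet of the fan, F
      -- included, then contributes exactly `x`.
      pointwise : ∀ G → S F G * [ ρ ∶ G ] + ℤ.+ 𝟙 (G Fin.≟ F) * x ≡ indicator G * x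
      pointwise G with ρ ◁? G | G Fin.≟ F
      ... | no ρ⊈G | yes refl = ⊥-elim (ρ⊈G ρ⊆F)
      ... | no ρ⊈G | no _     = trans (cong (λ y → S F G * y + 0ℤ * x) (incidence-outside {ρ} {G} ρ⊈G))
                                  (trans (cong₂ _+_ (ℤ.*-zeroʳ (S F G)) (ℤ.*-zeroˡ x)) (sym (ℤ.*-zeroˡ x)))
      ... | yes _  | yes refl = trans (cong (λ s → s * [ ρ ∶ F ] + 1ℤ * x) (S-nonadjacent {F} {F} (λ adj → proj₁ adj refl)))
                                  (trans (cong (_+ 1ℤ * x) (ℤ.*-zeroˡ [ ρ ∶ F ])) (ℤ.+-identityˡ (1ℤ * x)))
      ... | yes ρ⊆G | no G≢F  = begin
        S F G * y + 0ℤ * x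
          ≡⟨ cong₂ _+_ (cong (_* y) (S-adjacent {F} {G} {ρ} (G≢F ∘ sym) (common-ridge {ρ} (G≢F ∘ sym) ρ⊆F ρ⊆G))) (ℤ.*-zeroˡ x) ⟩
        x * y * y + 0ℤ          ≡⟨ regroup x y ⟩
        (y * y) * x             ≡⟨ cong (_* x) (incidence² {ρ} {G} ρ⊆G) ⟩
        1ℤ * x                  ∎
        where
        y = [ ρ ∶ G ]
        regroup : ∀ x y → x * y * y + 0ℤ ≡ (y * y) * x
        regroup = solve-∀
      total : T + x ≡ ℤ.+ fanDegree ρ * x
      total = begin
        T + x                                                          ≡⟨ cong (T +_) (sym (trans
            (sum-single (λ G → ℤ.+ 𝟙 (G Fin.≟ F) * x) F (λ G G≢F → trans (cong (λ i → ℤ.+ i * x) (𝟙-no (G Fin.≟ F) G≢F)) (ℤ.*-zeroˡ x)))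
            (trans (cong (λ i → ℤ.+ i * x) (𝟙-yes (F Fin.≟ F) refl)) (ℤ.*-identityˡ x)))) ⟩
        T + sum (λ G → ℤ.+ 𝟙 (G Fin.≟ F) * x)
          ≡⟨ sym (∑-distrib-+ (λ G → S F G * [ ρ ∶ G ]) (λ G → ℤ.+ 𝟙 (G Fin.≟ F) * x)) ⟩
        sum (λ G → S F G * [ ρ ∶ G ] + ℤ.+ 𝟙 (G Fin.≟ F) * x)          ≡⟨ sum-cong-≗ pointwise ⟩
        sum (λ G → indicator G * x)
          ≡⟨ sym (*-distribʳ-sum x indicator) ⟩
        sum indicator * x
          ≡⟨ cong (_* x) (sym (trans (cong ℤ.+_ (count-sum (ρ ◁?_))) (pos-sum (λ G → 𝟙 (ρ ◁? G))))) ⟩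
        ℤ.+ fanDegree ρ * x                                           ∎

    -- ρ = G ∖ a, and F ∩ G = G ∖ u = F ∖ b.
    record Corner (ρ : Fin #ridges) (F G : Fin #facets) : Set where
      field
        a u b     : Fin n
        a∈G       : a ∈ fset G
        a∈F       : a ∈ fset F
        u∈ρ       : u ∈ rset ρ
        u∉F       : u ∉ fset F
        b≢a       : b ≢ a
        F∩G⊆F-b   : ∀ {x} → x ∈ fset F → x ≢ b → x ∈ fset G
        G-a≡ρ     : fset G - a ≡ rset ρ
        G-u⊆F     : ∀ {x} → x ∈ fset G → x ≢ u → x ∈ fset F
        -- `sg (lt b a)` is kept on the left so that the right side is symmetric in `a` and `b`; it
        -- alone changes when they are exchanged.
        sign      : S F G * [ ρ ∶ G ] * sg (lt b a) ≡
                    sg (rank (fset F) a ℕ.+ rank (fset F) b ℕ.+ suc (rank (rset ρ) u)) * (facetSign F * ridgeSign ρ)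

    -- The shared ridge R arises from G by removing u and from F by removing b. Were a equal to u, ρ
    -- would be R and lie in F; hence a is in R, and so in F.
    corner : ∀ {ρ F G} → ¬ (ρ ◁ F) → ρ ◁ G → F ∼ G → Corner ρ F G
    corner {ρ} {F} {G} ρ⊈F ρ⊆G (F≢G , R , R≡F∩G) = build
      (ridge-removal {ρ} {G} ρ⊆G) (ridge-removal {R} {G} R⊆G) (ridge-removal {R} {F} R⊆F)
      where
      ∈F∩G : ∀ {x} → x ∈ rset R → x ∈ fset F × x ∈ fset G
      ∈F∩G {x} x∈R = x∈p∩q⁻ (fset F) (fset G) (subst (x ∈_) R≡F∩G x∈R)
      R⊆F : rset R ⊆ fset F
      R⊆F = proj₁ ∘ ∈F∩G
      R⊆G : rset R ⊆ fset G
      R⊆G = proj₂ ∘ ∈F∩G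
      build : (∃ λ a → a ∈ fset G × fset G - a ≡ rset ρ) →
              (∃ λ u → u ∈ fset G × fset G - u ≡ rset R) →
              (∃ λ b → b ∈ fset F × fset F - b ≡ rset R) → Corner ρ F G
      build (a , a∈G , G-a≡ρ) (u , u∈G , G-u≡R) (b , b∈F , F-b≡R) = record
        { a = a ; u = u ; b = b ; a∈G = a∈G ; a∈F = R⊆F a∈R ; u∈ρ = u∈ρ ; u∉F = u∉F
        ; b≢a = b≢a
        ; F∩G⊆F-b = λ x∈F x≢b → R⊆G (∈-remains F-b≡R x∈F x≢b)
        ; G-a≡ρ = G-a≡ρ
        ; G-u⊆F = λ x∈G x≢u → R⊆F (∈-remains G-u≡R x∈G x≢u)
        ; sign = sign
        }
        where
        a≢u : a ≢ u
        a≢u refl = ρ⊈F λ {x} x∈ρ → R⊆F (subst (x ∈_) (trans (sym G-a≡ρ) G-u≡R) x∈ρ)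
        a∈R : a ∈ rset R
        a∈R = ∈-remains G-u≡R a∈G a≢u
        b≢a : b ≢ a
        b≢a refl = ∉-removal F-b≡R a∈R
        u∈ρ : u ∈ rset ρ
        u∈ρ = ∈-remains G-a≡ρ u∈G (a≢u ∘ sym)
        u∉F : u ∉ fset F
        u∉F u∈F = ∉-removal G-u≡R (subst (u ∈_) (sym R≡F∩G) (x∈p∩q⁺ (u∈F , u∈G)))
        e = rank (fset F) b ℕ.+ rank (fset G) u ℕ.+ rank (fset G) a
        -- Removing a and u from G in either order differs by one transposition.
        exponent : e ℕ.+ lt b a ≡ rank (fset F) a ℕ.+ rank (fset F) b ℕ.+ suc (rank (rset ρ) u)
        exponent = begin
          rF b ℕ.+ rG u ℕ.+ rG a ℕ.+ lt b a
            ≡⟨ cong₂ (λ x y → rF b ℕ.+ x ℕ.+ y ℕ.+ lt b a) rG-u rG-a ⟩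
          rF b ℕ.+ (rρ u ℕ.+ lt a u) ℕ.+ (rR a ℕ.+ lt u a) ℕ.+ lt b a
            ≡⟨ regroup (rF b) (rρ u) (lt a u) (rR a) (lt u a) (lt b a) ⟩
          (rR a ℕ.+ lt b a) ℕ.+ rF b ℕ.+ (lt a u ℕ.+ lt u a ℕ.+ rρ u)
            ≡⟨ cong₂ (λ x y → x ℕ.+ rF b ℕ.+ (y ℕ.+ rρ u)) (sym rF-a) (lt-total a≢u) ⟩
          rF a ℕ.+ rF b ℕ.+ suc (rρ u)                                   ∎
          where
          open ≡-Reasoning
          rF = rank (fset F)
          rG = rank (fset G)
          rρ = rank (rset ρ)
          rR = rank (rset R)
          rG-u : rG u ≡ rρ u ℕ.+ lt a u
          rG-u = trans (rank-remove (fset G) a∈G u) (cong (λ s → rank s u ℕ.+ lt a u) G-a≡ρ)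
          rG-a : rG a ≡ rR a ℕ.+ lt u a
          rG-a = trans (rank-remove (fset G) u∈G a) (cong (λ s → rank s a ℕ.+ lt u a) G-u≡R)
          rF-a : rF a ≡ rR a ℕ.+ lt b a
          rF-a = trans (rank-remove (fset F) b∈F a) (cong (λ s → rank s a ℕ.+ lt b a) F-b≡R)
          regroup : ∀ x y z w v t → x ℕ.+ (y ℕ.+ z) ℕ.+ (w ℕ.+ v) ℕ.+ t ≡ (w ℕ.+ t) ℕ.+ x ℕ.+ (z ℕ.+ v ℕ.+ y)
          regroup = ℕ-Solver.solve-∀
        product : S F G * [ ρ ∶ G ] ≡ sg e * (facetSign F * ridgeSign ρ)
        product = begin
          S F G * [ ρ ∶ G ]
            ≡⟨ cong (_* [ ρ ∶ G ]) (S-adjacent {F} {G} {R} F≢G R≡F∩G) ⟩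
          [ R ∶ F ] * [ R ∶ G ] * [ ρ ∶ G ]
            ≡⟨ cong₂ _*_ (cong₂ _*_ (incidence-removal {R} {F} b∈F F-b≡R) (incidence-removal {R} {G} u∈G G-u≡R)) (incidence-removal {ρ} {G} a∈G G-a≡ρ) ⟩
          x * f * r * (y * g * r) * (z * g * p)      ≡⟨ regroup x y z f g r p ⟩
          x * y * z * (f * p) * ((g * g) * (r * r))
            ≡⟨ cong (x * y * z * (f * p) *_) (cong₂ _*_ (facetSign² G) (ridgeSign² R)) ⟩
          x * y * z * (f * p) * 1ℤ                   ≡⟨ ℤ.*-identityʳ _ ⟩
          x * y * z * (f * p)
            ≡⟨ cong (_* (f * p)) (sym (trans (sg-+ (rank (fset F) b ℕ.+ rank (fset G) u) (rank (fset G) a)) (cong (_* z) (sg-+ (rank (fset F) b) (rank (fset G) u))))) ⟩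
          sg e * (f * p)                             ∎
          where
          open ≡-Reasoning
          x = sg (rank (fset F) b)
          y = sg (rank (fset G) u)
          z = sg (rank (fset G) a)
          f = facetSign F
          g = facetSign G
          r = ridgeSign R
          p = ridgeSign ρ
          regroup : ∀ x y z f g r p → x * f * r * (y * g * r) * (z * g * p) ≡ x * y * z * (f * p) * ((g * g) * (r * r))
          regroup = solve-∀
        sign : S F G * [ ρ ∶ G ] * sg (lt b a) ≡
               sg (rank (fset F) a ℕ.+ rank (fset F) b ℕ.+ suc (rank (rset ρ) u)) * (facetSign F * ridgeSign ρ)
        sign = trans (cong (_* sg (lt b a)) product) (trans (swap (sg e) (facetSign F * ridgeSign ρ) (sg (lt b a)))
          (cong (_* (facetSign F * ridgeSign ρ)) (trans (sym (sg-+ e (lt b a))) (cong sg exponent))))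
          where
          swap : ∀ x y z → x * y * z ≡ x * z * y
          swap = solve-∀

    -- `u` is the only vertex of ρ missing from F, hence common to both corners. The vertex that G′
    -- adds to ρ lies in F and is not the one that G adds, so it is `b`: the second corner has `a`
    -- and `b` exchanged, and exactly one of `lt a b`, `lt b a` is 1.
    opposite-terms : ∀ {ρ F G G′} → ¬ (ρ ◁ F) → ρ ◁ G → ρ ◁ G′ → G ≢ G′ →
      F ∼ G → F ∼ G′ → S F G * [ ρ ∶ G ] + S F G′ * [ ρ ∶ G′ ] ≡ 0ℤ
    opposite-terms {ρ} {F} {G} {G′} ρ⊈F ρ⊆G ρ⊆G′ G≢G′ adj adj′ = cancel
      (corner {ρ} ρ⊈F ρ⊆G adj) (corner {ρ} ρ⊈F ρ⊆G′ adj′)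
      where
      open Corner
      other : ∀ {G G′} → G ≢ G′ → (c : Corner ρ F G) (c′ : Corner ρ F G′) → a c′ ≡ b c
      other {G} {G′} G≢G′ c c′ with a c′ Fin.≟ b c
      ... | yes a′≡b = a′≡b
      ... | no a′≢b  = contradiction (fset-injective (-[x]-injective (a∈G c)
              (subst (_∈ fset G′) a′≡a (a∈G c′))
              (trans (G-a≡ρ c) (sym (trans (cong (fset G′ -_) (sym a′≡a)) (G-a≡ρ c′)))))) G≢G′
        where
        a′≡a : a c′ ≡ a c
        a′≡a = ∈-removed (G-a≡ρ c) (F∩G⊆F-b c (a∈F c′) a′≢b) (∉-removal (G-a≡ρ c′))
      cancel : Corner ρ F G → Corner ρ F G′ → S F G * [ ρ ∶ G ] + S F G′ * [ ρ ∶ G′ ] ≡ 0ℤ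
      cancel c c′ = begin
        W + W′
          ≡⟨ sym (cong₂ _+_ (sg-cancelʳ W (lt (b c) (a c))) (sg-cancelʳ W′ (lt (b c′) (a c′)))) ⟩
        W * E * E + W′ * E′ * E′
          ≡⟨ cong₂ (λ x y → x * E + y * E′) (sign c) (trans (sign c′) (sym same)) ⟩
        X * E + X * E′                     ≡⟨ cong (λ e → X * E + X * e) E′≡-E ⟩
        X * E + X * (-1ℤ * E)              ≡⟨ vanish X E ⟩
        0ℤ                                 ∎
        where
        open ≡-Reasoning
        W  = S F G * [ ρ ∶ G ]
        W′ = S F G′ * [ ρ ∶ G′ ]
        E  = sg (lt (b c) (a c))
        E′ = sg (lt (b c′) (a c′))
        exponent : Fin n → Fin n → Fin n → ℕ
        exponent a b u = rank (fset F) a ℕ.+ rank (fset F) b ℕ.+ suc (rank (rset ρ) u)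
        X  = sg (exponent (a c) (b c) (u c)) * (facetSign F * ridgeSign ρ)
        a′≡b : a c′ ≡ b c
        a′≡b = other G≢G′ c c′
        a≡b′ : a c ≡ b c′
        a≡b′ = other (G≢G′ ∘ sym) c′ c
        u′≡u : u c′ ≡ u c
        u′≡u with u c Fin.≟ u c′
        ... | yes u≡u′ = sym u≡u′
        ... | no u≢u′  = contradiction (G-u⊆F c′ (ρ⊆G′ (u∈ρ c)) u≢u′) (u∉F c)
        same : X ≡ sg (exponent (a c′) (b c′) (u c′)) * (facetSign F * ridgeSign ρ)
        same = cong (λ e → sg e * (facetSign F * ridgeSign ρ)) (trans
          (cong (ℕ._+ suc (rank (rset ρ) (u c))) (ℕ.+-comm (rank (fset F) (a c)) (rank (fset F) (b c))))
          (trans (cong₂ (λ x y → exponent x y (u c)) (sym a′≡b) a≡b′) (cong (exponent (a c′) (b c′)) (sym u′≡u))))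
        E′≡-E : E′ ≡ -1ℤ * E
        E′≡-E = begin
          E′                                         ≡⟨ cong sg (cong₂ lt (sym a≡b′) a′≡b) ⟩
          sg (lt (a c) (b c))
            ≡⟨ sym (sg-cancelʳ (sg (lt (a c) (b c))) (lt (b c) (a c))) ⟩
          sg (lt (a c) (b c)) * E * E
            ≡⟨ cong (_* E) (trans (sym (sg-+ (lt (a c) (b c)) (lt (b c) (a c)))) (cong sg (lt-total (b≢a c ∘ sym)))) ⟩
          -1ℤ * E                                    ∎
        vanish : ∀ x e → x * e + x * (-1ℤ * e) ≡ 0ℤ
        vanish = solve-∀

    fanNeighbour? : ∀ ρ F → Decidable (λ G → (ρ ◁ G) × (F ∼ G))
    fanNeighbour? ρ F G = (ρ ◁? G) ×-dec (F ∼? G)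

    term² : ∀ {ρ F} G → ρ ◁ G × F ∼ G → (S F G * [ ρ ∶ G ]) * (S F G * [ ρ ∶ G ]) ≡ 1ℤ
    term² {ρ} {F} G (ρ⊆G , F≢G , R , R≡F∩G) = begin
      S F G * z * (S F G * z)
        ≡⟨ cong (λ s → s * z * (s * z)) (S-adjacent {F} {G} {R} F≢G R≡F∩G) ⟩
      x * y * z * (x * y * z)               ≡⟨ regroup x y z ⟩
      (x * x) * (y * y) * (z * z)
        ≡⟨ cong₂ _*_ (cong₂ _*_ (incidence² {R} {F} (proj₁ ∘ ∈F∩G)) (incidence² {R} {G} (proj₂ ∘ ∈F∩G))) (incidence² {ρ} {G} ρ⊆G) ⟩
      1ℤ                                    ∎
      where
      open ≡-Reasoning
      x = [ R ∶ F ]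
      y = [ R ∶ G ]
      z = [ ρ ∶ G ]
      ∈F∩G : ∀ {v} → v ∈ rset R → v ∈ fset F × v ∈ fset G
      ∈F∩G {v} v∈R = x∈p∩q⁻ (fset F) (fset G) (subst (v ∈_) R≡F∩G v∈R)
      regroup : ∀ x y z → x * y * z * (x * y * z) ≡ (x * x) * (y * y) * (z * z)
      regroup = solve-∀

    fanNeighbourCount : Fin #ridges → Fin #facets → ℕ
    fanNeighbourCount ρ F = count (fanNeighbour? ρ F)

    IsClean : Fin #ridges → Set
    IsClean ρ = ∀ F → ¬ (ρ ◁ F) → fanNeighbourCount ρ F ≡ 0 ⊎ fanNeighbourCount ρ F ≡ 2

    outer-row : ∀ ρ F → ¬ (ρ ◁ F) →
      SignedSum (λ G → S F G * [ ρ ∶ G ]) (λ G → (ρ ◁ G) × (F ∼ G)) (fanNeighbourCount ρ F)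
    outer-row ρ F ρ⊈F = subst (SignedSum _ _) (sym (count-sum (fanNeighbour? ρ F)))
      (signedSum (λ G → S F G * [ ρ ∶ G ]) (fanNeighbour? ρ F) (term² {ρ} {F}) null
        (λ G G′ G≢G′ p p′ → opposite-terms {ρ} ρ⊈F (proj₁ p) (proj₁ p′) G≢G′ (proj₂ p) (proj₂ p′)))
      where
      null : ∀ G → ¬ ((ρ ◁ G) × (F ∼ G)) → S F G * [ ρ ∶ G ] ≡ 0ℤ
      null G ¬neighbour with ρ ◁? G
      ... | no ρ⊈G  = trans (cong (S F G *_) (incidence-outside {ρ} {G} ρ⊈G)) (ℤ.*-zeroʳ (S F G))
      ... | yes ρ⊆G = trans (cong (_* [ ρ ∶ G ]) (S-nonadjacent {F} {G} (λ adj → ¬neighbour (ρ⊆G , adj)))) (ℤ.*-zeroˡ [ ρ ∶ G ])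

    IsFanEigenvector : Fin #ridges → Set
    IsFanEigenvector ρ = ∀ F → sum (λ G → S F G * [ ρ ∶ G ]) ≡ (ℤ.+ fanDegree ρ ℤ.- ℤ.+ 1) * [ ρ ∶ F ]

    clean⇔eigenvector : ∀ ρ → IsClean ρ ⇔ IsFanEigenvector ρ
    clean⇔eigenvector ρ = mk⇔ to from
      where
      c = ℤ.+ fanDegree ρ ℤ.- ℤ.+ 1
      off-fan : ∀ F → ¬ (ρ ◁ F) → c * [ ρ ∶ F ] ≡ 0ℤ
      off-fan F ρ⊈F = trans (cong (c *_) (incidence-outside {ρ} {F} ρ⊈F)) (ℤ.*-zeroʳ c)
      Terms : Fin #facets → Vector ℤ #facets
      Terms F G = S F G * [ ρ ∶ G ]
      Neighbour : Fin #facets → Pred (Fin #facets) 0ℓ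
      Neighbour F G = (ρ ◁ G) × (F ∼ G)
      vanishes : ∀ {F m} → SignedSum (Terms F) (Neighbour F) m → m ≡ 0 ⊎ m ≡ 2 → sum (Terms F) ≡ 0ℤ
      vanishes (none _ s≡0)          _         = s≡0
      vanishes (two _ _ _ _ _ _ s≡0) _         = s≡0
      vanishes (one refl _ _ _)      (inj₁ ())
      vanishes (one refl _ _ _)      (inj₂ ())
      balanced : ∀ {F m} → sum (Terms F) ≡ 0ℤ → SignedSum (Terms F) (Neighbour F) m → m ≡ 0 ⊎ m ≡ 2
      balanced         _   (none m≡0 _)          = inj₁ m≡0
      balanced         _   (two m≡2 _ _ _ _ _ _) = inj₂ m≡2
      balanced {F} s≡0 (one _ G p s≡)        = contradiction (trans (sym s≡) s≡0) (unit≢0 (term² {ρ} {F} G p))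
      to : IsClean ρ → IsFanEigenvector ρ
      to clean F = by-fan (ρ ◁? F)
        where
        by-fan : Dec (ρ ◁ F) → sum (Terms F) ≡ c * [ ρ ∶ F ]
        by-fan (yes ρ⊆F) = fan-row ρ F ρ⊆F
        by-fan (no ρ⊈F)  = trans (vanishes {F} (outer-row ρ F ρ⊈F) (clean F ρ⊈F)) (sym (off-fan F ρ⊈F))
      from : IsFanEigenvector ρ → IsClean ρ
      from eigen F ρ⊈F = balanced {F} (trans (eigen F) (off-fan F ρ⊈F)) (outer-row ρ F ρ⊈F)

  -- The Gram matrix BᵀB and the Rayleigh quotient of B x_ρ

  sum-∈ : ∀ {n} (s : Subset n) → ∑ℕ.sum (λ v → 𝟙 (v ∈? s)) ≡ ∣ s ∣
  sum-∈ Vec.[]            = refl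
  sum-∈ (true  Vec.∷ s)   = cong suc (sum-∈ s)
  sum-∈ (false Vec.∷ s)   = sum-∈ s

  -- Adjointness ⟨a, M b⟩ = ⟨Mᵀ a, b⟩, by which the boundary matrix is moved across inner products
  -- below.
  dot-*ᵛ : ∀ {m n} (M : Matrix ℤ m n) (a : Vector ℤ m) (b : Vector ℤ n) →
           sum (λ i → a i * sum (λ j → M i j * b j)) ≡ sum (λ j → sum (λ i → M i j * a i) * b j)
  dot-*ᵛ M a b = begin
    sum (λ i → a i * sum (λ j → M i j * b j))
      ≡⟨ sum-cong-≗ (λ i → *-distribˡ-sum (a i) (λ j → M i j * b j)) ⟩
    sum (λ i → sum (λ j → a i * (M i j * b j)))     ≡⟨ ∑-comm (λ i j → a i * (M i j * b j)) ⟩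
    sum (λ j → sum (λ i → a i * (M i j * b j)))
      ≡⟨ sum-cong-≗ (λ j → trans (sum-cong-≗ (λ i → regroup (a i) (M i j) (b j))) (sym (*-distribʳ-sum (b j) (λ i → M i j * a i)))) ⟩
    sum (λ j → sum (λ i → M i j * a i) * b j)       ∎
    where
    open ≡-Reasoning
    regroup : ∀ x y z → x * (y * z) ≡ y * x * z
    regroup = solve-∀

  0≤x² : ∀ x → 0ℤ ℤ.≤ x * x
  0≤x² (ℤ.+ n)      = subst (0ℤ ℤ.≤_) (ℤ.pos-* n n) (ℤ.+≤+ ℕ.z≤n)
  0≤x² ℤ.-[1+ n ]   = ℤ.+≤+ ℕ.z≤n

  0≤sum² : ∀ {n} (t : Vector ℤ n) → 0ℤ ℤ.≤ sum (λ i → t i * t i)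
  0≤sum² {zero}  t = ℤ.≤-refl
  0≤sum² {suc n} t = ℤ.+-mono-≤ (0≤x² (t zero)) (0≤sum² (t ∘ suc))

  sum²≤0⇒≡0 : ∀ {n} (t : Vector ℤ n) → sum (λ i → t i * t i) ℤ.≤ 0ℤ → ∀ i → t i ≡ 0ℤ
  sum²≤0⇒≡0 {suc n} t s≤0 zero with ℤ.i*j≡0⇒i≡0∨j≡0 (t zero) (ℤ.≤-antisym
        (ℤ.≤-trans (ℤ.≤-trans (ℤ.≤-reflexive (sym (ℤ.+-identityʳ _))) (ℤ.+-monoʳ-≤ (t zero * t zero) (0≤sum² (t ∘ suc)))) s≤0) (0≤x² (t zero)))
  ... | inj₁ t₀≡0 = t₀≡0
  ... | inj₂ t₀≡0 = t₀≡0
  sum²≤0⇒≡0 {suc n} t s≤0 (suc i) = sum²≤0⇒≡0 (t ∘ suc)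
    (ℤ.≤-trans (ℤ.≤-trans (ℤ.≤-reflexive (sym (ℤ.+-identityˡ _))) (ℤ.+-monoˡ-≤ _ (0≤x² (t zero)))) s≤0) i

  module Gram {n} (I : SignedIncidence n) where
    open SignedIncidence I
    open FanVector I

    -- Double counting of the pairs (v, σ) such that removing v from F gives σ: each subridge comes
    -- from one vertex, and `removal-index` gives one ridge for each vertex.
    sum-subridges : ∀ F → ∑ℕ.sum (λ σ → 𝟙 (σ ◁? F)) ≡ suc size
    sum-subridges F = begin
      ∑ℕ.sum (λ σ → 𝟙 (σ ◁? F))
        ≡⟨ ∑ℕ.sum-cong-≗ (λ σ → sym (removals σ)) ⟩
      ∑ℕ.sum (λ σ → ∑ℕ.sum (λ v → 𝟙 (removal? v σ)))           ≡⟨ ∑ℕ.∑-comm (λ σ v → 𝟙 (removal? v σ)) ⟩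
      ∑ℕ.sum (λ v → ∑ℕ.sum (λ σ → 𝟙 (removal? v σ)))           ≡⟨ ∑ℕ.sum-cong-≗ indices ⟩
      ∑ℕ.sum (λ v → 𝟙 (v ∈? fset F))                           ≡⟨ sum-∈ (fset F) ⟩
      ∣ fset F ∣                                                ≡⟨ ∣fset∣ F ⟩
      suc size                                                  ∎
      where
      open ≡-Reasoning
      removal? : ∀ v σ → Dec (v ∈ fset F × fset F - v ≡ rset σ)
      removal? v σ = (v ∈? fset F) ×-dec ((fset F - v) ≟ˢ rset σ)
      removals : ∀ σ → ∑ℕ.sum (λ v → 𝟙 (removal? v σ)) ≡ 𝟙 (σ ◁? F)
      removals σ with σ ◁? F
      ... | no ¬σ◁F = sum-zeroℕ λ v → 𝟙-no (removal? v σ) λ (v∈F , F-v≡σ) →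
              ¬σ◁F λ {x} x∈σ → p─q⊆p (fset F) _ (subst (x ∈_) (sym F-v≡σ) x∈σ)
      ... | yes σ◁F = let v , v∈F , F-v≡σ = ridge-removal {σ} {F} σ◁F in trans
              (sum-singleℕ (λ w → 𝟙 (removal? w σ)) v (λ w w≢v → 𝟙-no (removal? w σ) λ (w∈F , F-w≡σ) →
                w≢v (p-x-injective w∈F (trans F-w≡σ (sym F-v≡σ)))))
              (𝟙-yes (removal? v σ) (v∈F , F-v≡σ))
      indices : ∀ v → ∑ℕ.sum (λ σ → 𝟙 (removal? v σ)) ≡ 𝟙 (v ∈? fset F)
      indices v with v ∈? fset F
      ... | no v∉F  = sum-zeroℕ λ σ → 𝟙-no (no v∉F ×-dec ((fset F - v) ≟ˢ rset σ)) (v∉F ∘ proj₁)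
      ... | yes v∈F = let σ , σ≡F-v = removal-index F v∈F in trans
              (sum-singleℕ (λ τ → 𝟙 (yes v∈F ×-dec ((fset F - v) ≟ˢ rset τ))) σ (λ τ τ≢σ →
                𝟙-no (yes v∈F ×-dec ((fset F - v) ≟ˢ rset τ)) λ (_ , F-v≡τ) → τ≢σ (rset-injective (trans (sym F-v≡τ) (sym σ≡F-v)))))
              (𝟙-yes (yes v∈F ×-dec ((fset F - v) ≟ˢ rset σ)) (v∈F , sym σ≡F-v))

    -- Off the diagonal, only a ridge equal to F ∩ G can lie in both facets, so at most one term
    -- survives. On the diagonal, the squares are the indicators of the subridges of F.
    gram : ∀ F G → sum (λ σ → [ σ ∶ F ] * [ σ ∶ G ]) ≡ ℤ.+ 𝟙 (F Fin.≟ G) * ℤ.+ suc size + S F G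
    gram F G with F Fin.≟ G
    ... | yes refl = begin
      sum (λ σ → [ σ ∶ F ] * [ σ ∶ F ])          ≡⟨ sum-cong-≗ square ⟩
      sum (λ σ → ℤ.+ 𝟙 (σ ◁? F))                 ≡⟨ sym (pos-sum (λ σ → 𝟙 (σ ◁? F))) ⟩
      ℤ.+ ∑ℕ.sum (λ σ → 𝟙 (σ ◁? F))              ≡⟨ cong ℤ.+_ (sum-subridges F) ⟩
      ℤ.+ suc size
        ≡⟨ sym (trans (cong (1ℤ * ℤ.+ suc size +_) (S-nonadjacent {F} {F} (λ adj → proj₁ adj refl))) (trans (ℤ.+-identityʳ _) (ℤ.*-identityˡ _))) ⟩
      1ℤ * ℤ.+ suc size + S F F                  ∎
      where
      open ≡-Reasoning
      square : ∀ σ → [ σ ∶ F ] * [ σ ∶ F ] ≡ ℤ.+ 𝟙 (σ ◁? F)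
      square σ with σ ◁? F
      ... | yes σ◁F = incidence² {σ} {F} σ◁F
      ... | no ¬σ◁F = cong (_* [ σ ∶ F ]) (incidence-outside {σ} {F} ¬σ◁F)
    ... | no F≢G = trans (off (F ∼? G)) (sym (trans (cong (_+ S F G) (ℤ.*-zeroˡ (ℤ.+ suc size))) (ℤ.+-identityˡ (S F G))))
      where
      common : ∀ σ → ¬ (rset σ ≡ fset F ∩ fset G) → [ σ ∶ F ] * [ σ ∶ G ] ≡ 0ℤ
      common σ σ≢ with σ ◁? F | σ ◁? G
      ... | no ¬σ◁F | _        = trans (cong (_* [ σ ∶ G ]) (incidence-outside {σ} {F} ¬σ◁F)) (ℤ.*-zeroˡ [ σ ∶ G ])
      ... | yes _   | no ¬σ◁G  = trans (cong ([ σ ∶ F ] *_) (incidence-outside {σ} {G} ¬σ◁G)) (ℤ.*-zeroʳ [ σ ∶ F ])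
      ... | yes σ◁F | yes σ◁G  = contradiction (common-ridge {σ} F≢G σ◁F σ◁G) σ≢
      off : Dec (F ∼ G) → sum (λ σ → [ σ ∶ F ] * [ σ ∶ G ]) ≡ S F G
      off (yes (_ , R , R≡F∩G)) = trans
        (sum-single (λ σ → [ σ ∶ F ] * [ σ ∶ G ]) R (λ σ σ≢R → common σ λ σ≡F∩G → σ≢R (rset-injective (trans σ≡F∩G (sym R≡F∩G)))))
        (sym (S-adjacent {F} {G} {R} F≢G R≡F∩G))
      off (no ¬adj) = trans (sum-zero λ σ → common σ λ σ≡F∩G → ¬adj (F≢G , σ , σ≡F∩G)) (sym (S-nonadjacent {F} {G} ¬adj))

    laplacian : Matrix ℤ #ridges #ridges
    laplacian σ τ = sum (λ F → [ σ ∶ F ] * [ τ ∶ F ])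

    laplacian-symmetric : ∀ σ τ → laplacian σ τ ≡ laplacian τ σ
    laplacian-symmetric σ τ = sum-cong-≗ λ F → ℤ.*-comm [ σ ∶ F ] [ τ ∶ F ]

    module _ (ρ : Fin #ridges) where

      x : Vector ℤ #facets
      x F = [ ρ ∶ F ]

      y : Vector ℤ #ridges
      y σ = sum (λ F → [ σ ∶ F ] * x F)

      z t : Vector ℤ #facets
      z F = sum (λ σ → [ σ ∶ F ] * y σ)
      t F = sum (λ G → S F G * x G) ℤ.- (ℤ.+ fanDegree ρ ℤ.- ℤ.+ 1) * x F

      c : ℤ
      c = ℤ.+ fanDegree ρ + ℤ.+ size

      -- `z` is BᵀB x = (k + 1) x + S x; moving (D - 1) x out of S x makes the coefficient D + k and
      -- leaves `t`.
      z≡cx+t : ∀ F → z F ≡ c * x F + t F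
      z≡cx+t F = begin
        sum (λ σ → [ σ ∶ F ] * sum (λ G → [ σ ∶ G ] * x G))
          ≡⟨ dot-*ᵛ (λ σ G → [ σ ∶ G ]) (λ σ → [ σ ∶ F ]) x ⟩
        sum (λ G → sum (λ σ → [ σ ∶ G ] * [ σ ∶ F ]) * x G)      ≡⟨ sum-cong-≗ (λ G → trans
            (cong (_* x G) (trans (sum-cong-≗ λ σ → ℤ.*-comm [ σ ∶ G ] [ σ ∶ F ]) (gram F G)))
            (ℤ.*-distribʳ-+ (x G) (ℤ.+ 𝟙 (F Fin.≟ G) * ℤ.+ suc size) (S F G))) ⟩
        sum (λ G → δ G * x G + S F G * x G)
          ≡⟨ ∑-distrib-+ (λ G → δ G * x G) (λ G → S F G * x G) ⟩
        sum (λ G → δ G * x G) + T                                ≡⟨ cong (_+ T) (trans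
            (sum-single (λ G → δ G * x G) F (λ G G≢F → cong (λ i → ℤ.+ i * ℤ.+ suc size * x G) (𝟙-no (F Fin.≟ G) (G≢F ∘ sym))))
            (trans (cong (λ i → ℤ.+ i * ℤ.+ suc size * x F) (𝟙-yes (F Fin.≟ F) refl)) (cong (_* x F) (ℤ.*-identityˡ (ℤ.+ suc size))))) ⟩
        ℤ.+ suc size * x F + T
          ≡⟨ regroup (ℤ.+ size) (x F) T (ℤ.+ fanDegree ρ) ⟩
        c * x F + t F                                            ∎
        where
        open ≡-Reasoning
        T = sum (λ G → S F G * x G)
        δ : Vector ℤ #facets
        δ G = ℤ.+ 𝟙 (F Fin.≟ G) * ℤ.+ suc size
        regroup : ∀ s x T d → (1ℤ + s) * x + T ≡ (d + s) * x + (T ℤ.- (d ℤ.- 1ℤ) * x)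
        regroup = solve-∀

      -- Orthogonality holds entry by entry: `x` vanishes off the fan, and `t` vanishes on it by
      -- `fan-row`.
      x*t≡0 : ∀ F → x F * t F ≡ 0ℤ
      x*t≡0 F with ρ ◁? F
      ... | no ¬ρ◁F = trans (cong (_* t F) (incidence-outside {ρ} {F} ¬ρ◁F)) (ℤ.*-zeroˡ (t F))
      ... | yes ρ◁F = trans (cong (x F *_) (trans (cong (ℤ._- d) (fan-row ρ F ρ◁F)) (ℤ.+-inverseʳ d))) (ℤ.*-zeroʳ (x F))
        where d = (ℤ.+ fanDegree ρ ℤ.- ℤ.+ 1) * x F

      -- yᵀLy = |Bᵀy|² = |z|². Expanding one side through z = c x + t, the mixed term drops out by
      -- `x*t≡0`, and z · x = |y|² because z = Bᵀy and y = B x.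
      rayleigh-excess : sum (λ σ → y σ * sum (λ τ → laplacian σ τ * y τ)) ≡
                        c * sum (λ σ → y σ * y σ) + sum (λ F → t F * t F)
      rayleigh-excess = begin
        sum (λ σ → y σ * sum (λ τ → laplacian σ τ * y τ))
          ≡⟨ sum-cong-≗ (λ σ → cong (y σ *_) (sym (rows σ))) ⟩
        sum (λ σ → y σ * sum (λ F → [ σ ∶ F ] * z F))          ≡⟨ dot-*ᵛ (λ σ F → [ σ ∶ F ]) y z ⟩
        sum (λ F → z F * z F)                                  ≡⟨ sum-cong-≗ pointwise ⟩
        sum (λ F → c * (z F * x F) + t F * t F)
          ≡⟨ ∑-distrib-+ (λ F → c * (z F * x F)) (λ F → t F * t F) ⟩
        sum (λ F → c * (z F * x F)) + sum (λ F → t F * t F)    ≡⟨ cong (_+ sum (λ F → t F * t F)) (trans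
            (sym (*-distribˡ-sum c (λ F → z F * x F))) (cong (c *_) (sym (dot-*ᵛ (λ σ F → [ σ ∶ F ]) y x)))) ⟩
        c * sum (λ σ → y σ * y σ) + sum (λ F → t F * t F)      ∎
        where
        open ≡-Reasoning
        rows : ∀ σ → sum (λ F → [ σ ∶ F ] * z F) ≡ sum (λ τ → laplacian σ τ * y τ)
        rows σ = trans (dot-*ᵛ (λ F τ → [ τ ∶ F ]) (λ F → [ σ ∶ F ]) y)
          (sum-cong-≗ λ τ → cong (_* y τ) (sum-cong-≗ λ F → ℤ.*-comm [ τ ∶ F ] [ σ ∶ F ]))
        pointwise : ∀ F → z F * z F ≡ c * (z F * x F) + t F * t F
        pointwise F = begin
          z F * z F                                              ≡⟨ cong (λ u → u * u) (z≡cx+t F) ⟩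
          (c * x F + t F) * (c * x F + t F)                      ≡⟨ expand c (x F) (t F) ⟩
          c * ((c * x F + t F) * x F) + t F * t F + c * (x F * t F)
            ≡⟨ cong₂ (λ u v → c * (u * x F) + t F * t F + c * v) (sym (z≡cx+t F)) (x*t≡0 F) ⟩
          c * (z F * x F) + t F * t F + c * 0ℤ
            ≡⟨ trans (cong (c * (z F * x F) + t F * t F +_) (ℤ.*-zeroʳ c)) (ℤ.+-identityʳ _) ⟩
          c * (z F * x F) + t F * t F                            ∎
          where
          expand : ∀ c x t → (c * x + t) * (c * x + t) ≡ c * ((c * x + t) * x) + t * t + c * (x * t)
          expand = solve-∀

      -- By `rayleigh-excess` the bound leaves |t|² ≤ 0, and a sum of integer squares that is at
      -- most 0 has only zero entries.
      rayleigh-bound⇒eigenvector :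
        sum (λ σ → y σ * sum (λ τ → laplacian σ τ * y τ)) ℤ.≤ c * sum (λ σ → y σ * y σ) → IsFanEigenvector ρ
      rayleigh-bound⇒eigenvector bound F = ℤ.i-j≡0⇒i≡j _ _ (sum²≤0⇒≡0 t squares≤0 F)
        where
        open ℤ.≤-Reasoning
        e = c * sum (λ σ → y σ * y σ)
        q = sum (λ σ → y σ * sum (λ τ → laplacian σ τ * y τ))
        squares≤0 : sum (λ F → t F * t F) ℤ.≤ 0ℤ
        squares≤0 = begin
          sum (λ F → t F * t F)                  ≡⟨ isolate e (sum (λ F → t F * t F)) ⟩
          (e + sum (λ F → t F * t F)) ℤ.- e      ≡⟨ cong (ℤ._- e) (sym rayleigh-excess) ⟩
          q ℤ.- e                                ≤⟨ ℤ.+-monoˡ-≤ (ℤ.- e) bound ⟩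
          e ℤ.- e                                ≡⟨ ℤ.+-inverseʳ e ⟩
          0ℤ                                     ∎
          where
          isolate : ∀ e s → s ≡ (e + s) ℤ.- e
          isolate = solve-∀

-- Transfer between integer, rational and real statements

open import Data.Integer using (+_; _-_)
open import Data.Nat using (ℕ; _≤_; _+_)
open import Data.Fin using (zero; suc)
open import Data.Fin.Subset using (_∩_)
open import Data.Fin.Subset.Properties using (p─q⊆p)
open import Data.Integer as ℤ using (ℤ; 0ℤ)
import Data.Integer.Properties as ℤ
import Data.Nat as ℕ
import Data.Nat.Properties as ℕ
open import Data.Rational as ℚ using (ℚ; 0ℚ; _/_)
import Data.Rational.Properties as ℚ
open import Data.Vec.Functional using (Vector)
open import Relation.Binary.Definitions using (tri<; tri≈; tri>)
open import Tactic.RingSolver using (solve-∀)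
import Algebra.Properties.Semiring.Sum ℤ.+-*-semiring as ∑ℤ
import Algebra.Properties.Semiring.Sum (CommutativeRing.semiring ℚ.+-*-commutativeRing) as ∑ℚ
open RayleighBound
open OrderingSigns
open FanVectors

/1-homo-sum : ∀ {n} (f : Vector ℤ n) → ∑ℤ.sum f / 1 ≡ ∑ℚ.sum (λ i → f i / 1)
/1-homo-sum {ℕ.zero}  f = refl
/1-homo-sum {ℕ.suc n} f = trans (/1-homo-+ (f zero) (∑ℤ.sum (f ∘ suc))) (cong (f zero / 1 ℚ.+_) (/1-homo-sum (f ∘ suc)))

/1-homo-dot : ∀ {n} (f g : Vector ℤ n) → ∑ℤ.sum (λ i → f i ℤ.* g i) / 1 ≡ dot (λ i → f i / 1) (λ i → g i / 1)
/1-homo-dot f g = trans (/1-homo-sum (λ i → f i ℤ.* g i)) (∑ℚ.sum-cong-≗ λ i → /1-homo-* (f i) (g i))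

p-q≡0⇒p≡q : ∀ {p q} → p ℚ.- q ≡ 0ℚ → p ≡ q
p-q≡0⇒p≡q {p} {q} eq = trans (add-back p q) (trans (cong (ℚ._+ q) eq) (ℚ.+-identityˡ q))
  where
  add-back : ∀ p q → p ≡ p ℚ.- q ℚ.+ q
  add-back = solve-∀ ℚ-ring

-- If |p - q| were positive, closeness with this ε would make it smaller than itself. Through this
-- the real eigenvector equation becomes an integer one.
constant-≃ᵣ : ∀ {x y p q} → (∀ t → seq x t ≡ p / 1) → (∀ t → seq y t ≡ q / 1) → (x ≃ᵣ y) ⇔ (p ≡ q)
constant-≃ᵣ {x} {y} {p} {q} x≡p y≡q = mk⇔ to λ { refl → ≃ᵣ-pointwise {x} {y} (λ t → trans (x≡p t) (sym (y≡q t))) }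
  where
  d = ℚ.∣ p / 1 ℚ.- q / 1 ∣
  to : x ≃ᵣ y → p ≡ q
  to x≃y with ℚ.<-cmp 0ℚ d
  ... | tri≈ _ 0≡d _ = /1-injective (p-q≡0⇒p≡q (ℚ.∣p∣≡0⇒p≡0 _ (sym 0≡d)))
  ... | tri> _ _ d<0 = contradiction (ℚ.≤-<-trans (ℚ.0≤∣p∣ (p / 1 ℚ.- q / 1)) d<0) (ℚ.<-irrefl refl)
  ... | tri< 0<d _ _ with x≃y d 0<d
  ...   | T , close = contradiction (subst₂ (λ u v → ℚ.∣ u ℚ.- v ∣ ℚ.< d) (x≡p T) (y≡q T) (close T ℕ.≤-refl)) (ℚ.<-irrefl refl)

seq-if : ∀ {P : Set} (P? : Dec P) {z} → (¬ P → z ≡ 0ℤ) → ∀ t →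
         seq (if does P? then fromℤ z else fromℤ 0ℤ) t ≡ z / 1
seq-if (yes _) _    t = refl
seq-if (no ¬p) z≡0 t = cong (_/ 1) (sym (z≡0 ¬p))

module _ {n} (K : SimplicialComplex n) (k : ℕ) (o : Orientation K) where

  signedIncidence : SignedIncidence n
  signedIncidence = record
    { #ridges = #faces K k ; #facets = #faces K (ℕ.suc k) ; size = k
    ; rset = ridge K k ; fset = facet K k
    ; rset-injective = vertices-injective K k
    ; fset-injective = vertices-injective K (ℕ.suc k)
    ; ∣rset∣ = ∣vertices∣ K k
    ; ∣fset∣ = ∣vertices∣ K (ℕ.suc k)
    ; removal-index = λ F v∈F → face-index K k
        (down-closed K (p─q⊆p (facet K k F) _) (vertices-isFace K (ℕ.suc k) F))
        (ℕ.suc-injective (trans (sym (∣p∣≡1+∣p-x∣ v∈F)) (∣vertices∣ K (ℕ.suc k) F)))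
    ; [_∶_] = incidence K k o
    ; ridgeSign = λ σ → orderingSign (o k σ)
    ; facetSign = λ F → orderingSign (o (ℕ.suc k) F)
    ; ridgeSign² = λ σ → sg² (inversionCount (vertex (o k σ)))
    ; facetSign² = λ F → sg² (inversionCount (vertex (o (ℕ.suc k) F)))
    ; incidence-removal = λ {σ} {F} → Incidence.incidence-removal K k o {σ} {F}
    ; incidence-outside = λ {σ} {F} → Incidence.incidence-outside K k o {σ} {F}
    ; S = signedAdjacency K k o
    ; S-adjacent = λ {F} {G} {R} → S-adjacent {F} {G} {R}
    ; S-nonadjacent = λ {F} {G} → S-nonadjacent {F} {G}
    }
    where
    S-adjacent : ∀ {F G R} → F ≢ G → ridge K k R ≡ facet K k F ∩ facet K k G →
                 signedAdjacency K k o F G ≡ incidence K k o R F ℤ.* incidence K k o R G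
    S-adjacent {F} {G} {R} F≢G R≡F∩G with adjacent? K k F G
    ... | yes (_ , R′ , R′≡F∩G) = cong (λ σ → incidence K k o σ F ℤ.* incidence K k o σ G)
            (vertices-injective K k (trans R′≡F∩G (sym R≡F∩G)))
    ... | no ¬adj = contradiction (F≢G , R , R≡F∩G) ¬adj

    S-nonadjacent : ∀ {F G} → ¬ Adjacent K k F G → signedAdjacency K k o F G ≡ 0ℤ
    S-nonadjacent {F} {G} ¬adj with adjacent? K k F G
    ... | yes adj = contradiction adj ¬adj
    ... | no _    = refl

  open SignedIncidence signedIncidence using ([_∶_]; S; incidence-outside)
  open FanVector signedIncidence using (IsFanEigenvector; clean⇔eigenvector)
  module G = Gram signedIncidence

  seq-fanVector : ∀ ρ F t → seq (fanVector K k o ρ F) t ≡ [ ρ ∶ F ] / 1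
  seq-fanVector ρ F = seq-if (inFan? K k ρ F) (incidence-outside {ρ} {F})

  real-eigenvector⇔ : ∀ ρ →
    (realMatrix (signedAdjacency K k o) *ᵛ fanVector K k o ρ
      ≋ fromℤ (+ degree K k ρ - + 1) • fanVector K k o ρ) ⇔ IsFanEigenvector ρ
  real-eigenvector⇔ ρ = mk⇔ (λ eigen F → Equivalence.to (entry F) (eigen F)) (λ eigen F → Equivalence.from (entry F) (eigen F))
    where
    c = + degree K k ρ - + 1
    lhs : ∀ F t → seq ((realMatrix (signedAdjacency K k o) *ᵛ fanVector K k o ρ) F) t ≡ ∑ℤ.sum (λ G → S F G ℤ.* [ ρ ∶ G ]) / 1
    lhs F t = trans (seq-*ᵛ (realMatrix (signedAdjacency K k o)) (fanVector K k o ρ) F t)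
      (trans (∑ℚ.sum-cong-≗ λ G → cong (S F G / 1 ℚ.*_) (seq-fanVector ρ G t))
        (sym (/1-homo-dot (S F) (λ G → [ ρ ∶ G ]))))
    rhs : ∀ F t → seq ((fromℤ c • fanVector K k o ρ) F) t ≡ (c ℤ.* [ ρ ∶ F ]) / 1
    rhs F t = trans (cong (c / 1 ℚ.*_) (seq-fanVector ρ F t)) (sym (/1-homo-* c [ ρ ∶ F ]))
    entry : ∀ F → _ ⇔ _
    entry F = constant-≃ᵣ {(realMatrix (signedAdjacency K k o) *ᵛ fanVector K k o ρ) F} {(fromℤ c • fanVector K k o ρ) F} (lhs F) (rhs F)

  clean⇔real-eigenvector : ∀ ρ → Clean K k ρ ⇔
    (realMatrix (signedAdjacency K k o) *ᵛ fanVector K k o ρ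
      ≋ fromℤ (+ degree K k ρ - + 1) • fanVector K k o ρ)
  clean⇔real-eigenvector ρ = mk⇔
    (Equivalence.from (real-eigenvector⇔ ρ) ∘ Equivalence.to (clean⇔eigenvector ρ))
    (Equivalence.from (clean⇔eigenvector ρ) ∘ Equivalence.to (real-eigenvector⇔ ρ))

  -- The Rayleigh bound is tested at the single vector y = B x_ρ. Its entries are integers, so the
  -- rational inequality descends to ℤ.
  eigenvalue-bound⇒clean : ∀ ρ →
    (∀ ν → IsEigenvalue (realMatrix (upLaplacian K k o)) ν → ν ≤ᵣ fromℤ (+ (degree K k ρ + k))) → Clean K k ρ
  eigenvalue-bound⇒clean ρ bounded = Equivalence.from (clean⇔eigenvector ρ) (G.rayleigh-bound⇒eigenvector ρ (/1-cancel-≤ bound))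
    where
    L : Matrix ℤ (#faces K k) (#faces K k)
    L = upLaplacian K k o
    A : Matrix ℚ (#faces K k) (#faces K k)
    A σ τ = L σ τ / 1
    y = G.y ρ
    v = λ σ → y σ / 1
    ∣y∣² = ∑ℤ.sum (λ σ → y σ ℤ.* y σ)
    Ly = λ σ → ∑ℤ.sum (λ τ → L σ τ ℤ.* y τ)
    c = + (degree K k ρ + k)
    form : ∑ℤ.sum (λ σ → y σ ℤ.* Ly σ) / 1 ≡ quadraticForm A v
    form = trans (/1-homo-dot y Ly) (∑ℚ.sum-cong-≗ λ σ → cong (y σ / 1 ℚ.*_) (/1-homo-dot (L σ) y))
    bound : ∑ℤ.sum (λ σ → y σ ℤ.* Ly σ) / 1 ℚ.≤ (c ℤ.* ∣y∣²) / 1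
    bound = subst₂ ℚ._≤_ (sym form) (sym (trans (/1-homo-* c ∣y∣²) (cong (c / 1 ℚ.*_) (/1-homo-dot y y))))
      (rayleigh-bound A (λ σ τ → cong (_/ 1) (G.laplacian-symmetric σ τ)) (c / 1) bounded v)

proposition4p11 : ∀ {n : ℕ} (K : SimplicialComplex n) (k : ℕ) → 1 ≤ k → HasDimension K k →
    (o : Orientation K) (D : ℕ) → IsMaximumDegree K k D →
    ((ρ : Ridge K k) → degree K k ρ ≡ D →
    (Clean K k ρ ⇔
    (realMatrix (signedAdjacency K k o) *ᵛ fanVector K k o ρ
    ≋ fromℤ (+ D - + 1) • fanVector K k o ρ)))
    ×
    (IsLargestEigenvalue (realMatrix (upLaplacian K k o)) (fromℤ (+ (D + k))) →
    (ρ : Ridge K k) → degree K k ρ ≡ D → Clean K k ρ)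
proposition4p11 K k _ _ o _ _ =
  (λ { ρ refl → clean⇔real-eigenvector K k o ρ }) ,
  (λ { (_ , bounded) ρ refl → eigenvalue-bound⇒clean K k o ρ bounded })
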